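{- Let $n\ge2$ and let $w=w_1w_2\cdots w_n\in\mathfrak{B}_n$. Then $w$ is minimal non-separable if and only if the following conditions hold: (a) $w_1w_2\cdots w_{n-1}$ avoids the patterns $\underline{2}1$ and $2\underline{1}$, and $w$ avoids the patterns $3142$, $2413$, $\underline{3}\,\underline{1}\,\underline{4}\,\underline{2}$, and $\underline{2}\,\underline{4}\,\underline{1}\,\underline{3}$; (b) there exists $i\in[n-1]$ such that $$\mathrm{sts}(w_iw_n)=\begin{cases}\underline{2}1,&\text{if }w_n>0,\\ 2\underline{1},&\text{if }w_n<0,\end{cases}$$ and for any $j,k,l$ with $1\le j<k<l<n$ we have $$\mathrm{sts}(w_jw_kw_lw_n)\notin\begin{cases}\{13\underline{4}2,\ 2\underline{3}41,\ \underline{1}3\underline{4}2,\ \underline{2}3\underline{4}1\},&\text{if }w_n>0,\\ \{\underline{1}\,\underline{3}4\underline{2},\ \underline{2}3\underline{4}\,\underline{1},\ 1\underline{3}4\underline{2},\ 2\underline{3}4\underline{1}\},&\text{if }w_n<0.\end{cases}$$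
   Context: Notation: $[n]=\{1,\dots,n\}$; an underlined number is negative, $\underline{k}=-k$. $\mathfrak{B}_n$ is the group (under composition, $(uv)(i)=u(v(i))$) of signed permutations of $[n]$, i.e. bijections $w$ of $\{\pm1,\dots,\pm n\}$ with $w(-i)=-w(i)$; one-line notation is $w=w_1\cdots w_n$ with $w_i=w(i)$, $i\in[n]$. $\mathfrak{B}_n$ is the Weyl group of type $B_n$, acting on $\mathbb{R}^n$ by $we_i=e_{w_i}$ with $e_{ -i}=-e_i$, with root system $\Phi=\{\pm e_i\mid i\in[n]\}\cup\{\pm e_i\pm e_j\mid 1\le i<j\le n\}$, positive roots $\Phi^+=\{\pm e_i+e_j\mid 1\le i<j\le n\}\cup\{e_i\mid i\in[n]\}$, and simple roots $\Delta=\{\alpha_0=e_1\}\cup\{\alpha_i=-e_i+e_{i+1}\mid i\in[n-1]\}$. Separable elements: let $\Phi$ be a crystallographic root system with simple system $\Delta$, positive system $\Phi^+$ and Weyl group $W(\Phi)$. $I_\Phi(w)=\{\alpha\in\Phi^+\mid w\alpha\in-\Phi^+\}$; on $\Phi^+$, $\alpha\le\beta$ iff $\beta-\alpha$ is a nonnegative integral combination of simple roots. For a linear subspace $V$ of $\mathrm{span}(\Phi)$ and $\Phi'=\Phi\cap V$ (with positive system $\Phi^+\cap V$), $w|_{\Phi'}$ is the unique $w'\in W(\Phi')$ with $I_{\Phi'}(w')=I_\Phi(w)\cap V$. An element $w\in W(\Phi)$ is separable (recursively) if one of the following holds: (S1) $\Phi$ is of type $A_1$; (S2) $\Phi=\bigoplus\Phi_i$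 is reducible and $w|_{\Phi_i}$ is separable for each $i$; (S3) $\Phi$ is irreducible and there exists $\alpha_i\in\Delta$ such that $w|_{\Phi_J}\in W(\Phi_J)$ is separable, where $\Phi_J$ is the subsystem generated by $J=\Delta\setminus\{\alpha_i\}$, and either $\{\beta\in\Phi^+\mid\beta\ge\alpha_i\}\subset I_\Phi(w)$ (equality allowed) or $\{\beta\in\Phi^+\mid\beta\ge\alpha_i\}\cap I_\Phi(w)=\emptyset$. (The identity of the trivial group is regarded as separable.) Minimal non-separable: for $J\subseteq\Delta$, $W_J$ is the parabolic subgroup generated by $s_\alpha$, $\alpha\in J$ (the Weyl group of $\Phi_J$), and $w=w^Jw_J$ is the unique factorization with $w_J\in W_J$ and $w^J$ of minimal length in $wW_J$; one has $w_J=w|_{\Phi_J}$. An element $w$ of a Weyl group $W$ is minimal non-separable if $w$ is not separable but $w_J\in W_J$ is separable for all $J\subsetneq\Delta$. Patterns: for a sequence $a=a_1\cdots a_m$ of nonzero reals, the standard signed permutation $\mathrm{sts}(a)$ is the unique $v\in\mathfrak{B}_m$ with $\{i\mid v_i<0\}=\{i\mid a_i<0\}$ and, for all $1\le i<j\le m$, $|v_i|<|v_j|\Leftrightarrow|a_i|\le|a_j|$. A sequence $w_1\cdots w_r$ contains the pattern $u\in\mathfrak{B}_m$ if there are $1\le i_1<\cdots<i_m\le r$ with $\mathrm{sts}(w_{i_1}\cdots w_{i_m})=u$; otherwise it avoids $u$. -}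

module Defs where

open import Algebra.Definitions.RawMonoid using (sum)
open import Data.Bool.Base using (if_then_else_)
open import Data.Fin.Base as Fin using (Fin; zero; suc; inject₁)
open import Data.Fin.Properties using (_≟_)
open import Data.Fin.Subset using (Subset; _∈_; _∉_; _⊆_; _⊂_; _-_; ⊤; Empty; Nonempty)
open import Data.Integer.Base as ℤ using (ℤ; +_; -_; ∣_∣; _◃_; 0ℤ; 1ℤ; -1ℤ)
open import Data.List.Base as List using (List)
open import Data.List.Relation.Unary.Any using (Any)
open import Data.Nat.Base as ℕ using (ℕ; zero; suc)
open import Data.Product.Base using (Σ; ∃; ∃-syntax; Σ-syntax; _×_; _,_)
open import Data.Sign.Base as Sign using (Sign)
open import Data.Sum.Base using (_⊎_)
open import Data.Vec.Base as Vec using (Vec; lookup)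
open import Data.Vec.Functional using (Vector; init; last; []; _∷_)
open import Function.Base using (_∘_)
open import Function.Bundles using (_↔_; _⇔_; Inverse)
open import Relation.Binary.PropositionalEquality using (_≡_; _≗_)
open import Relation.Nullary.Decidable using (does)
open import Relation.Nullary.Negation using (¬_)

------------------------------------------------------------------------
-- Signed permutations

-- (s , i) stands for the element s(i+1) of {±1,…,±n}.
Letter : ℕ → Set
Letter n = Sign × Fin n

neg : ∀ {n} → Letter n → Letter n
neg (s , i) = Sign.opposite s , i

value : ∀ {n} → Letter n → ℤ
value (s , i) = s ◃ suc (Fin.toℕ i)

record 𝔅 (n : ℕ) : Set where
  field
    bijection : Letter n ↔ Letter n
    odd       : ∀ x → Inverse.to bijection (neg x) ≡ neg (Inverse.to bijection x)

infixl 9 _⟨_⟩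
_⟨_⟩ : ∀ {n} → 𝔅 n → Letter n → Letter n
w ⟨ x ⟩ = Inverse.to (𝔅.bijection w) x

-- Records of type 𝔅 n also carry proofs, so equality in the group is
-- pointwise equality of the underlying maps.
infix 4 _≡_·_
_≡_·_ : ∀ {n} → 𝔅 n → 𝔅 n → 𝔅 n → Set
w ≡ u · v = ∀ x → w ⟨ x ⟩ ≡ u ⟨ v ⟨ x ⟩ ⟩

IsIdentity : ∀ {n} → 𝔅 n → Set
IsIdentity w = ∀ x → w ⟨ x ⟩ ≡ x

oneLine : ∀ {n} → 𝔅 n → Vector ℤ n
oneLine w i = value (w ⟨ Sign.+ , i ⟩)

------------------------------------------------------------------------
-- The root system of type Bₙ

-- All roots lie in the lattice ℤⁿ ⊂ ℝⁿ, which 𝔅 n preserves.  Vectors are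
-- functions and are compared pointwise.
V : ℕ → Set
V n = Vector ℤ n

Σℤ : ∀ {n} → Vector ℤ n → ℤ
Σℤ = sum ℤ.+-0-rawMonoid

infixl 6 _⊞_ _⊟_
_⊞_ _⊟_ : ∀ {n} → V n → V n → V n
(u ⊞ v) k = u k ℤ.+ v k
(u ⊟ v) k = u k ℤ.- v k

infixr 7 _⊡_
_⊡_ : ∀ {n} → ℤ → V n → V n
(c ⊡ v) k = c ℤ.* v k

⊖_ : ∀ {n} → V n → V n
(⊖ v) k = - v k

∑ : ∀ {m n} → (Fin m → V n) → V n
∑ f k = Σℤ (λ i → f i k)

⟪_,_⟫ : ∀ {n} → V n → V n → ℤ
⟪ u , v ⟫ = Σℤ (λ k → u k ℤ.* v k)

-- e (- , i) is the vector −eᵢ, following the convention e₋ᵢ = −eᵢ.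
e : ∀ {n} → Letter n → V n
e (s , i) k = if does (i ≟ k) then s ◃ 1 else 0ℤ

infixr 8 _•_
_•_ : ∀ {n} → 𝔅 n → V n → V n
w • v = ∑ (λ i → v i ⊡ e (w ⟨ Sign.+ , i ⟩))

data Root {n} (v : V n) : Set where
  short : ∀ s i → v ≗ e (s , i) → Root v
  long  : ∀ s t {i j} → i Fin.< j → v ≗ e (s , i) ⊞ e (t , j) → Root v

data PositiveRoot {n} (v : V n) : Set where
  short : ∀ i → v ≗ e (Sign.+ , i) → PositiveRoot v
  long  : ∀ s {i j} → i Fin.< j → v ≗ e (s , i) ⊞ e (Sign.+ , j) → PositiveRoot v

-- The index set of Δ = {α₀,…,αₙ₋₁} is Fin n.
α : ∀ {n} → Fin n → V n
α zero    = e (Sign.+ , zero)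
α (suc i) = e (Sign.- , inject₁ i) ⊞ e (Sign.+ , suc i)

-- J : Subset n stands for the set of simple roots αᵢ, i ∈ J.  Since Δ is a
-- ℤ-basis of ℤⁿ, a lattice vector is in the real span of J if and only if
-- it is an integral combination of J.
Span : ∀ {n} → Subset n → V n → Set
Span {n} J v =
  Σ[ c ∈ (Fin n → ℤ) ] (∀ i → i ∉ J → c i ≡ 0ℤ) × v ≗ ∑ (λ i → c i ⊡ α i)

Φ : ∀ {n} → Subset n → V n → Set
Φ J v = Root v × Span J v

Φ⁺ : ∀ {n} → Subset n → V n → Set
Φ⁺ J v = PositiveRoot v × Span J v

-- γ ≤ β in the order of Φ⁺ J, whose simple system is J.
Dominates : ∀ {n} → Subset n → V n → V n → Set
Dominates {n} J β γ =
  Σ[ c ∈ (Fin n → ℕ) ] (∀ i → i ∉ J → c i ≡ 0) × β ⊟ γ ≗ ∑ (λ i → + c i ⊡ α i)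

Inversion : ∀ {n} → Subset n → 𝔅 n → V n → Set
Inversion J w β = Φ⁺ J β × Φ⁺ J (⊖ (w • β))

------------------------------------------------------------------------
-- Parabolic subgroups

-- s v = v − (2⟨v,β⟩/⟨β,β⟩) β, with the denominator cleared.
IsReflection : ∀ {n} → V n → 𝔅 n → Set
IsReflection β s = ∀ v → ⟪ β , β ⟫ ⊡ (v ⊟ s • v) ≗ (+ 2 ℤ.* ⟪ v , β ⟫) ⊡ β

-- Word J k w: w is a product of k simple reflections s_α with α ∈ J.
data Word {n} (J : Subset n) : ℕ → 𝔅 n → Set where
  one  : ∀ {w} → IsIdentity w → Word J 0 w
  cons : ∀ {k i s u w} → i ∈ J → IsReflection (α i) s → Word J k u →
         w ≡ s · u → Word J (suc k) w

-- The generators are involutions, so no inverses are needed.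
InW : ∀ {n} → Subset n → 𝔅 n → Set
InW J w = ∃[ k ] Word J k w

-- u has an expression that is no longer than any expression, in the
-- generators of the whole group, of any element of wW_J.
MinimalInCoset : ∀ {n} → 𝔅 n → Subset n → 𝔅 n → Set
MinimalInCoset w J u =
  ∃[ k ] Word ⊤ k u × (∀ {x v m} → InW J v → x ≡ w · v → Word ⊤ m x → k ℕ.≤ m)

-- w = uv is the factorization w = w^J w_J; membership of u in wW_J is
-- implied by the first two fields.
record ParabolicFactorization {n} (J : Subset n) (w u v : 𝔅 n) : Set where
  field
    product : w ≡ u · v
    inW     : InW J v
    minimal : MinimalInCoset w J u

------------------------------------------------------------------------
-- Separable elements

-- Restricts J w C w′: w′ = w|_{Φ_C}, for w ∈ W_J and C ⊆ J.
Restricts : ∀ {n} → Subset n → 𝔅 n → Subset n → 𝔅 n → Set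
Restricts J w C w′ =
  InW C w′ × (∀ β → Inversion C w′ β ⇔ (Inversion J w β × Span C β))

TypeA₁ : ∀ {n} → Subset n → Set
TypeA₁ J = ∃[ γ ] Φ J γ × (∀ β → Φ J β → β ≗ γ ⊎ β ≗ ⊖ γ)

-- Φ_J = Φ_A ⊕ Φ_B with both summands nonzero.
record _≡_⊕_ {n} (J A B : Subset n) : Set where
  field
    A⊆J        : A ⊆ J
    B⊆J        : B ⊆ J
    nonemptyA  : Nonempty A
    nonemptyB  : Nonempty B
    cover      : ∀ β → Φ J β → Φ A β ⊎ Φ B β
    orthogonal : ∀ β γ → Φ A β → Φ B γ → ⟪ β , γ ⟫ ≡ 0ℤ

Reducible : ∀ {n} → Subset n → Set
Reducible J = ∃[ A ] ∃[ B ] J ≡ A ⊕ B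

Irreducible : ∀ {n} → Subset n → Set
Irreducible J = Nonempty J × ¬ Reducible J

-- Irreducible components of a reducible Φ_J.
Component : ∀ {n} → Subset n → Subset n → Set
Component J C = Irreducible C × ∃[ B ] J ≡ C ⊕ B

-- Separable J w: w ∈ W_J is separable as an element of W(Φ_J).  The recursion
-- only ever reaches subsystems Φ_J with J ⊆ Δ, because irreducible components
-- of Φ_J and the subsystems generated by J ∖ {αᵢ} are again of this form.
data Separable {n} (J : Subset n) (w : 𝔅 n) : Set where
  trivial     : Empty J → Separable J w
  typeA₁      : TypeA₁ J → Separable J w
  reducible   : Reducible J →
                (∀ C → Component J C →
                  ∃[ w′ ] Restricts J w C w′ × Separable C w′) →
                Separable J w
  irreducible : Irreducible J → ∀ i → i ∈ J →
                (∃[ w′ ] Restricts J w (J - i) w′ × Separable (J - i) w′) →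
                (∀ β → Φ⁺ J β → Dominates J β (α i) → Inversion J w β) ⊎
                (∀ β → Φ⁺ J β → Dominates J β (α i) → ¬ Inversion J w β) →
                Separable J w

MinimalNonSeparable : ∀ {n} → 𝔅 n → Set
MinimalNonSeparable w =
  ¬ Separable ⊤ w ×
  (∀ J → J ⊂ ⊤ → ∃[ u ] ∃[ v ] ParabolicFactorization J w u v × Separable J v)

------------------------------------------------------------------------
-- Patterns

IsSts : ∀ {m} → Vector ℤ m → 𝔅 m → Set
IsSts a v =
  (∀ i → oneLine v i ℤ.< 0ℤ ⇔ a i ℤ.< 0ℤ) ×
  (∀ i j → i Fin.< j →
    ∣ oneLine v i ∣ ℕ.< ∣ oneLine v j ∣ ⇔ ∣ a i ∣ ℕ.≤ ∣ a j ∣)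

-- sts a ≐ p: the one-line notation of sts(a) is p.
infix 4 sts_≐_
sts_≐_ : ∀ {m} → Vector ℤ m → Vec ℤ m → Set
sts a ≐ p = ∃[ v ] IsSts a v × oneLine v ≗ lookup p

Contains : ∀ {r m} → Vector ℤ r → Vec ℤ m → Set
Contains {r} {m} a p =
  Σ[ f ∈ (Fin m → Fin r) ] (∀ i j → i Fin.< j → f i Fin.< f j) × sts (a ∘ f) ≐ p

Avoids : ∀ {r m} → Vector ℤ r → Vec ℤ m → Set
Avoids a p = ¬ Contains a p

p2 : ℤ → ℤ → Vec ℤ 2
p2 a b = a Vec.∷ b Vec.∷ Vec.[]

p4 : ℤ → ℤ → ℤ → ℤ → Vec ℤ 4
p4 a b c d = a Vec.∷ b Vec.∷ c Vec.∷ d Vec.∷ Vec.[]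

ConditionA : ∀ {m} → 𝔅 (suc m) → Set
ConditionA w =
  Avoids (init (oneLine w)) (p2 (- + 2) (+ 1)) ×
  Avoids (init (oneLine w)) (p2 (+ 2) (- + 1)) ×
  Avoids (oneLine w) (p4 (+ 3) (+ 1) (+ 4) (+ 2)) ×
  Avoids (oneLine w) (p4 (+ 2) (+ 4) (+ 1) (+ 3)) ×
  Avoids (oneLine w) (p4 (- + 3) (- + 1) (- + 4) (- + 2)) ×
  Avoids (oneLine w) (p4 (- + 2) (- + 4) (- + 1) (- + 3))

forbidden⁺ forbidden⁻ : List (Vec ℤ 4)
forbidden⁺ =
  p4 (+ 1)   (+ 3) (- + 4) (+ 2) List.∷
  p4 (+ 2)   (- + 3) (+ 4) (+ 1) List.∷
  p4 (- + 1) (+ 3) (- + 4) (+ 2) List.∷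
  p4 (- + 2) (+ 3) (- + 4) (+ 1) List.∷ List.[]
forbidden⁻ =
  p4 (- + 1) (- + 3) (+ 4) (- + 2) List.∷
  p4 (- + 2) (+ 3) (- + 4) (- + 1) List.∷
  p4 (+ 1)   (- + 3) (+ 4) (- + 2) List.∷
  p4 (+ 2)   (- + 3) (+ 4) (- + 1) List.∷ List.[]

ConditionB : ∀ {m} → 𝔅 (suc m) → Set
ConditionB {m} w =
  (∃[ i ] (0ℤ ℤ.< wₙ → sts pair i ≐ p2 (- + 2) (+ 1)) ×
          (wₙ ℤ.< 0ℤ → sts pair i ≐ p2 (+ 2) (- + 1))) ×
  (∀ j k l → j Fin.< k → k Fin.< l →
     (0ℤ ℤ.< wₙ → ¬ Any (sts quad j k l ≐_) forbidden⁺) ×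
     (wₙ ℤ.< 0ℤ → ¬ Any (sts quad j k l ≐_) forbidden⁻))
  where
  wₙ : ℤ
  wₙ = last (oneLine w)

  pair : Fin m → Vector ℤ 2
  pair i = init (oneLine w) i ∷ wₙ ∷ []

  quad : Fin m → Fin m → Fin m → Vector ℤ 4
  quad j k l =
    init (oneLine w) j ∷ init (oneLine w) k ∷ init (oneLine w) l ∷ wₙ ∷ []

{-# OPTIONS --safe #-}

-- Let x = w₁⋯wₙ.  Inversions translate into inequalities between the entries:
-- e_q is inverted iff x_q < 0, e_p + e_q iff x_p + x_q < 0, and e_q − e_p iff
-- x_q < x_p.  For w ∈ W_J, separability is equivalent to a pattern condition on
-- the roots of Φ_J: x_q and x_p + x_q have the same sign whenever p < q and
-- e_q ∈ Φ_J, and no 2413 or 3142 occurs among positions a < b < c < d with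
-- e_d − e_a ∈ Φ_J.  A pivot exists in a connected J of type B at the start of
-- the last block of constant sign, and in type A because permutations avoiding
-- 2413 and 3142 are direct or skew sums.  Since w_J has the same inversions as w
-- in Φ_J (by the exchange condition), w is minimal non-separable iff the
-- condition on signs holds in w₁⋯wₙ₋₁, fails for some pair (wᵢ, wₙ), and no
-- signed 2413 or 3142 occurs in w.  Under the sign condition the only possible
-- signed versions are those listed in (a) and (b); negation exchanges 2413 and
-- 3142.

module Submission where

open import Defs
open import Algebra.Bundles using (CommutativeSemiring)
open import Data.Bool.Base using (true)
open import Data.Empty using (⊥; ⊥-elim)
open import Data.Fin.Base as Fin using (Fin; zero; suc; inject₁; toℕ; fromℕ; fromℕ<)
open import Data.Fin.Properties as Finₚ using (_≟_; any?; all?)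
open import Data.Fin.Induction as Finᵢ using (<-weakInduction)
open import Data.Fin.Relation.Unary.Top using (view; ‵fromℕ; ‵inject₁)
open import Data.Fin.Subset using (Subset; _∈_; _∉_; _⊆_; _⊂_; ⊤; Nonempty) renaming (_-_ to _∖_; ∣_∣ to card)
open import Data.Fin.Subset.Properties as Subₚ using (_∈?_)
open import Data.Integer.Base as ℤ using (ℤ; +_; -[1+_]; +[1+_]; -_; _+_; _*_; _-_; _<_; _≤_; ∣_∣; _◃_; 0ℤ; 1ℤ; -1ℤ; +<+; -<+; +≤+; -≤+; -≤-)
open import Data.Integer.Properties as ℤₚ using ()
open import Data.Integer.Tactic.RingSolver using (solve-∀)
open import Data.List.Relation.Unary.Any using (here; there)
open import Data.Nat.Base as ℕ using (ℕ; zero; suc; z≤n; s≤s)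
open import Data.Nat.Induction using (<-wellFounded)
open import Data.Nat.Properties as ℕₚ using ()
open import Data.Product.Base using (∃-syntax; _×_; _,_; proj₁; proj₂; map₂)
open import Data.Product.Properties using (≡-dec)
open import Data.Sign.Base as Sign using (Sign; opposite)
open import Data.Sign.Properties as Signₚ using ()
open import Data.Sum.Base as Sum using (_⊎_; inj₁; inj₂; [_,_]′)
open import Data.Vec.Base as Vec using (Vec; lookup)
open import Data.Vec.Properties using (lookup∘tabulate; lookup-map; []=⇒lookup; lookup⇒[]=)
open import Data.Vec.Functional using (Vector; init; last; []; _∷_)
open import Function.Base using (_∘_; id; case_of_)
open import Function.Bundles using (_⇔_; Inverse; Equivalence; mk⇔; mk↔ₛ′)
open import Induction.WellFounded using (Acc; acc)
open import Relation.Binary.Definitions using (DecidableEquality; tri<; tri≈; tri>)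
open import Relation.Binary.PropositionalEquality using (_≡_; _≢_; _≗_; refl; sym; trans; cong; cong₂; subst; subst₂; module ≡-Reasoning)
open import Relation.Nullary.Decidable using (Dec; yes; no; does; _×-dec_; _→-dec_; _⊎-dec_; ¬?; from-yes)
open import Relation.Nullary.Negation using (¬_; contradiction)
open import Algebra.Properties.CommutativeMonoid.Sum ℤₚ.+-0-commutativeMonoid using (sum-cong-≗; ∑-distrib-+; ∑-comm)
open import Algebra.Properties.Semiring.Sum (CommutativeSemiring.semiring ℤₚ.+-*-commutativeSemiring) using (*-distribˡ-sum; *-distribʳ-sum)

-- The element w enters only through the linear functional `L w`, the height of w•v. A root has
-- nonzero height and is positive exactly when its height is positive, so inversions, cosets and
-- restrictions all become statements about signs of `L`. The obstacle is that `Separable` replaces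
-- w by a new element at every stage, while the pattern condition speaks of the entries of w.
-- Restricting to Φ_C changes these entries, but not the signs of `L` on the positive roots of Φ_C;
-- hence `Good` is phrased by signs on roots of Φ_J alone and passes from w to any restriction. The
-- same observation handles w_J, once minimal length in a coset is shown to mean that every α_i with
-- i ∈ J is kept positive. Proper J need not be searched one by one: dropping α₀ keeps all roots e_q
-- - e_p and so the whole 2413/3142 condition, dropping the last simple root keeps all e_q and e_p +
-- e_q with q < n, and no proper J admits a root of full support such as e_n. This is why only the
-- pairs (w_i, w_n) may violate the sign condition.

Σ-zero : ∀ {n} {f : Vector ℤ n} → (∀ i → f i ≡ 0ℤ) → Σℤ f ≡ 0ℤ
Σ-zero {zero}  p = refl
Σ-zero {suc n} p = cong₂ _+_ (p zero) (Σ-zero (p ∘ suc))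

Σ-nonneg : ∀ {n} {f : Vector ℤ n} → (∀ i → 0ℤ ≤ f i) → 0ℤ ≤ Σℤ f
Σ-nonneg {zero}  p = ℤₚ.≤-refl
Σ-nonneg {suc n} p = ℤₚ.+-mono-≤ (p zero) (Σ-nonneg (p ∘ suc))

-- Signed letters, pairings and heights

opposite-◃ : ∀ s m → opposite s ◃ m ≡ - (s ◃ m)
opposite-◃ Sign.+ m = trans (ℤₚ.-◃n≡-n m) (cong -_ (sym (ℤₚ.+◃n≡+n m)))
opposite-◃ Sign.- m = trans (ℤₚ.+◃n≡+n m) (trans (sym (ℤₚ.neg-involutive (+ m))) (cong -_ (sym (ℤₚ.-◃n≡-n m))))

value-neg : ∀ {n} (x : Letter n) → value (neg x) ≡ - value x
value-neg (s , i) = opposite-◃ s _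

neg-involutive : ∀ {n} (x : Letter n) → neg (neg x) ≡ x
neg-involutive (Sign.+ , i) = refl
neg-involutive (Sign.- , i) = refl

neg≢id : ∀ {n} (x : Letter n) → neg x ≢ x
neg≢id (Sign.+ , i) ()
neg≢id (Sign.- , i) ()

-- Coordinates are extended oddly to negative letters, so that the action and the reflections can be
-- described without splitting on signs.
coord : ∀ {n} → V n → Letter n → ℤ
coord v (s , i) = (s ◃ 1) * v i

coord-+ : ∀ {n} (v : V n) i → coord v (Sign.+ , i) ≡ v i
coord-+ v i = ℤₚ.*-identityˡ (v i)

coord-neg : ∀ {n} (v : V n) x → coord v (neg x) ≡ - coord v x
coord-neg v (Sign.+ , i) = trans (ℤₚ.-1*i≡-i (v i)) (cong -_ (sym (ℤₚ.*-identityˡ (v i))))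
coord-neg v (Sign.- , i) = trans (ℤₚ.*-identityˡ (v i)) (trans (sym (ℤₚ.neg-involutive (v i))) (cong -_ (sym (ℤₚ.-1*i≡-i (v i)))))

e-self : ∀ {n} s (i : Fin n) → e (s , i) i ≡ s ◃ 1
e-self s i with i ≟ i
... | yes _ = refl
... | no ¬p = contradiction refl ¬p

e-other : ∀ {n} s {i k : Fin n} → i ≢ k → e (s , i) k ≡ 0ℤ
e-other s {i} {k} i≢k with i ≟ k
... | yes p = contradiction p i≢k
... | no _  = refl

e-neg : ∀ {n} (x : Letter n) → e (neg x) ≗ ⊖ e x
e-neg (s , i) k with i ≟ k
... | yes _ = opposite-◃ s 1
... | no  _ = refl

e-injective : ∀ {n} {x y : Letter n} → e x ≗ e y → x ≡ y
e-injective {x = s , i} {t , j} p with i ≟ j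
... | no i≢j = contradiction (trans (sym (e-self s i)) (trans (p i) (e-other t (i≢j ∘ sym)))) (nonzero s)
  where
  nonzero : ∀ s → s ◃ 1 ≢ 0ℤ
  nonzero Sign.+ ()
  nonzero Sign.- ()
... | yes refl = cong (_, i) (signs s t (trans (sym (e-self s i)) (trans (p i) (e-self t i))))
  where
  signs : ∀ s t → s ◃ 1 ≡ t ◃ 1 → s ≡ t
  signs Sign.+ Sign.+ _ = refl
  signs Sign.- Sign.- _ = refl

pairing-e : ∀ {n} (v : V n) x → ⟪ v , e x ⟫ ≡ coord v x
pairing-e {suc n} v (s , zero) =
  trans (cong₂ _+_ (ℤₚ.*-comm (v zero) (s ◃ 1)) (Σ-zero {f = λ k → v (suc k) * 0ℤ} λ k → ℤₚ.*-zeroʳ (v (suc k))))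
        (ℤₚ.+-identityʳ _)
pairing-e {suc n} v (s , suc i) =
  trans (cong₂ _+_ (ℤₚ.*-zeroʳ (v zero)) (pairing-e (v ∘ suc) (s , i))) (ℤₚ.+-identityˡ _)

pairing-comm : ∀ {n} (u v : V n) → ⟪ u , v ⟫ ≡ ⟪ v , u ⟫
pairing-comm u v = sum-cong-≗ λ k → ℤₚ.*-comm (u k) (v k)

pairing-⊞ʳ : ∀ {n} (u v w : V n) → ⟪ u , v ⊞ w ⟫ ≡ ⟪ u , v ⟫ + ⟪ u , w ⟫
pairing-⊞ʳ u v w = trans (sum-cong-≗ λ k → ℤₚ.*-distribˡ-+ (u k) (v k) (w k)) (∑-distrib-+ (λ k → u k * v k) (λ k → u k * w k))

-- L w v is the pairing of w•v with (1,…,n), that is, its height.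
L : ∀ {n} → 𝔅 n → V n → ℤ
L w v = ⟪ v , oneLine w ⟫

L-cong : ∀ {n} (w : 𝔅 n) {u v : V n} → u ≗ v → L w u ≡ L w v
L-cong w p = sum-cong-≗ λ k → cong (_* oneLine w k) (p k)

L-⊞ : ∀ {n} (w : 𝔅 n) (u v : V n) → L w (u ⊞ v) ≡ L w u + L w v
L-⊞ w u v = trans (sum-cong-≗ λ k → ℤₚ.*-distribʳ-+ (oneLine w k) (u k) (v k)) (∑-distrib-+ (λ k → u k * oneLine w k) (λ k → v k * oneLine w k))

L-⊡ : ∀ {n} (w : 𝔅 n) c (v : V n) → L w (c ⊡ v) ≡ c * L w v
L-⊡ w c v = trans (sum-cong-≗ λ k → ℤₚ.*-assoc c (v k) (oneLine w k)) (sym (*-distribˡ-sum c (λ k → v k * oneLine w k)))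

⊖≗-1⊡ : ∀ {n} (v : V n) → ⊖ v ≗ -1ℤ ⊡ v
⊖≗-1⊡ v k = sym (ℤₚ.-1*i≡-i (v k))

L-⊖ : ∀ {n} (w : 𝔅 n) (v : V n) → L w (⊖ v) ≡ - L w v
L-⊖ w v = trans (L-cong w (⊖≗-1⊡ v)) (trans (L-⊡ w -1ℤ v) (ℤₚ.-1*i≡-i (L w v)))

L-⊟ : ∀ {n} (w : 𝔅 n) (u v : V n) → L w (u ⊟ v) ≡ L w u - L w v
L-⊟ w u v = trans (L-⊞ w u (⊖ v)) (cong₂ _+_ {x = L w u} refl (L-⊖ w v))

L-e : ∀ {n} (w : 𝔅 n) x → L w (e x) ≡ value (w ⟨ x ⟩)
L-e w (Sign.+ , i) = trans (pairing-comm (e (Sign.+ , i)) (oneLine w)) (trans (pairing-e (oneLine w) (Sign.+ , i)) (coord-+ (oneLine w) i))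
L-e w (Sign.- , i) = trans (L-cong w (e-neg (Sign.+ , i))) (trans (L-⊖ w (e (Sign.+ , i)))
  (trans (cong -_ (L-e w (Sign.+ , i))) (trans (sym (value-neg (w ⟨ Sign.+ , i ⟩))) (cong value (sym (𝔅.odd w (Sign.+ , i)))))))

•-cong : ∀ {n} (w : 𝔅 n) {u v : V n} → u ≗ v → w • u ≗ w • v
•-cong w p k = sum-cong-≗ λ i → cong (_* e (w ⟨ Sign.+ , i ⟩) k) (p i)

•-⊞ : ∀ {n} (w : 𝔅 n) (u v : V n) → w • (u ⊞ v) ≗ (w • u) ⊞ (w • v)
•-⊞ w u v k = trans (sum-cong-≗ λ i → ℤₚ.*-distribʳ-+ (e (w ⟨ Sign.+ , i ⟩) k) (u i) (v i)) (∑-distrib-+ (λ i → u i * _) (λ i → v i * _))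

•-e : ∀ {n} (w : 𝔅 n) x → w • e x ≗ e (w ⟨ x ⟩)
•-e w (s , i) k = trans (pairing-comm (e (s , i)) (λ j → e (w ⟨ Sign.+ , j ⟩) k)) (trans (pairing-e (λ j → e (w ⟨ Sign.+ , j ⟩) k) (s , i)) (go s))
  where
  go : ∀ s → (s ◃ 1) * e (w ⟨ Sign.+ , i ⟩) k ≡ e (w ⟨ s , i ⟩) k
  go Sign.+ = ℤₚ.*-identityˡ _
  go Sign.- = trans (ℤₚ.-1*i≡-i _) (trans (sym (e-neg (w ⟨ Sign.+ , i ⟩) k)) (cong (λ y → e y k) (sym (𝔅.odd w (Sign.+ , i)))))

-- The group 𝔅 n

id𝔅 : ∀ {n} → 𝔅 n
id𝔅 = record { bijection = mk↔ₛ′ id id (λ _ → refl) (λ _ → refl) ; odd = λ _ → refl }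

infixl 8 _⊙_
_⊙_ : ∀ {n} → 𝔅 n → 𝔅 n → 𝔅 n
u ⊙ v = record
  { bijection = mk↔ₛ′ (λ x → u ⟨ v ⟨ x ⟩ ⟩)
      (λ x → Inverse.from (𝔅.bijection v) (Inverse.from (𝔅.bijection u) x))
      (λ x → trans (cong (u ⟨_⟩) (Inverse.strictlyInverseˡ (𝔅.bijection v) _)) (Inverse.strictlyInverseˡ (𝔅.bijection u) x))
      (λ x → trans (cong (Inverse.from (𝔅.bijection v)) (Inverse.strictlyInverseʳ (𝔅.bijection u) _)) (Inverse.strictlyInverseʳ (𝔅.bijection v) x))
  ; odd = λ x → trans (cong (u ⟨_⟩) (𝔅.odd v x)) (𝔅.odd u (v ⟨ x ⟩))
  }

⟨⟩-injective : ∀ {n} (w : 𝔅 n) {x y} → w ⟨ x ⟩ ≡ w ⟨ y ⟩ → x ≡ y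
⟨⟩-injective w {x} {y} p = trans (sym (Inverse.strictlyInverseʳ (𝔅.bijection w) x)) (trans (cong (Inverse.from (𝔅.bijection w)) p) (Inverse.strictlyInverseʳ (𝔅.bijection w) y))

infix 9 _⁻¹
_⁻¹ : ∀ {n} → 𝔅 n → 𝔅 n
w ⁻¹ = record
  { bijection = mk↔ₛ′ (Inverse.from (𝔅.bijection w)) (w ⟨_⟩) (Inverse.strictlyInverseʳ (𝔅.bijection w)) (Inverse.strictlyInverseˡ (𝔅.bijection w))
  ; odd = λ x → ⟨⟩-injective w (trans (Inverse.strictlyInverseˡ (𝔅.bijection w) (neg x))
            (sym (trans (𝔅.odd w (Inverse.from (𝔅.bijection w) x)) (cong neg (Inverse.strictlyInverseˡ (𝔅.bijection w) x)))))
  }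

⁻¹-inverseˡ : ∀ {n} (w : 𝔅 n) x → (w ⁻¹) ⟨ w ⟨ x ⟩ ⟩ ≡ x
⁻¹-inverseˡ w = Inverse.strictlyInverseʳ (𝔅.bijection w)

⁻¹-inverseʳ : ∀ {n} (w : 𝔅 n) x → w ⟨ (w ⁻¹) ⟨ x ⟩ ⟩ ≡ x
⁻¹-inverseʳ w = Inverse.strictlyInverseˡ (𝔅.bijection w)

L-• : ∀ {n} (u w : 𝔅 n) (v : V n) → L u (w • v) ≡ L (u ⊙ w) v
L-• u w v = begin
  Σℤ (λ k → Σℤ (λ i → v i * e (w ⟨ Sign.+ , i ⟩) k) * oneLine u k)
    ≡⟨ sum-cong-≗ (λ k → *-distribʳ-sum (oneLine u k) (λ i → v i * e (w ⟨ Sign.+ , i ⟩) k)) ⟩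
  Σℤ (λ k → Σℤ (λ i → v i * e (w ⟨ Sign.+ , i ⟩) k * oneLine u k))
    ≡⟨ ∑-comm (λ k i → v i * e (w ⟨ Sign.+ , i ⟩) k * oneLine u k) ⟩
  Σℤ (λ i → Σℤ (λ k → v i * e (w ⟨ Sign.+ , i ⟩) k * oneLine u k))
    ≡⟨ sum-cong-≗ (λ i → trans (sum-cong-≗ λ k → ℤₚ.*-assoc (v i) (e (w ⟨ Sign.+ , i ⟩) k) (oneLine u k))
                               (sym (*-distribˡ-sum (v i) (λ k → e (w ⟨ Sign.+ , i ⟩) k * oneLine u k)))) ⟩
  Σℤ (λ i → v i * L u (e (w ⟨ Sign.+ , i ⟩)))
    ≡⟨ sum-cong-≗ (λ i → cong (v i *_) (L-e u (w ⟨ Sign.+ , i ⟩))) ⟩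
  L (u ⊙ w) v ∎
  where open ≡-Reasoning

L-∑ : ∀ {m n} (w : 𝔅 n) (c : Fin m → ℤ) (f : Fin m → V n) → L w (∑ (λ i → c i ⊡ f i)) ≡ Σℤ (λ i → c i * L w (f i))
L-∑ w c f = begin
  Σℤ (λ k → Σℤ (λ i → c i * f i k) * oneLine w k)
    ≡⟨ sum-cong-≗ (λ k → *-distribʳ-sum (oneLine w k) (λ i → c i * f i k)) ⟩
  Σℤ (λ k → Σℤ (λ i → c i * f i k * oneLine w k))
    ≡⟨ ∑-comm (λ k i → c i * f i k * oneLine w k) ⟩
  Σℤ (λ i → Σℤ (λ k → c i * f i k * oneLine w k))
    ≡⟨ sum-cong-≗ (λ i → L-⊡ w (c i) (f i)) ⟩
  Σℤ (λ i → c i * L w (f i)) ∎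
  where open ≡-Reasoning

-- Coefficients with respect to the simple roots

combination : ∀ {n} → (Fin n → ℤ) → V n
combination c = ∑ (λ j → c j ⊡ α j)

-- tailSum i v = vᵢ + vᵢ₊₁ + … is the coefficient of αᵢ in v.
tailSum : ∀ {n} → ℕ → V n → ℤ
tailSum {zero}  _       _ = 0ℤ
tailSum {suc n} zero    v = Σℤ v
tailSum {suc n} (suc i) v = tailSum i (v ∘ suc)

coeff : ∀ {n} → V n → Fin n → ℤ
coeff v i = tailSum (toℕ i) v

tailSum-zero : ∀ {n} (v : V n) → tailSum 0 v ≡ Σℤ v
tailSum-zero {zero}  v = refl
tailSum-zero {suc n} v = refl

tailSum-cong : ∀ {n} i {u v : V n} → u ≗ v → tailSum i u ≡ tailSum i v
tailSum-cong {zero}  i       p = refl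
tailSum-cong {suc n} zero    p = sum-cong-≗ p
tailSum-cong {suc n} (suc i) p = tailSum-cong i (p ∘ suc)

tailSum-⊞ : ∀ {n} i (u v : V n) → tailSum i (u ⊞ v) ≡ tailSum i u + tailSum i v
tailSum-⊞ {zero}  i       u v = refl
tailSum-⊞ {suc n} zero    u v = ∑-distrib-+ u v
tailSum-⊞ {suc n} (suc i) u v = tailSum-⊞ i (u ∘ suc) (v ∘ suc)

tailSum-⊡ : ∀ {n} i c (v : V n) → tailSum i (c ⊡ v) ≡ c * tailSum i v
tailSum-⊡ {zero}  i       c v = sym (ℤₚ.*-zeroʳ c)
tailSum-⊡ {suc n} zero    c v = sym (*-distribˡ-sum c v)
tailSum-⊡ {suc n} (suc i) c v = tailSum-⊡ i c (v ∘ suc)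

tailSum-⊖ : ∀ {n} i (v : V n) → tailSum i (⊖ v) ≡ - tailSum i v
tailSum-⊖ i v = trans (tailSum-cong i (⊖≗-1⊡ v)) (trans (tailSum-⊡ i -1ℤ v) (ℤₚ.-1*i≡-i _))

tailSum-⊟ : ∀ {n} i (u v : V n) → tailSum i (u ⊟ v) ≡ tailSum i u - tailSum i v
tailSum-⊟ i u v = trans (tailSum-⊞ i u (⊖ v)) (cong₂ _+_ {x = tailSum i u} refl (tailSum-⊖ i v))

-- Consecutive tail sums telescope. Hence an entry vanishes as soon as the two neighbouring
-- coefficients do, which later gives the orthogonality of components.
entry-tailSum : ∀ {n} (v : V n) k → v k ≡ tailSum (toℕ k) v - tailSum (suc (toℕ k)) v
entry-tailSum {suc n} v zero = trans (lemma (v zero) (Σℤ (v ∘ suc))) (cong (λ z → Σℤ v - z) (sym (tailSum-zero (v ∘ suc))))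
  where
  lemma : ∀ a b → a ≡ (a + b) - b
  lemma = solve-∀
entry-tailSum {suc n} v (suc k) = entry-tailSum (v ∘ suc) k

tailSum-e-≤ : ∀ {n} i s (k : Fin n) → i ℕ.≤ toℕ k → tailSum i (e (s , k)) ≡ s ◃ 1
tailSum-e-≤ {suc n} zero s zero p = trans (cong₂ _+_ {x = s ◃ 1} refl (Σ-zero {n} {λ _ → 0ℤ} λ _ → refl)) (ℤₚ.+-identityʳ _)
tailSum-e-≤ zero s (suc k) p = trans (ℤₚ.+-identityˡ _) (trans (sym (tailSum-zero (e (s , k)))) (tailSum-e-≤ zero s k z≤n))
tailSum-e-≤ (suc i) s (suc k) (s≤s p) = tailSum-e-≤ i s k p

tailSum-e-> : ∀ {n} i s (k : Fin n) → toℕ k ℕ.< i → tailSum i (e (s , k)) ≡ 0ℤ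
tailSum-e-> {suc n} (suc i) s zero p = trans (tailSum-cong {n} i {v = λ _ → 0ℤ} λ _ → refl) (go n i)
  where
  go : ∀ n i → tailSum {n} i (λ _ → 0ℤ) ≡ 0ℤ
  go zero i = refl
  go (suc n) zero = Σ-zero {suc n} λ _ → refl
  go (suc n) (suc i) = go n i
tailSum-e-> (suc i) s (suc k) (s≤s p) = tailSum-e-> i s k p

-- Deleting coordinate 0 removes the -e₁ from α₁ = e₂ - e₁ and turns the simple system into the one
-- of rank one less; the inductions on rank rest on this.
α-shift : ∀ {n} (i k : Fin n) → α (suc i) (suc k) ≡ α i k
α-shift zero    k = ℤₚ.+-identityˡ _
α-shift (suc i) k = refl

combination-suc : ∀ {n} (c : Fin (suc n) → ℤ) k → combination c (suc k) ≡ combination (c ∘ suc) k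
combination-suc c k = trans (cong₂ _+_ (ℤₚ.*-zeroʳ (c zero)) (sum-cong-≗ λ i → cong (c (suc i) *_) (α-shift i k))) (ℤₚ.+-identityˡ _)

-- Proved together with `Σ-combination`: entry 0 of a combination is c₀ - c₁, and c₁ is the total of
-- the shifted combination, which is the other statement in smaller rank.
combination-zero : ∀ {n} (c : Fin (suc n) → ℤ) → combination c zero ≡ c zero - tailSum 0 (combination (c ∘ suc))
Σ-combination : ∀ {n} (c : Fin (suc n) → ℤ) → Σℤ (combination c) ≡ c zero

combination-zero {zero} c = cong₂ _+_ (ℤₚ.*-identityʳ (c zero)) refl
combination-zero {suc n} c = cong₂ _+_ (ℤₚ.*-identityʳ (c zero))
  (trans (cong₂ _+_ {x = c (suc zero) * -1ℤ} refl (Σ-zero λ i → ℤₚ.*-zeroʳ (c (suc (suc i)))))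
  (trans (lemma (c (suc zero))) (cong -_ (sym (Σ-combination (c ∘ suc))))))
  where
  lemma : ∀ a → a * -1ℤ + 0ℤ ≡ - a
  lemma = solve-∀

Σ-combination c = trans (cong₂ _+_ (combination-zero c) (trans (sum-cong-≗ (combination-suc c)) (sym (tailSum-zero (combination (c ∘ suc)))))) (lemma (c zero) (tailSum 0 (combination (c ∘ suc))))
  where
  lemma : ∀ a b → a - b + b ≡ a
  lemma = solve-∀

coeff-combination : ∀ {n} (c : Fin n → ℤ) i → coeff (combination c) i ≡ c i
coeff-combination c zero    = Σ-combination c
coeff-combination c (suc i) = trans (tailSum-cong (toℕ i) (combination-suc c)) (coeff-combination (c ∘ suc) i)

combination-coeff : ∀ {n} (v : V n) → v ≗ combination (coeff v)
combination-coeff {suc n} v zero = trans (entry-tailSum v zero) (trans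
  (cong (λ z → Σℤ v - z) (tailSum-cong 0 {u = v ∘ suc} (combination-coeff (v ∘ suc)))) (sym (combination-zero (coeff v))))
combination-coeff v (suc k) = trans (combination-coeff (v ∘ suc) k) (sym (combination-suc (coeff v) k))

coeff-α-self : ∀ {n} (i : Fin n) → coeff (α i) i ≡ 1ℤ
coeff-α-self {suc n} zero = tailSum-e-≤ {suc n} 0 Sign.+ zero z≤n
coeff-α-self (suc i) = trans (tailSum-⊞ (suc (toℕ i)) (e (Sign.- , inject₁ i)) (e (Sign.+ , suc i)))
  (cong₂ _+_ (tailSum-e-> (suc (toℕ i)) Sign.- (inject₁ i) (s≤s (ℕₚ.≤-reflexive (Finₚ.toℕ-inject₁ i))))
             (tailSum-e-≤ (suc (toℕ i)) Sign.+ (suc i) ℕₚ.≤-refl))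

coeff-α-other : ∀ {n} {i j : Fin n} → i ≢ j → coeff (α i) j ≡ 0ℤ
coeff-α-other {i = zero}  {zero}  i≢j = contradiction refl i≢j
coeff-α-other {suc n} {i = zero}  {suc j} i≢j = tailSum-e-> {suc n} (suc (toℕ j)) Sign.+ zero (s≤s z≤n)
coeff-α-other {suc (suc n)} {i = suc i} {zero}  i≢j =
  trans (tailSum-⊞ 0 (e (Sign.- , inject₁ i)) (e (Sign.+ , suc i)))
        (cong₂ _+_ (tailSum-e-≤ 0 Sign.- (inject₁ i) z≤n) (tailSum-e-≤ 0 Sign.+ (suc i) z≤n))
coeff-α-other {i = suc i} {suc j} i≢j = trans (tailSum-cong (toℕ j) (α-shift i)) (coeff-α-other {i = i} {j} (i≢j ∘ cong suc))

-- Coefficients in a basis are unique, so the existential in `Span` can be traded for the vanishing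
-- of explicit tail sums.
Span⇒coeff : ∀ {n} {J : Subset n} {v} → Span J v → ∀ i → i ∉ J → coeff v i ≡ 0ℤ
Span⇒coeff (c , c≡0 , v≗) i i∉J = trans (tailSum-cong (toℕ i) v≗) (trans (coeff-combination c i) (c≡0 i i∉J))

coeff⇒Span : ∀ {n} {J : Subset n} {v} → (∀ i → i ∉ J → coeff v i ≡ 0ℤ) → Span J v
coeff⇒Span {v = v} p = coeff v , p , combination-coeff v

Span-cong : ∀ {n} {J : Subset n} {u v} → u ≗ v → Span J u → Span J v
Span-cong u≗v (c , c≡0 , p) = c , c≡0 , λ k → trans (sym (u≗v k)) (p k)

Span-⊖ : ∀ {n} {J : Subset n} {v} → Span J v → Span J (⊖ v)
Span-⊖ {v = v} s = coeff⇒Span λ i i∉J → trans (tailSum-⊖ (toℕ i) v) (cong -_ (Span⇒coeff s i i∉J))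

Span-mono : ∀ {n} {J K : Subset n} {v} → J ⊆ K → Span J v → Span K v
Span-mono J⊆K (c , c≡0 , p) = c , (λ i i∉K → c≡0 i (i∉K ∘ J⊆K)) , p

Span-⊤ : ∀ {n} (v : V n) → Span ⊤ v
Span-⊤ v = coeff⇒Span λ i i∉⊤ → contradiction Subₚ.∈⊤ i∉⊤

Span-α : ∀ {n} {J : Subset n} {i} → i ∈ J → Span J (α i)
Span-α {i = i} i∈J = coeff⇒Span λ j j∉J → coeff-α-other {i = i} {j} λ { refl → j∉J i∈J }

-- Roots

i≮i : ∀ {i : ℤ} → ¬ i < i
i≮i = ℤₚ.<-irrefl refl

-‿pos : ∀ {i} → i < 0ℤ → 0ℤ < - i
-‿pos p = ℤₚ.neg-mono-< p

-‿neg : ∀ {i} → 0ℤ < i → - i < 0ℤ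
-‿neg p = ℤₚ.neg-mono-< p

neg-pos : ∀ {i} → 0ℤ < - i → i < 0ℤ
neg-pos {i} p = subst (_< 0ℤ) (ℤₚ.neg-involutive i) (-‿neg p)

≢0⇒sign : ∀ {i} → i ≢ 0ℤ → i < 0ℤ ⊎ 0ℤ < i
≢0⇒sign {i} i≢0 with ℤₚ.<-cmp i 0ℤ
... | tri< p _ _ = inj₁ p
... | tri≈ _ p _ = contradiction p i≢0
... | tri> _ _ p = inj₂ p

gap : ∀ {a b} → a < b → 0ℤ < b - a
gap {a} {b} p = subst (_< b - a) (ℤₚ.+-inverseʳ a) (ℤₚ.+-monoˡ-< (- a) p)

ungap : ∀ {a b} → 0ℤ < b - a → a < b
ungap {a} {b} p = subst₂ _<_ (ℤₚ.+-identityˡ a) (lemma a b) (ℤₚ.+-monoˡ-< a p)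
  where
  lemma : ∀ a b → b - a + a ≡ b
  lemma = solve-∀

opposite-value : ∀ {n} (x y : Letter n) → value x + value y ≡ 0ℤ → x ≡ neg y
opposite-value (Sign.+ , i) (Sign.- , j) p = cong (Sign.+ ,_) (Finₚ.toℕ-injective (ℤₚ.+-injective (ℤₚ.i-j≡0⇒i≡j (+ toℕ i) (+ toℕ j) (trans (ℤₚ.m-n≡m⊖n (toℕ i) (toℕ j)) (trans (sym (ℤₚ.[1+m]⊖[1+n]≡m⊖n (toℕ i) (toℕ j))) p)))))
opposite-value (Sign.- , i) (Sign.+ , j) p = cong (Sign.- ,_) (sym (Finₚ.toℕ-injective (ℤₚ.+-injective (ℤₚ.i-j≡0⇒i≡j (+ toℕ j) (+ toℕ i) (trans (ℤₚ.m-n≡m⊖n (toℕ j) (toℕ i)) (trans (sym (ℤₚ.[1+m]⊖[1+n]≡m⊖n (toℕ j) (toℕ i))) p))))))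

value≢0 : ∀ {n} (x : Letter n) → value x ≢ 0ℤ
value≢0 (Sign.+ , i) ()
value≢0 (Sign.- , i) ()

same-index : ∀ {n} (x y : Letter n) → proj₂ x ≡ proj₂ y → x ≡ y ⊎ x ≡ neg y
same-index (Sign.+ , i) (Sign.+ , .i) refl = inj₁ refl
same-index (Sign.+ , i) (Sign.- , .i) refl = inj₂ refl
same-index (Sign.- , i) (Sign.+ , .i) refl = inj₂ refl
same-index (Sign.- , i) (Sign.- , .i) refl = inj₁ refl

index-injective : ∀ {n} (w : 𝔅 n) x y → proj₂ (w ⟨ x ⟩) ≡ proj₂ (w ⟨ y ⟩) → proj₂ x ≡ proj₂ y
index-injective w x y p with same-index (w ⟨ x ⟩) (w ⟨ y ⟩) p
... | inj₁ q = cong proj₂ (⟨⟩-injective w q)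
... | inj₂ q = cong proj₂ (⟨⟩-injective w (trans q (sym (𝔅.odd w y))))

⊞-comm : ∀ {n} (u v : V n) → u ⊞ v ≗ v ⊞ u
⊞-comm u v k = ℤₚ.+-comm (u k) (v k)

Root-cong : ∀ {n} {u v : V n} → u ≗ v → Root u → Root v
Root-cong p (short s i q)    = short s i λ k → trans (sym (p k)) (q k)
Root-cong p (long s t i<j q) = long s t i<j λ k → trans (sym (p k)) (q k)

positive⇒root : ∀ {n} {v : V n} → PositiveRoot v → Root v
positive⇒root (short i p)    = short Sign.+ i p
positive⇒root (long s i<j p) = long s Sign.+ i<j p

pair-root : ∀ {n} (x y : Letter n) → proj₂ x ≢ proj₂ y → Root (e x ⊞ e y)
pair-root (s , i) (t , j) i≢j with Finₚ.<-cmp i j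
... | tri< i<j _ _ = long s t i<j λ _ → refl
... | tri≈ _ i≡j _ = contradiction i≡j i≢j
... | tri> _ _ j<i = long t s j<i (⊞-comm (e (s , i)) (e (t , j)))

<⇒≢ : ∀ {n} {i j : Fin n} → i Fin.< j → i ≢ j
<⇒≢ i<j refl = ℕₚ.<-irrefl refl i<j

•-pair : ∀ {n} (w : 𝔅 n) x y → w • (e x ⊞ e y) ≗ e (w ⟨ x ⟩) ⊞ e (w ⟨ y ⟩)
•-pair w x y k = trans (•-⊞ w (e x) (e y) k) (cong₂ _+_ (•-e w x k) (•-e w y k))

•-root : ∀ {n} (w : 𝔅 n) {v} → Root v → Root (w • v)
•-root w (short s i p) = short (proj₁ (w ⟨ s , i ⟩)) (proj₂ (w ⟨ s , i ⟩)) λ k → trans (•-cong w p k) (•-e w (s , i) k)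
•-root w (long s t {i} {j} i<j p) = Root-cong (λ k → sym (trans (•-cong w p k) (•-pair w (s , i) (t , j) k)))
  (pair-root (w ⟨ s , i ⟩) (w ⟨ t , j ⟩) (<⇒≢ i<j ∘ index-injective w (s , i) (t , j)))

root-cases : ∀ {n} {v : V n} → Root v → PositiveRoot v ⊎ PositiveRoot (⊖ v)
root-cases (short Sign.+ i p)      = inj₁ (short i p)
root-cases (short Sign.- i p)      = inj₂ (short i λ k → trans (cong -_ (p k)) (sym (e-neg (Sign.- , i) k)))
root-cases (long s Sign.+ i<j p)   = inj₁ (long s i<j p)
root-cases (long s Sign.- {i} {j} i<j p) = inj₂ (long (opposite s) i<j λ k →
  trans (cong -_ (p k)) (trans (ℤₚ.neg-distrib-+ (e (s , i) k) (e (Sign.- , j) k)) (cong₂ _+_ (sym (e-neg (s , i) k)) (sym (e-neg (Sign.- , j) k)))))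

positive⇒height>0 : ∀ {n} {v : V n} → PositiveRoot v → 0ℤ < L id𝔅 v
positive⇒height>0 (short i p) = subst (0ℤ <_) (sym (trans (L-cong id𝔅 p) (L-e id𝔅 (Sign.+ , i)))) (+<+ (s≤s z≤n))
positive⇒height>0 (long s {i} {j} i<j p) = subst (0ℤ <_)
  (sym (trans (L-cong id𝔅 p) (trans (L-⊞ id𝔅 (e (s , i)) (e (Sign.+ , j))) (cong₂ _+_ (L-e id𝔅 (s , i)) (L-e id𝔅 (Sign.+ , j)))))) (go s)
  where
  go : ∀ s → 0ℤ < value (s , i) + value (Sign.+ , j)
  go Sign.+ = +<+ (s≤s z≤n)
  go Sign.- = subst₂ _<_ (ℤₚ.n⊖n≡0 (suc (toℕ i))) refl (ℤₚ.⊖-monoˡ-< (suc (toℕ i)) (s≤s i<j))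

L-id-• : ∀ {n} (w : 𝔅 n) v → L id𝔅 (w • v) ≡ L w v
L-id-• w v = L-• id𝔅 w v

positive-•⇒L>0 : ∀ {n} (w : 𝔅 n) {v} → PositiveRoot (w • v) → 0ℤ < L w v
positive-•⇒L>0 w {v} p = subst (0ℤ <_) (L-id-• w v) (positive⇒height>0 p)

negative-•⇒L<0 : ∀ {n} (w : 𝔅 n) {v} → PositiveRoot (⊖ (w • v)) → L w v < 0ℤ
negative-•⇒L<0 w {v} p = neg-pos (subst (0ℤ <_) (trans (L-⊖ id𝔅 (w • v)) (cong -_ (L-id-• w v))) (positive⇒height>0 p))

-- The image of a root is again a root, hence positive or the negative of a positive one, and
-- positive roots have positive height.
L≢0 : ∀ {n} (w : 𝔅 n) {v} → Root v → L w v ≢ 0ℤ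
L≢0 w {v} r with root-cases (•-root w r)
... | inj₁ p = λ q → i≮i (subst (0ℤ <_) q (positive-•⇒L>0 w {v} p))
... | inj₂ p = λ q → i≮i (subst (_< 0ℤ) q (negative-•⇒L<0 w {v} p))

L<0⇒negative-• : ∀ {n} (w : 𝔅 n) {v} → Root v → L w v < 0ℤ → PositiveRoot (⊖ (w • v))
L<0⇒negative-• w {v} r q with root-cases (•-root w r)
... | inj₁ p = ⊥-elim (ℤₚ.<-asym q (positive-•⇒L>0 w {v} p))
... | inj₂ p = p

α-positive : ∀ {n} (i : Fin n) → PositiveRoot (α i)
α-positive zero    = short zero λ _ → refl
α-positive (suc i) = long Sign.- (s≤s (ℕₚ.≤-reflexive (Finₚ.toℕ-inject₁ i))) λ _ → refl

α-root : ∀ {n} (i : Fin n) → Root (α i)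
α-root i = positive⇒root (α-positive i)

-- Coefficients and supports of positive roots

coeff-short-≤ : ∀ {n} {i q : Fin n} → i Fin.≤ q → coeff (e (Sign.+ , q)) i ≡ 1ℤ
coeff-short-≤ {q = q} = tailSum-e-≤ _ Sign.+ q

coeff-short-> : ∀ {n} {i q : Fin n} → q Fin.< i → coeff (e (Sign.+ , q)) i ≡ 0ℤ
coeff-short-> {q = q} = tailSum-e-> _ Sign.+ q

module _ {n} (s : Sign) {i p q : Fin n} (p<q : p Fin.< q) where
  private
    split : coeff (e (s , p) ⊞ e (Sign.+ , q)) i ≡ coeff (e (s , p)) i + coeff (e (Sign.+ , q)) i
    split = tailSum-⊞ (toℕ i) (e (s , p)) (e (Sign.+ , q))

  coeff-long-low : i Fin.≤ p → coeff (e (s , p) ⊞ e (Sign.+ , q)) i ≡ (s ◃ 1) + 1ℤ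
  coeff-long-low i≤p = trans split (cong₂ _+_ (tailSum-e-≤ (toℕ i) s p i≤p) (coeff-short-≤ {i = i} {q} (ℕₚ.≤-trans i≤p (ℕₚ.<⇒≤ p<q))))

  coeff-long-mid : p Fin.< i → i Fin.≤ q → coeff (e (s , p) ⊞ e (Sign.+ , q)) i ≡ 1ℤ
  coeff-long-mid p<i i≤q = trans split (cong₂ _+_ (tailSum-e-> (toℕ i) s p p<i) (coeff-short-≤ {i = i} {q} i≤q))

  coeff-long-high : q Fin.< i → coeff (e (s , p) ⊞ e (Sign.+ , q)) i ≡ 0ℤ
  coeff-long-high q<i = trans split (cong₂ _+_ (tailSum-e-> (toℕ i) s p (ℕₚ.<-trans p<q q<i)) (coeff-short-> {i = i} {q} q<i))

coeff-nonneg : ∀ {n} {v : V n} → PositiveRoot v → ∀ i → 0ℤ ≤ coeff v i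
coeff-nonneg (short q p) i with ℕₚ.≤-<-connex (toℕ i) (toℕ q)
... | inj₁ i≤q = subst (0ℤ ≤_) (sym (trans (tailSum-cong (toℕ i) p) (coeff-short-≤ {i = i} {q} i≤q))) (+≤+ z≤n)
... | inj₂ q<i = ℤₚ.≤-reflexive (sym (trans (tailSum-cong (toℕ i) p) (coeff-short-> {i = i} {q} q<i)))
coeff-nonneg (long s {p} {q} p<q v≗) i with ℕₚ.≤-<-connex (toℕ i) (toℕ p) | ℕₚ.≤-<-connex (toℕ i) (toℕ q)
... | inj₁ i≤p | _ = subst (0ℤ ≤_) (sym (trans (tailSum-cong (toℕ i) v≗) (coeff-long-low s {i} p<q i≤p))) (go s)
  where
  go : ∀ s → 0ℤ ≤ (s ◃ 1) + 1ℤ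
  go Sign.+ = +≤+ z≤n
  go Sign.- = +≤+ z≤n
... | inj₂ p<i | inj₁ i≤q = subst (0ℤ ≤_) (sym (trans (tailSum-cong (toℕ i) v≗) (coeff-long-mid s {i} p<q p<i i≤q))) (+≤+ z≤n)
... | inj₂ p<i | inj₂ q<i = ℤₚ.≤-reflexive (sym (trans (tailSum-cong (toℕ i) v≗) (coeff-long-high s {i} p<q q<i)))

-- e_q and e_p + e_q have support {α₀,…,α_q}, and e_q − e_p has support {α_{p+1},…,α_q}.
Below : ∀ {n} → Subset n → Fin n → Set
Below J q = ∀ i → i Fin.≤ q → i ∈ J

Between : ∀ {n} → Subset n → Fin n → Fin n → Set
Between J p q = ∀ i → p Fin.< i → i Fin.≤ q → i ∈ J

coeff≢0⇒∈ : ∀ {n} {J : Subset n} {v} → Span J v → ∀ i → coeff v i ≢ 0ℤ → i ∈ J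
coeff≢0⇒∈ {J = J} s i c≢0 with i ∈? J
... | yes i∈J = i∈J
... | no i∉J  = contradiction (Span⇒coeff s i i∉J) c≢0

≡1⇒≢0 : ∀ {i} → i ≡ 1ℤ → i ≢ 0ℤ
≡1⇒≢0 refl ()

Span-short⇒Below : ∀ {n} {J : Subset n} {q} → Span J (e (Sign.+ , q)) → Below J q
Span-short⇒Below {q = q} s i i≤q = coeff≢0⇒∈ s i (≡1⇒≢0 (coeff-short-≤ {i = i} {q} i≤q))

Below⇒Span-short : ∀ {n} {J : Subset n} {q} → Below J q → Span J (e (Sign.+ , q))
Below⇒Span-short {J = J} {q} b = coeff⇒Span λ i i∉J → coeff-short-> {i = i} {q} (ℕₚ.≰⇒> λ i≤q → i∉J (b i i≤q))

Span-sum⇒Below : ∀ {n} {J : Subset n} {p q} → p Fin.< q → Span J (e (Sign.+ , p) ⊞ e (Sign.+ , q)) → Below J q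
Span-sum⇒Below {p = p} {q} p<q s i i≤q with ℕₚ.≤-<-connex (toℕ i) (toℕ p)
... | inj₁ i≤p = coeff≢0⇒∈ s i λ c≡0 → case trans (sym c≡0) (coeff-long-low Sign.+ {i} p<q i≤p) of λ ()
... | inj₂ p<i = coeff≢0⇒∈ s i (≡1⇒≢0 (coeff-long-mid Sign.+ {i} p<q p<i i≤q))

Below⇒Span-sum : ∀ {n} {J : Subset n} {p q} → p Fin.< q → Below J q → Span J (e (Sign.+ , p) ⊞ e (Sign.+ , q))
Below⇒Span-sum p<q b = coeff⇒Span λ i i∉J → coeff-long-high Sign.+ {i} p<q (ℕₚ.≰⇒> λ i≤q → i∉J (b i i≤q))

Span-difference⇒Between : ∀ {n} {J : Subset n} {p q} → p Fin.< q → Span J (e (Sign.- , p) ⊞ e (Sign.+ , q)) → Between J p q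
Span-difference⇒Between p<q s i p<i i≤q = coeff≢0⇒∈ s i (≡1⇒≢0 (coeff-long-mid Sign.- {i} p<q p<i i≤q))

Between⇒Span-difference : ∀ {n} {J : Subset n} {p q} → p Fin.< q → Between J p q → Span J (e (Sign.- , p) ⊞ e (Sign.+ , q))
Between⇒Span-difference {p = p} {q} p<q b = coeff⇒Span λ i i∉J → outside i i∉J
  where
  outside : ∀ i → i ∉ _ → coeff (e (Sign.- , p) ⊞ e (Sign.+ , q)) i ≡ 0ℤ
  outside i i∉J with ℕₚ.≤-<-connex (toℕ i) (toℕ p)
  ... | inj₁ i≤p = coeff-long-low Sign.- {i} p<q i≤p
  ... | inj₂ p<i = coeff-long-high Sign.- {i} p<q (ℕₚ.≰⇒> λ i≤q → i∉J (b i p<i i≤q))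

-- Simple reflections

_≟ᴸ_ : ∀ {n} → DecidableEquality (Letter n)
_≟ᴸ_ = ≡-dec Signₚ._≟_ _≟_

-- The graph of the reflection in e x ⊞ e y, or in e x if x ≡ y.
data Reflects {n} (x y z a : Letter n) : Set where
  at₁  : z ≡ x → a ≡ neg y → Reflects x y z a
  at₂  : z ≡ y → a ≡ neg x → Reflects x y z a
  at₋₁ : z ≡ neg x → a ≡ y → Reflects x y z a
  at₋₂ : z ≡ neg y → a ≡ x → Reflects x y z a
  off  : z ≢ x → z ≢ y → z ≢ neg x → z ≢ neg y → a ≡ z → Reflects x y z a

module _ {n : ℕ} where
  private variable x y z a b : Letter n

  Reflects-swap : Reflects x y z a → Reflects y x z a
  Reflects-swap (at₁ p q)  = at₂ p q
  Reflects-swap (at₂ p q)  = at₁ p q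
  Reflects-swap (at₋₁ p q) = at₋₂ p q
  Reflects-swap (at₋₂ p q) = at₋₁ p q
  Reflects-swap (off p q r s t) = off q p s r t

  neg-swap : z ≡ neg x → neg z ≡ x
  neg-swap {x = x} p = trans (cong neg p) (neg-involutive x)

  neg-injective : neg z ≡ neg x → z ≡ x
  neg-injective {z} {x} p = trans (sym (neg-involutive z)) (neg-swap p)

  Reflects-neg : Reflects x y z a → Reflects x y (neg z) (neg a)
  Reflects-neg (at₁ p q)  = at₋₁ (cong neg p) (neg-swap q)
  Reflects-neg (at₂ p q)  = at₋₂ (cong neg p) (neg-swap q)
  Reflects-neg (at₋₁ p q) = at₁ (neg-swap p) (cong neg q)
  Reflects-neg (at₋₂ p q) = at₂ (neg-swap p) (cong neg q)
  Reflects-neg {x} {y} {z} (off p q r s t) = off (r ∘ flip) (s ∘ flip) (p ∘ neg-injective) (q ∘ neg-injective) (cong neg t)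
    where
    flip : ∀ {x} → neg z ≡ x → z ≡ neg x
    flip refl = sym (neg-involutive z)

  Reflects-sym : Reflects x y z a → Reflects x y a z
  Reflects-sym (at₁ p q)  = at₋₂ q p
  Reflects-sym (at₂ p q)  = at₋₁ q p
  Reflects-sym (at₋₁ p q) = at₂ q p
  Reflects-sym (at₋₂ p q) = at₁ q p
  Reflects-sym (off p q r s refl) = off p q r s refl

  private
    functional₁ : z ≡ x → a ≡ neg y → Reflects x y z b → a ≡ b
    functional₁ refl refl (at₁ p q)  = sym q
    functional₁ refl refl (at₂ p q)  = trans (cong neg (sym p)) (sym q)
    functional₁ refl refl (at₋₁ p q) = contradiction (sym p) (neg≢id _)
    functional₁ refl refl (at₋₂ p q) = trans (sym p) (sym q)
    functional₁ refl refl (off p _ _ _ _) = contradiction refl p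

  -- The cases of the graph overlap when x = y or x = -y, but then they prescribe the same value.
  -- Swapping x and y and negating z reduce everything to the case z = x.
  Reflects-functional : Reflects x y z a → Reflects x y z b → a ≡ b
  Reflects-functional (at₁ p q)  r = functional₁ p q r
  Reflects-functional (at₂ p q)  r = functional₁ p q (Reflects-swap r)
  Reflects-functional (at₋₁ p q) r = neg-injective (functional₁ (neg-swap p) (cong neg q) (Reflects-neg r))
  Reflects-functional (at₋₂ p q) r = neg-injective (functional₁ (neg-swap p) (cong neg q) (Reflects-neg (Reflects-swap r)))
  Reflects-functional (off p _ _ _ _) (at₁ q _)  = contradiction q p
  Reflects-functional (off _ p _ _ _) (at₂ q _)  = contradiction q p
  Reflects-functional (off _ _ p _ _) (at₋₁ q _) = contradiction q p
  Reflects-functional (off _ _ _ p _) (at₋₂ q _) = contradiction q p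
  Reflects-functional (off _ _ _ _ p) (off _ _ _ _ q) = trans p (sym q)

  -- Everything below uses the graph, never the order in which its cases are tested here.
  abstract
    reflects : (x y z : Letter n) → ∃[ a ] Reflects x y z a
    reflects x y z with z ≟ᴸ x | z ≟ᴸ y | z ≟ᴸ neg x | z ≟ᴸ neg y
    ... | yes p | _     | _     | _     = _ , at₁ p refl
    ... | no _  | yes p | _     | _     = _ , at₂ p refl
    ... | no _  | no _  | yes p | _     = _ , at₋₁ p refl
    ... | no _  | no _  | no _  | yes p = _ , at₋₂ p refl
    ... | no p  | no q  | no r  | no s  = _ , off p q r s refl

  Reflects-map : (w : 𝔅 n) → Reflects x y z a → Reflects (w ⟨ x ⟩) (w ⟨ y ⟩) (w ⟨ z ⟩) (w ⟨ a ⟩)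
  Reflects-map w (at₁ refl refl)  = at₁ refl (𝔅.odd w _)
  Reflects-map w (at₂ refl refl)  = at₂ refl (𝔅.odd w _)
  Reflects-map w (at₋₁ refl refl) = at₋₁ (𝔅.odd w _) refl
  Reflects-map w (at₋₂ refl refl) = at₋₂ (𝔅.odd w _) refl
  Reflects-map {x} {y} w (off p q r s refl) = off (p ∘ ⟨⟩-injective w) (q ∘ ⟨⟩-injective w)
    (λ t → r (⟨⟩-injective w (trans t (sym (𝔅.odd w x))))) (λ t → s (⟨⟩-injective w (trans t (sym (𝔅.odd w y))))) refl

  -- Bijectivity and oddness follow from uniqueness of values, because the graph is closed under
  -- transposition and under negation.
  reflection : Letter n → Letter n → 𝔅 n
  reflection x y = record
    { bijection = mk↔ₛ′ ρ ρ involutive involutive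
    ; odd       = λ z → Reflects-functional {z = neg z} (proj₂ (reflects x y (neg z))) (Reflects-neg {z = z} (proj₂ (reflects x y z)))
    }
    where
    ρ : Letter n → Letter n
    ρ z = proj₁ (reflects x y z)

    involutive : ∀ z → ρ (ρ z) ≡ z
    involutive z = Reflects-functional {z = ρ z} (proj₂ (reflects x y (ρ z))) (Reflects-sym (proj₂ (reflects x y z)))

-- For i > 0 the root α_i is e(`low` i) + e(`high` i). For i = 0 both letters coincide and the sum
-- is 2α₀; this doubling lets the short simple root be treated like the long ones.
low high : ∀ {n} → Fin n → Letter n
low zero    = Sign.+ , zero
low (suc i) = Sign.- , inject₁ i
high i = Sign.+ , i

σ : ∀ {n} → Fin n → 𝔅 n
σ i = reflection (low i) (high i)

σ-graph : ∀ {n} (i : Fin n) z → Reflects (low i) (high i) z (σ i ⟨ z ⟩)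
σ-graph i z = proj₂ (reflects (low i) (high i) z)

σ-involutive : ∀ {n} (i : Fin n) z → σ i ⟨ σ i ⟨ z ⟩ ⟩ ≡ z
σ-involutive i = ⁻¹-inverseʳ (σ i)

-- The matrix of a signed permutation is orthogonal, so its inverse is its transpose.
e-transpose : ∀ {n} (w : 𝔅 n) j k → e (w ⟨ Sign.+ , j ⟩) k ≡ e ((w ⁻¹) ⟨ Sign.+ , k ⟩) j
e-transpose {n} w j k with proj₂ (w ⟨ Sign.+ , j ⟩) ≟ k
... | yes refl = go (proj₁ (w ⟨ Sign.+ , j ⟩)) refl
  where
  go : ∀ t → t ≡ proj₁ (w ⟨ Sign.+ , j ⟩) → t ◃ 1 ≡ e ((w ⁻¹) ⟨ Sign.+ , k ⟩) j
  go Sign.+ p = trans (sym (e-self Sign.+ j)) (cong (λ x → e x j) (trans (sym (⁻¹-inverseˡ w (Sign.+ , j))) (cong (λ t → (w ⁻¹) ⟨ t , k ⟩) (sym p))))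
  go Sign.- p = trans (sym (e-self Sign.- j)) (cong (λ x → e x j) (trans (cong neg (trans (sym (⁻¹-inverseˡ w (Sign.+ , j))) (cong (λ t → (w ⁻¹) ⟨ t , k ⟩) (sym p)))) (sym (𝔅.odd (w ⁻¹) (Sign.- , k)))))
... | no ¬p = sym (e-other (proj₁ ((w ⁻¹) ⟨ Sign.+ , k ⟩)) λ q → ¬p (trans (index-injective (w ⁻¹) (w ⟨ Sign.+ , j ⟩) (Sign.+ , k) (trans (cong proj₂ (⁻¹-inverseˡ w (Sign.+ , j))) (sym q))) refl))

•-entry : ∀ {n} (w : 𝔅 n) v k → (w • v) k ≡ coord v ((w ⁻¹) ⟨ Sign.+ , k ⟩)
•-entry w v k = trans (sum-cong-≗ λ j → cong (v j *_) (e-transpose w j k)) (pairing-e v ((w ⁻¹) ⟨ Sign.+ , k ⟩))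

coord-⊞ : ∀ {n} (u v : V n) x → coord (u ⊞ v) x ≡ coord u x + coord v x
coord-⊞ u v (s , i) = ℤₚ.*-distribˡ-+ (s ◃ 1) (u i) (v i)

coord-e-self : ∀ {n} (x : Letter n) → coord (e x) x ≡ 1ℤ
coord-e-self (s , i) = trans (cong ((s ◃ 1) *_) (e-self s i)) (go s)
  where
  go : ∀ s → (s ◃ 1) * (s ◃ 1) ≡ 1ℤ
  go Sign.+ = refl
  go Sign.- = refl

coord-e-other : ∀ {n} (x z : Letter n) → proj₂ x ≢ proj₂ z → coord (e x) z ≡ 0ℤ
coord-e-other (s , i) (t , k) i≢k = trans (cong ((t ◃ 1) *_) (e-other s i≢k)) (ℤₚ.*-zeroʳ (t ◃ 1))

coord-e-off : ∀ {n} {x z : Letter n} → z ≢ x → z ≢ neg x → coord (e x) z ≡ 0ℤ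
coord-e-off {x = x} {z} p q = coord-e-other x z λ r → [ p , q ]′ (same-index z x (sym r))

module _ {n} (v : V n) (x y : Letter n) (x≢y : proj₂ x ≢ proj₂ y) where
  private
    β : V n
    β = e x ⊞ e y

    β-x : coord β x ≡ 1ℤ
    β-x = trans (coord-⊞ (e x) (e y) x) (cong₂ _+_ (coord-e-self x) (coord-e-other y x (x≢y ∘ sym)))

    β-y : coord β y ≡ 1ℤ
    β-y = trans (coord-⊞ (e x) (e y) y) (cong₂ _+_ (coord-e-other x y x≢y) (coord-e-self y))

  pair-norm : ⟪ β , β ⟫ ≡ + 2
  pair-norm = trans (pairing-⊞ʳ β (e x) (e y)) (cong₂ _+_ (trans (pairing-e β x) β-x) (trans (pairing-e β y) β-y))

  -- This is the reflection equation read at the signed letter z. Each case of the graph leaves a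
  -- ring identity in the coordinates of v, with the norm on the left equal to 2.
  pair-reflection : ∀ {z a} → Reflects x y z a → ⟪ β , β ⟫ * (coord v z - coord v a) ≡ (+ 2 * ⟪ v , β ⟫) * coord β z
  pair-reflection {z} {a} r = trans (cong (_* _) pair-norm) (trans (go r)
    (cong (λ t → (+ 2 * t) * coord β z) (sym (trans (pairing-⊞ʳ v (e x) (e y)) (cong₂ _+_ (pairing-e v x) (pairing-e v y))))))
    where
    id₁ : ∀ a b → + 2 * (a - - b) ≡ (+ 2 * (a + b)) * 1ℤ
    id₁ = solve-∀
    id₂ : ∀ a b → + 2 * (b - - a) ≡ (+ 2 * (a + b)) * 1ℤ
    id₂ = solve-∀
    id₃ : ∀ a b → + 2 * (- a - b) ≡ (+ 2 * (a + b)) * - 1ℤ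
    id₃ = solve-∀
    id₄ : ∀ a b → + 2 * (- b - a) ≡ (+ 2 * (a + b)) * - 1ℤ
    id₄ = solve-∀
    id₅ : ∀ a b c → + 2 * (a - a) ≡ (+ 2 * (b + c)) * 0ℤ
    id₅ = solve-∀
    go : Reflects x y z a → + 2 * (coord v z - coord v a) ≡ (+ 2 * (coord v x + coord v y)) * coord β z
    go (at₁ refl refl)  rewrite coord-neg v y | β-x = id₁ (coord v x) (coord v y)
    go (at₂ refl refl)  rewrite coord-neg v x | β-y = id₂ (coord v x) (coord v y)
    go (at₋₁ refl refl) rewrite coord-neg v x | coord-neg β x | β-x = id₃ (coord v x) (coord v y)
    go (at₋₂ refl refl) rewrite coord-neg v y | coord-neg β y | β-y = id₄ (coord v x) (coord v y)
    go (off p q r s refl) rewrite coord-⊞ (e x) (e y) z | coord-e-off p r | coord-e-off q s = id₅ (coord v z) (coord v x) (coord v y)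

single-norm : ∀ {n} (x : Letter n) → ⟪ e x , e x ⟫ ≡ 1ℤ
single-norm x = trans (pairing-e (e x) x) (coord-e-self x)

single-reflection : ∀ {n} (v : V n) x {z a} → Reflects x x z a → ⟪ e x , e x ⟫ * (coord v z - coord v a) ≡ (+ 2 * ⟪ v , e x ⟫) * coord (e x) z
single-reflection v x {z} {a} r = trans (cong (_* (coord v z - coord v a)) (single-norm x)) (trans (go r) (cong (λ t → (+ 2 * t) * coord (e x) z) (sym (pairing-e v x))))
  where
  id₁ : ∀ a → 1ℤ * (a - - a) ≡ (+ 2 * a) * 1ℤ
  id₁ = solve-∀
  id₂ : ∀ a → 1ℤ * (- a - a) ≡ (+ 2 * a) * - 1ℤ
  id₂ = solve-∀
  id₃ : ∀ a b → 1ℤ * (a - a) ≡ (+ 2 * b) * 0ℤ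
  id₃ = solve-∀
  go : Reflects x x z a → 1ℤ * (coord v z - coord v a) ≡ (+ 2 * coord v x) * coord (e x) z
  go (at₁ refl refl)  rewrite coord-neg v x | coord-e-self x = id₁ (coord v x)
  go (at₂ refl refl)  rewrite coord-neg v x | coord-e-self x = id₁ (coord v x)
  go (at₋₁ refl refl) rewrite coord-neg v x | coord-neg (e x) x | coord-e-self x = id₂ (coord v x)
  go (at₋₂ refl refl) rewrite coord-neg v x | coord-neg (e x) x | coord-e-self x = id₂ (coord v x)
  go (off p _ r _ refl) rewrite coord-e-off p r = id₃ (coord v z) (coord v x)

inject₁≢suc : ∀ {n} (i : Fin n) → inject₁ i ≢ suc i
inject₁≢suc (suc i) p = inject₁≢suc i (Finₚ.suc-injective p)

σ-isReflection : ∀ {n} (i : Fin n) → IsReflection (α i) (σ i)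
σ-isReflection i v k = trans (cong (λ t → ⟪ α i , α i ⟫ * t) (cong₂ _-_ (sym (coord-+ v k)) (•-entry (σ i) v k)))
  (trans (go i) (cong (λ t → (+ 2 * ⟪ v , α i ⟫) * t) (coord-+ (α i) k)))
  where
  go : ∀ i → ⟪ α i , α i ⟫ * (coord v (Sign.+ , k) - coord v (σ i ⟨ Sign.+ , k ⟩)) ≡ (+ 2 * ⟪ v , α i ⟫) * coord (α i) (Sign.+ , k)
  go zero    = single-reflection v (high zero) (σ-graph zero (Sign.+ , k))
  go (suc i) = pair-reflection v (low (suc i)) (high (suc i)) (inject₁≢suc i) (σ-graph (suc i) (Sign.+ , k))

α-norm : ∀ {n} (i : Fin n) → ℤ.NonZero ⟪ α i , α i ⟫
α-norm {suc n} zero = subst ℤ.NonZero (sym (single-norm {suc n} (high zero))) _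
α-norm (suc i) = subst ℤ.NonZero (sym (pair-norm (α (suc i)) (low (suc i)) (high (suc i)) (inject₁≢suc i))) _

-- Applied to the vector e z, the reflection equation determines e (s z) once the nonzero norm is
-- cancelled.
σ-unique : ∀ {n} (i : Fin n) {s} → IsReflection (α i) s → ∀ z → s ⟨ z ⟩ ≡ σ i ⟨ z ⟩
σ-unique i {s} r z = e-injective λ k → trans (sym (•-e s z k)) (trans (cancel (e z k)
    (ℤₚ.*-cancelˡ-≡ ⟪ α i , α i ⟫ _ _ {{α-norm i}} (trans (r (e z) k) (sym (σ-isReflection i (e z) k))))) (•-e (σ i) z k))
  where
  difference : ∀ a b → b ≡ a - (a - b)
  difference = solve-∀
  cancel : ∀ a {b c} → a - b ≡ a - c → b ≡ c
  cancel a {b} {c} p = trans (difference a b) (trans (cong (λ t → a - t) p) (sym (difference a c)))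

-- The exchange condition

L-pair : ∀ {n} (w : 𝔅 n) x y → L w (e x ⊞ e y) ≡ value (w ⟨ x ⟩) + value (w ⟨ y ⟩)
L-pair w x y = trans (L-⊞ w (e x) (e y)) (cong₂ _+_ (L-e w x) (L-e w y))

module _ {n} (w : 𝔅 n) where
  L-α<0 : ∀ i → L w (α i) < 0ℤ → value (w ⟨ low i ⟩) + value (w ⟨ high i ⟩) < 0ℤ
  L-α<0 zero    p = let q = subst (_< 0ℤ) (L-e w (high zero)) p in ℤₚ.+-mono-< q q
  L-α<0 (suc i) p = subst (_< 0ℤ) (L-pair w (low (suc i)) (high (suc i))) p

  L-α>0 : ∀ i → 0ℤ < L w (α i) → 0ℤ < value (w ⟨ low i ⟩) + value (w ⟨ high i ⟩)
  L-α>0 zero    p = let q = subst (0ℤ <_) (L-e w (high zero)) p in ℤₚ.+-mono-< q q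
  L-α>0 (suc i) p = subst (0ℤ <_) (L-pair w (low (suc i)) (high (suc i))) p

1≤ : ∀ {i} → 0ℤ < i → 1ℤ ≤ i
1≤ = ℤₚ.i<j⇒suc[i]≤j

module _ {n} (i : Fin n) where
  value-lower : value (low (suc i)) ≡ -[1+ toℕ i ]
  value-lower = cong -[1+_] (Finₚ.toℕ-inject₁ i)

  value-neg-lower : value (neg (low (suc i))) ≡ +[1+ toℕ i ]
  value-neg-lower = cong +[1+_] (Finₚ.toℕ-inject₁ i)

  -- The reflection in α_{i+1} exchanges two adjacent values, so a value that decreases does so by
  -- exactly 1, and this happens at two letters only.
  σ-drop : ∀ {z a} → Reflects (low (suc i)) (high (suc i)) z a →
           ((z ≡ low (suc i) ⊎ z ≡ high (suc i)) × value a ≡ value z - 1ℤ) ⊎ value z ≤ value a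
  σ-drop (at₁ refl refl)  = inj₁ (inj₁ refl , trans (cong (λ m → -[1+ suc m ]) (sym (ℕₚ.+-identityʳ (toℕ i)))) (cong (_- 1ℤ) (sym value-lower)) )
  σ-drop (at₂ refl refl)  = inj₁ (inj₂ refl , value-neg-lower)
  σ-drop (at₋₁ refl refl) = inj₂ (subst (_≤ +[1+ suc (toℕ i) ]) (sym value-neg-lower) (+≤+ (ℕₚ.n≤1+n _)))
  σ-drop (at₋₂ refl refl) = inj₂ (subst (-[1+ suc (toℕ i) ] ≤_) (sym value-lower) (-≤- (ℕₚ.n≤1+n _)))
  σ-drop (off _ _ _ _ refl) = inj₂ ℤₚ.≤-refl

σ₀-drop : ∀ {n} {z a : Letter (suc n)} → Reflects (low zero) (high zero) z a →
          (z ≡ high zero × value z ≡ 1ℤ × value a ≡ -1ℤ) ⊎ value z ≤ value a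
σ₀-drop (at₁ refl refl)  = inj₁ (refl , refl , refl)
σ₀-drop (at₂ refl refl)  = inj₁ (refl , refl , refl)
σ₀-drop (at₋₁ refl refl) = inj₂ -≤+
σ₀-drop (at₋₂ refl refl) = inj₂ -≤+
σ₀-drop (off _ _ _ _ refl) = inj₂ ℤₚ.≤-refl

-- The reflection in α₀ lowers a value by 2, from 1 to -1, but no letter has value 0: from 1 + y > 0
-- follows y ≥ 1, and the new sum is still nonnegative.
crossing₀ : ∀ {x a y b} → x ≡ 1ℤ → a ≡ -1ℤ → y ≢ 0ℤ → y ≤ b → 0ℤ < x + y → a + b < 0ℤ → ⊥
crossing₀ {y = y} {b} refl refl y≢0 y≤b p q with ≢0⇒sign y≢0
... | inj₁ y<0 = ℤₚ.<⇒≱ p (ℤₚ.+-mono-≤ {1ℤ} ℤₚ.≤-refl (ℤₚ.i<j⇒i≤pred[j] y<0))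
... | inj₂ 0<y = ℤₚ.<⇒≱ q (ℤₚ.+-mono-≤ { -1ℤ} ℤₚ.≤-refl (ℤₚ.≤-trans (1≤ 0<y) y≤b))

-- A positive integer lowered by 1 is still nonnegative.
drop-one : ∀ {x a y b} → a ≡ x - 1ℤ → y ≤ b → 0ℤ < x + y → a + b < 0ℤ → ⊥
drop-one {x} {a} {y} {b} refl y≤b p q = ℤₚ.<⇒≱ q (ℤₚ.≤-trans (ℤₚ.i<j⇒i≤pred[j] p)
  (ℤₚ.≤-trans (ℤₚ.≤-reflexive (lemma x y)) (ℤₚ.+-mono-≤ {x - 1ℤ} ℤₚ.≤-refl y≤b)))
  where
  lemma : ∀ x y → -1ℤ + (x + y) ≡ x - 1ℤ + y
  lemma = solve-∀

-- σ i makes only the root αᵢ (and its double) change from positive to negative.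
crossing : ∀ {n} (j : Fin n) {z₁ z₂ a₁ a₂} →
  Reflects (low j) (high j) z₁ a₁ → Reflects (low j) (high j) z₂ a₂ →
  0ℤ < value z₁ + value z₂ → value a₁ + value a₂ < 0ℤ →
  (z₁ ≡ low j × z₂ ≡ high j) ⊎ (z₁ ≡ high j × z₂ ≡ low j)
crossing zero {z₁} {z₂} {a₁} {a₂} r₁ r₂ p q with σ₀-drop r₁ | σ₀-drop r₂
... | inj₁ (s , _) | inj₁ (t , _) = inj₁ (s , t)
... | inj₁ (_ , s , t) | inj₂ u = ⊥-elim (crossing₀ s t (value≢0 z₂) u p q)
... | inj₂ u | inj₁ (_ , s , t) = ⊥-elim (crossing₀ s t (value≢0 z₁) u (subst (0ℤ <_) (ℤₚ.+-comm (value z₁) (value z₂)) p) (subst (_< 0ℤ) (ℤₚ.+-comm (value a₁) (value a₂)) q))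
... | inj₂ u | inj₂ v = ⊥-elim (ℤₚ.<⇒≱ (ℤₚ.<-trans q p) (ℤₚ.+-mono-≤ u v))
crossing (suc i) {z₁} {z₂} {a₁} {a₂} r₁ r₂ p q with σ-drop i r₁ | σ-drop i r₂
... | inj₁ (inj₁ s , _) | inj₁ (inj₂ t , _) = inj₁ (s , t)
... | inj₁ (inj₂ s , _) | inj₁ (inj₁ t , _) = inj₂ (s , t)
... | inj₁ (inj₁ refl , _) | inj₁ (inj₁ refl , _) = ⊥-elim (case p of λ ())
... | inj₁ (inj₂ refl , s) | inj₁ (inj₂ refl , t) = ⊥-elim (ℤₚ.<⇒≱ (subst₂ (λ x y → x + y < 0ℤ) s t q) (+≤+ z≤n))
... | inj₁ (_ , s) | inj₂ u = ⊥-elim (drop-one {value z₁} s u p q)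
... | inj₂ u | inj₁ (_ , s) = ⊥-elim (drop-one {value z₂} s u (subst (0ℤ <_) (ℤₚ.+-comm (value z₁) (value z₂)) p) (subst (_< 0ℤ) (ℤₚ.+-comm (value a₁) (value a₂)) q))
... | inj₂ u | inj₂ v = ⊥-elim (ℤₚ.<⇒≱ (ℤₚ.<-trans q p) (ℤₚ.+-mono-≤ u v))

-- Conjugating the reflection in α_i by u gives the reflection in u•α_i, and the hypothesis says
-- that this root is α_j.
σ-conjugate : ∀ {n} (u : 𝔅 n) i j →
  (u ⟨ low i ⟩ ≡ low j × u ⟨ high i ⟩ ≡ high j) ⊎ (u ⟨ low i ⟩ ≡ high j × u ⟨ high i ⟩ ≡ low j) →
  ∀ z → σ j ⟨ u ⟨ z ⟩ ⟩ ≡ u ⟨ σ i ⟨ z ⟩ ⟩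
σ-conjugate u i j (inj₁ (p , q)) z = Reflects-functional (σ-graph j (u ⟨ z ⟩))
  (subst₂ (λ x y → Reflects x y (u ⟨ z ⟩) (u ⟨ σ i ⟨ z ⟩ ⟩)) p q (Reflects-map u (σ-graph i z)))
σ-conjugate u i j (inj₂ (p , q)) z = Reflects-functional (σ-graph j (u ⟨ z ⟩))
  (Reflects-swap (subst₂ (λ x y → Reflects x y (u ⟨ z ⟩) (u ⟨ σ i ⟨ z ⟩ ⟩)) p q (Reflects-map u (σ-graph i z))))

infix 4 _≋_
_≋_ : ∀ {n} → 𝔅 n → 𝔅 n → Set
u ≋ v = ∀ x → u ⟨ x ⟩ ≡ v ⟨ x ⟩

L-≋ : ∀ {n} {u w : 𝔅 n} v → u ≋ w → L u v ≡ L w v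
L-≋ v p = sum-cong-≗ λ k → cong (λ x → v k * value x) (p (Sign.+ , k))

Word-≋ : ∀ {n} {J : Subset n} {k u v} → u ≋ v → Word J k u → Word J k v
Word-≋ p (one q)          = one λ x → trans (sym (p x)) (q x)
Word-≋ p (cons {s = s} {u} i∈J r W q) = cons {s = s} {u} i∈J r W λ x → trans (sym (p x)) (q x)

Word-snoc : ∀ {n} {J : Subset n} {k i u v} → Word J k u → i ∈ J → v ≡ u · σ i → Word J (suc k) v
Word-snoc {i = i} {v = v} (one p) i∈J q = cons {s = σ i} {id𝔅} i∈J (σ-isReflection i) (one λ _ → refl) λ x → trans (q x) (p (σ i ⟨ x ⟩))
Word-snoc {i = i} {v = v} (cons {s = s} {u} j∈J r W p) i∈J q =
  cons {s = s} {u ⊙ σ i} j∈J r (Word-snoc {v = u ⊙ σ i} W i∈J λ _ → refl) λ x → trans (q x) (p (σ i ⟨ x ⟩))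

Word-⊙ : ∀ {n} {J : Subset n} {k l u v} → Word J k u → Word J l v → Word J (k ℕ.+ l) (u ⊙ v)
Word-⊙ {v = v} (one p) W = Word-≋ (λ x → sym (p (v ⟨ x ⟩))) W
Word-⊙ {v = v} (cons {s = s} {u} i∈J r U p) W = cons {s = s} {u ⊙ v} i∈J r (Word-⊙ U W) λ x → p (v ⟨ x ⟩)

InW-⊙ : ∀ {n} {J : Subset n} {u v} → InW J u → InW J v → InW J (u ⊙ v)
InW-⊙ (k , U) (l , W) = k ℕ.+ l , Word-⊙ U W

InW-id : ∀ {n} {J : Subset n} → InW J id𝔅
InW-id = 0 , one λ _ → refl

InW-σ : ∀ {n} {J : Subset n} {i} → i ∈ J → InW J (σ i)
InW-σ {i = i} i∈J = 1 , Word-snoc {u = id𝔅} (one λ _ → refl) i∈J λ _ → refl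

InW-⁻¹ : ∀ {n} {J : Subset n} {w} → InW J w → InW J (w ⁻¹)
InW-⁻¹ {w = w} (_ , one p) = 0 , one λ x → ⟨⟩-injective w (trans (⁻¹-inverseʳ w x) (sym (p x)))
InW-⁻¹ {w = w} (_ , cons {k} {i} {s} {u} i∈J r W p) with InW-⁻¹ (k , W)
... | l , W′ = suc l , Word-snoc {u = u ⁻¹} W′ i∈J λ x → ⟨⟩-injective w (trans (⁻¹-inverseʳ w x)
  (sym (trans (p _) (trans (cong (s ⟨_⟩) (⁻¹-inverseʳ u _)) (trans (σ-unique i {s} r _) (σ-involutive i x))))))

-- Write the word as s_j followed by the word of u. If u already inverts α_i, a letter is deleted
-- inside u. Otherwise s_j makes the positive root u•α_i negative, which forces u•α_i = α_j; then
-- s_j u = u s_i and the first letter is the one to delete.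
exchange : ∀ {n} {J : Subset n} {k u} → Word J k u → ∀ i → L u (α i) < 0ℤ →
           ∃[ k′ ] k ≡ suc k′ × Word J k′ (u ⊙ σ i)
exchange {u = u} (one p) i q = ⊥-elim (ℤₚ.<-asym q (subst (0ℤ <_) (L-≋ {u = id𝔅} {u} (α i) (λ x → sym (p x))) (positive⇒height>0 (α-positive i))))
exchange {u = w} (cons {k} {j} {s} {u} j∈J r W p) i q with ≢0⇒sign (L≢0 u (α-root i))
... | inj₁ L<0 with exchange W i L<0
...   | k′ , refl , W′ = k , refl , cons {s = s} {u ⊙ σ i} j∈J r W′ λ x → p (σ i ⟨ x ⟩)
exchange {u = w} (cons {k} {j} {s} {u} j∈J r W p) i q | inj₂ L>0 = k , refl , Word-≋ (λ x → sym (lemma x)) W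
  where
  w≋ : ∀ x → w ⟨ x ⟩ ≡ σ j ⟨ u ⟨ x ⟩ ⟩
  w≋ x = trans (p x) (σ-unique j {s} r (u ⟨ x ⟩))
  lemma : ∀ x → w ⟨ σ i ⟨ x ⟩ ⟩ ≡ u ⟨ x ⟩
  lemma x = trans (w≋ (σ i ⟨ x ⟩)) (trans (σ-conjugate u i j
    (crossing j (σ-graph j (u ⟨ low i ⟩)) (σ-graph j (u ⟨ high i ⟩)) (L-α>0 u i L>0)
      (subst₂ (λ a b → value a + value b < 0ℤ) (w≋ (low i)) (w≋ (high i)) (L-α<0 w i q))) (σ i ⟨ x ⟩)) (cong (u ⟨_⟩) (σ-involutive i x)))

-- Parabolic factorizations

coord-• : ∀ {n} (w : 𝔅 n) v x → coord (w • v) x ≡ coord v ((w ⁻¹) ⟨ x ⟩)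
coord-• w v (Sign.+ , i) = trans (coord-+ (w • v) i) (•-entry w v i)
coord-• w v (Sign.- , i) = trans (coord-neg (w • v) (Sign.+ , i)) (trans (cong -_ (coord-• w v (Sign.+ , i)))
  (trans (sym (coord-neg v ((w ⁻¹) ⟨ Sign.+ , i ⟩))) (cong (coord v) (sym (𝔅.odd (w ⁻¹) (Sign.+ , i))))))

•-⊙ : ∀ {n} (u w : 𝔅 n) v → (u ⊙ w) • v ≗ u • (w • v)
•-⊙ u w v k = trans (•-entry (u ⊙ w) v k) (sym (trans (•-entry u (w • v) k) (coord-• w v ((u ⁻¹) ⟨ Sign.+ , k ⟩))))

•-≋ : ∀ {n} {u w : 𝔅 n} v → u ≋ w → u • v ≗ w • v
•-≋ v p k = sum-cong-≗ λ i → cong (λ x → v i * e x k) (p (Sign.+ , i))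

norm-positive : ∀ {n} (i : Fin n) → 0ℤ < ⟪ α i , α i ⟫
norm-positive {suc n} zero = subst (0ℤ <_) (sym (single-norm {suc n} (high zero))) (+<+ (s≤s z≤n))
norm-positive (suc i) = subst (0ℤ <_) (sym (pair-norm (α (suc i)) (low (suc i)) (high (suc i)) (inject₁≢suc i))) (+<+ (s≤s z≤n))

-- Up to the factor N, the difference v - s•v is a multiple of α_i, which has no component along
-- α_j.
reflection-coeff : ∀ {n} {i j : Fin n} {s} → IsReflection (α i) s → i ≢ j → ∀ v → coeff (s • v) j ≡ coeff v j
reflection-coeff {i = i} {j} {s} r i≢j v = sym (ℤₚ.i-j≡0⇒i≡j _ _ (ℤₚ.*-cancelˡ-≡ N _ _ {{α-norm i}} (begin
  N * (coeff v j - coeff (s • v) j)  ≡⟨ cong (N *_) (sym (tailSum-⊟ (toℕ j) v (s • v))) ⟩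
  N * coeff (v ⊟ s • v) j            ≡⟨ sym (tailSum-⊡ (toℕ j) N (v ⊟ s • v)) ⟩
  coeff (N ⊡ (v ⊟ s • v)) j          ≡⟨ tailSum-cong (toℕ j) (r v) ⟩
  coeff (c ⊡ α i) j                  ≡⟨ tailSum-⊡ (toℕ j) c (α i) ⟩
  c * coeff (α i) j                  ≡⟨ cong (c *_) (coeff-α-other i≢j) ⟩
  c * 0ℤ                             ≡⟨ ℤₚ.*-zeroʳ c ⟩
  0ℤ                                 ≡⟨ sym (ℤₚ.*-zeroʳ N) ⟩
  N * 0ℤ                             ∎)))
  where
  open ≡-Reasoning
  N c : ℤ
  N = ⟪ α i , α i ⟫
  c = + 2 * ⟪ v , α i ⟫

InW-coeff : ∀ {n} {J : Subset n} {w j} → InW J w → j ∉ J → ∀ v → coeff (w • v) j ≡ coeff v j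
InW-coeff {w = w} {j} (_ , one p) j∉J v = tailSum-cong (toℕ j) λ k → trans (•-≋ {u = w} {id𝔅} v p k) (trans (•-entry id𝔅 v k) (coord-+ v k))
InW-coeff {w = w} {j} (_ , cons {k} {i} {s} {u} i∈J r W p) j∉J v =
  trans (tailSum-cong (toℕ j) λ m → trans (•-≋ {u = w} {s ⊙ u} v p m) (•-⊙ s u v m))
  (trans (reflection-coeff {i = i} {s = s} r (λ { refl → j∉J i∈J }) (u • v)) (InW-coeff {w = u} (k , W) j∉J v))

InW-Span : ∀ {n} {J : Subset n} {w v} → InW J w → Span J v → Span J (w • v)
InW-Span {w = w} {v} W s = coeff⇒Span λ i i∉J → trans (InW-coeff {w = w} W i∉J v) (Span⇒coeff s i i∉J)

-- An element of W_J preserves the span of J, so a root of Φ_J that turns negative is automatically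
-- an inversion within Φ_J.
inversion-intro : ∀ {n} {J : Subset n} {w β} → InW J w → Φ⁺ J β → L w β < 0ℤ → Inversion J w β
inversion-intro {w = w} {β} W (p , s) q = (p , s) , L<0⇒negative-• w (positive⇒root p) q , Span-⊖ (InW-Span {w = w} W s)

inversion-elim : ∀ {n} {J : Subset n} {w β} → Inversion J w β → L w β < 0ℤ
inversion-elim {w = w} {β} (_ , p , _) = negative-•⇒L<0 w {β} p

PositiveOn : ∀ {n} → Subset n → 𝔅 n → Set
PositiveOn J u = ∀ i → i ∈ J → 0ℤ < L u (α i)

-- The value at β is a nonnegative combination of values at simple roots in J; it is strictly
-- positive because no root has height 0.
PositiveOn-Φ⁺ : ∀ {n} {J : Subset n} {u β} → PositiveOn J u → Φ⁺ J β → 0ℤ < L u β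
PositiveOn-Φ⁺ {J = J} {u} {β} pos (p , s) = ℤₚ.≤∧≢⇒< (subst (0ℤ ≤_)
  (sym (trans (L-cong u (combination-coeff β)) (L-∑ u (coeff β) α))) (Σ-nonneg term)) (λ q → L≢0 u (positive⇒root p) (sym q))
  where
  term : ∀ i → 0ℤ ≤ coeff β i * L u (α i)
  term i with i ∈? J
  ... | yes i∈J = subst (_≤ coeff β i * L u (α i)) (ℤₚ.*-zeroʳ (coeff β i)) (ℤₚ.*-monoˡ-≤-nonNeg (coeff β i) {{ℤ.nonNegative (coeff-nonneg p i)}} (ℤₚ.<⇒≤ (pos i i∈J)))
  ... | no i∉J = ℤₚ.≤-reflexive (sym (cong (_* L u (α i)) (Span⇒coeff s i i∉J)))

-- Descending terminates: removing a descent αᵢ increases ⟨w•ρ,ρ⟩ for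
-- ρ = (1,…,n), which is bounded.
Ρ : ∀ {n} → V n
Ρ = oneLine id𝔅

-- The vector ρ - s_i•ρ is a positive multiple of α_i, since ρ pairs positively with every simple
-- root; a negative `L w (α i)` therefore makes `L w` grow from ρ to s_i•ρ.
ascent : ∀ {n} (w : 𝔅 n) i → L w (α i) < 0ℤ → L w Ρ < L (w ⊙ σ i) Ρ
ascent w i p = subst (L w Ρ <_) (L-• w (σ i) Ρ) (ungap (subst (0ℤ <_) (flip (L w Ρ) (L w (σ i • Ρ))) (-‿pos
  (ℤₚ.*-cancelˡ-<-nonNeg N {{ℤ.nonNegative (ℤₚ.<⇒≤ (norm-positive i))}} (subst₂ _<_ (sym eq) (sym (ℤₚ.*-zeroʳ N)) product<0)))))
  where
  N c : ℤ
  N = ⟪ α i , α i ⟫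
  c = + 2 * ⟪ Ρ , α i ⟫
  eq : N * (L w Ρ - L w (σ i • Ρ)) ≡ c * L w (α i)
  eq = trans (cong (N *_) (sym (L-⊟ w Ρ (σ i • Ρ)))) (trans (sym (L-⊡ w N (Ρ ⊟ σ i • Ρ)))
    (trans (L-cong w (σ-isReflection i Ρ)) (L-⊡ w c (α i))))
  0<c : 0ℤ < c
  0<c = ℤₚ.*-monoˡ-<-pos (+ 2) (subst (0ℤ <_) (pairing-comm (α i) Ρ) (positive⇒height>0 (α-positive i)))
  product<0 : c * L w (α i) < 0ℤ
  product<0 = subst (c * L w (α i) <_) (ℤₚ.*-zeroʳ c) (ℤₚ.*-monoˡ-<-pos c {{ℤ.positive 0<c}} p)
  flip : ∀ a b → - (a - b) ≡ b - a
  flip = solve-∀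

oneLine-neg : ∀ {n} (u : 𝔅 n) i → value (u ⟨ Sign.- , i ⟩) ≡ - oneLine u i
oneLine-neg u i = trans (cong value (𝔅.odd u (Sign.+ , i))) (value-neg (u ⟨ Sign.+ , i ⟩))

-- Positivity on α₀ makes the first entry at least 1, and positivity on the other simple roots makes
-- the entries increase.
positive⇒expanding : ∀ {n} (u : 𝔅 n) → PositiveOn ⊤ u → ∀ i → + suc (toℕ i) ≤ oneLine u i
positive⇒expanding {suc n} u pos = <-weakInduction (λ i → + suc (toℕ i) ≤ oneLine u i)
  (1≤ (subst (0ℤ <_) (L-e u (high zero)) (pos zero Subₚ.∈⊤)))
  λ i p → ℤₚ.≤-trans (ℤₚ.+-monoʳ-≤ 1ℤ (subst (λ m → + suc m ≤ oneLine u (inject₁ i)) (Finₚ.toℕ-inject₁ i) p))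
    (ℤₚ.i<j⇒suc[i]≤j (ungap (subst (0ℤ <_) (trans (L-pair u (low (suc i)) (high (suc i)))
      (trans (cong₂ _+_ (oneLine-neg u (inject₁ i)) refl) (ℤₚ.+-comm (- oneLine u (inject₁ i)) (oneLine u (suc i)))))
        (pos (suc i) Subₚ.∈⊤))))

-- If the inverse of u sent α_i to -γ with γ a positive root, then u would send γ to -α_i.
positive-⁻¹ : ∀ {n} (u : 𝔅 n) → PositiveOn ⊤ u → PositiveOn ⊤ (u ⁻¹)
positive-⁻¹ u pos i _ with ≢0⇒sign (L≢0 (u ⁻¹) (α-root i))
... | inj₂ p = p
... | inj₁ p = ⊥-elim (ℤₚ.<-asym (positive⇒height>0 (α-positive i)) (neg-pos (subst (0ℤ <_)
        (trans (L-⊖ u (u ⁻¹ • α i)) (cong -_ (trans (L-• u (u ⁻¹) (α i)) (L-≋ {u = u ⊙ u ⁻¹} {id𝔅} (α i) (⁻¹-inverseʳ u)))))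
        (PositiveOn-Φ⁺ {u = u} pos (L<0⇒negative-• (u ⁻¹) (α-root i) p , Span-⊤ _)))))

-- Both u and its inverse move every position weakly upwards.
positive⇒identity : ∀ {n} (u : 𝔅 n) → PositiveOn ⊤ u → IsIdentity u
positive⇒identity u pos = go
  where
  below : ∀ (w : 𝔅 _) → PositiveOn ⊤ w → ∀ i {x} → w ⟨ Sign.+ , i ⟩ ≡ x → proj₁ x ≡ Sign.+ × i Fin.≤ proj₂ x
  below w p i {x} q with x | subst (λ x → + suc (toℕ i) ≤ value x) q (positive⇒expanding w p i)
  ... | Sign.+ , j | +≤+ (s≤s i≤j) = refl , i≤j
  go₊ : ∀ i → u ⟨ Sign.+ , i ⟩ ≡ (Sign.+ , i)
  go₊ i with u ⟨ Sign.+ , i ⟩ in eq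
  ... | s , j with below u pos i eq
  ... | refl , i≤j = cong (Sign.+ ,_) (Finₚ.≤-antisym
          (proj₂ (below (u ⁻¹) (positive-⁻¹ u pos) j (trans (cong ((u ⁻¹) ⟨_⟩) (sym eq)) (⁻¹-inverseˡ u (Sign.+ , i))))) i≤j)
  go : IsIdentity u
  go (Sign.+ , i) = go₊ i
  go (Sign.- , i) = trans (𝔅.odd u (Sign.+ , i)) (cong neg (go₊ i))

-- For i outside J the coefficient of α_i in v•α_i is still 1, so this root cannot be negative;
-- hence v is positive on all simple roots.
positive-InW⇒identity : ∀ {n} {J : Subset n} {v} → InW J v → PositiveOn J v → IsIdentity v
positive-InW⇒identity {J = J} {v} W pos = positive⇒identity v pos-⊤
  where
  pos-⊤ : PositiveOn ⊤ v
  pos-⊤ i _ with i ∈? J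
  ... | yes i∈J = pos i i∈J
  ... | no i∉J with root-cases (•-root v (α-root i))
  ...   | inj₁ p = positive-•⇒L>0 v {α i} p
  ...   | inj₂ p = ⊥-elim (ℤₚ.<⇒≱ {0ℤ} {1ℤ} (+<+ (s≤s z≤n)) (ℤₚ.neg-cancel-≤ (subst (0ℤ ≤_)
            (trans (tailSum-⊖ (toℕ i) (v • α i)) (cong -_ (trans (InW-coeff {w = v} W i∉J (α i)) (coeff-α-self i)))) (coeff-nonneg p i))))

Σ-mono : ∀ {n} {f g : Vector ℤ n} → (∀ i → f i ≤ g i) → Σℤ f ≤ Σℤ g
Σ-mono {zero}  p = ℤₚ.≤-refl
Σ-mono {suc n} p = ℤₚ.+-mono-≤ (p zero) (Σ-mono (p ∘ suc))

value≤n : ∀ {n} (x : Letter n) → value x ≤ + n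
value≤n (Sign.+ , i) = +≤+ (Finₚ.toℕ<n i)
value≤n (Sign.- , i) = -≤+

bound : ℕ → ℤ
bound n = Σℤ {n} (λ k → Ρ k * + n)

L-Ρ≤bound : ∀ {n} (w : 𝔅 n) → L w Ρ ≤ bound n
L-Ρ≤bound w = Σ-mono λ k → ℤₚ.*-monoˡ-≤-nonNeg (Ρ k) (value≤n (w ⟨ Sign.+ , k ⟩))

deficit : ∀ {n} → 𝔅 n → ℕ
deficit {n} w = ∣ bound n - L w Ρ ∣

∣∣-mono-< : ∀ {a b} → 0ℤ ≤ a → a < b → ∣ a ∣ ℕ.< ∣ b ∣
∣∣-mono-< (+≤+ _) (+<+ p) = p

deficit-decreases : ∀ {n} (w : 𝔅 n) i → L w (α i) < 0ℤ → deficit (w ⊙ σ i) ℕ.< deficit w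
deficit-decreases {n} w i p = ∣∣-mono-< (ℤₚ.i≤j⇒0≤j-i (L-Ρ≤bound (w ⊙ σ i))) (ℤₚ.+-monoʳ-< (bound n) (ℤₚ.neg-mono-< (ascent w i p)))

descent? : ∀ {n} (J : Subset n) (w : 𝔅 n) → (∃[ i ] i ∈ J × L w (α i) < 0ℤ) ⊎ PositiveOn J w
descent? J w with any? (λ i → (i ∈? J) ×-dec (L w (α i) ℤₚ.<? 0ℤ))
... | yes p = inj₁ p
... | no ¬p = inj₂ λ i i∈J → [ (λ q → contradiction (i , i∈J , q) ¬p) , id ]′ (≢0⇒sign (L≢0 w (α-root i)))

factorize : ∀ {n} (J : Subset n) (w : 𝔅 n) → ∃[ u ] ∃[ v ] (w ≡ u · v) × InW J v × PositiveOn J u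
factorize {n} J w = go w (<-wellFounded _)
  where
  go : (w : 𝔅 n) → Acc ℕ._<_ (deficit w) → ∃[ u ] ∃[ v ] (w ≡ u · v) × InW J v × PositiveOn J u
  go w (acc rec) with descent? J w
  ... | inj₂ pos = w , id𝔅 , (λ _ → refl) , InW-id , pos
  ... | inj₁ (i , i∈J , p) with go (w ⊙ σ i) (rec (deficit-decreases w i p))
  ...   | u , v , w≡uv , W , pos = u , v ⊙ σ i ,
          (λ x → trans (cong (w ⟨_⟩) (sym (σ-involutive i x))) (w≡uv (σ i ⟨ x ⟩))) , InW-⊙ {u = v} {σ i} W (InW-σ i∈J) , pos

-- Every step removes a last letter that is a descent, so words of this shape
-- are reduced (see Reduced-shortest).
data Reduced {n} : ℕ → 𝔅 n → Set where
  done : ∀ {w} → IsIdentity w → Reduced 0 w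
  step : ∀ {k w} i → L w (α i) < 0ℤ → Reduced k (w ⊙ σ i) → Reduced (suc k) w

reduced : ∀ {n} (w : 𝔅 n) → ∃[ k ] Reduced k w
reduced {n} w = go w (<-wellFounded _)
  where
  go : (w : 𝔅 n) → Acc ℕ._<_ (deficit w) → ∃[ k ] Reduced k w
  go w (acc rec) with descent? ⊤ w
  ... | inj₂ pos = 0 , done (positive⇒identity w pos)
  ... | inj₁ (i , _ , p) with go (w ⊙ σ i) (rec (deficit-decreases w i p))
  ...   | k , r = suc k , step i p r

Reduced⇒Word : ∀ {n k} {w : 𝔅 n} → Reduced k w → Word ⊤ k w
Reduced⇒Word (done p) = one p
Reduced⇒Word {w = w} (step i _ r) = Word-snoc {u = w ⊙ σ i} (Reduced⇒Word r) Subₚ.∈⊤ λ x → cong (w ⟨_⟩) (sym (σ-involutive i x))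

InW-⊤ : ∀ {n} (w : 𝔅 n) → InW ⊤ w
InW-⊤ w = map₂ Reduced⇒Word (reduced w)

Reduced-shortest : ∀ {n k m} {w : 𝔅 n} → Reduced k w → Word ⊤ m w → k ℕ.≤ m
Reduced-shortest (done _) W = z≤n
Reduced-shortest (step i p r) W with exchange W i p
... | m′ , refl , W′ = s≤s (Reduced-shortest r W′)

-- Every descent of v in J is also a descent of x = uv, so the exchange condition shortens the words
-- of v and x together until v is trivial and the word of x has become a word of u.
shorten : ∀ {n} {J : Subset n} {u v x : 𝔅 n} {l m} → PositiveOn J u → Word J l v → x ≡ u · v → Word ⊤ m x →
          ∃[ m′ ] m′ ℕ.≤ m × Word ⊤ m′ u
shorten {J = J} {u} {v} {x} {l} {m} pos V x≡uv X with descent? J v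
... | inj₂ pos′ = m , ℕₚ.≤-refl , Word-≋ (λ y → trans (x≡uv y) (cong (u ⟨_⟩) (positive-InW⇒identity {v = v} (l , V) pos′ y))) X
... | inj₁ (i , i∈J , p) with exchange V i p | exchange X i L<0
  where
  -- The root -v•α_i is positive and lies in the span of J, so u keeps it positive.
  L<0 : L x (α i) < 0ℤ
  L<0 = subst (_< 0ℤ) (sym (L-≋ {u = x} {u ⊙ v} (α i) x≡uv)) (neg-pos (subst (0ℤ <_)
    (trans (L-⊖ u (v • α i)) (cong -_ (L-• u v (α i))))
    (PositiveOn-Φ⁺ {u = u} pos (L<0⇒negative-• v (α-root i) p , Span-⊖ (InW-Span {w = v} (l , V) (Span-α i∈J))))))
...   | l′ , refl , V′ | m′ , refl , X′ with shorten {v = v ⊙ σ i} pos V′ (λ y → x≡uv (σ i ⟨ y ⟩)) X′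
...     | m″ , m″≤m′ , U = m″ , ℕₚ.m≤n⇒m≤1+n m″≤m′ , U

factorization : ∀ {n} (J : Subset n) {w u v : 𝔅 n} → w ≡ u · v → InW J v → PositiveOn J u → ParabolicFactorization J w u v
factorization J {w} {u} {v} w≡uv V pos = record
  { product = w≡uv
  ; inW     = V
  ; minimal = proj₁ (reduced u) , Reduced⇒Word (proj₂ (reduced u)) , minimal
  }
  where
  minimal : ∀ {x v′ m} → InW J v′ → x ≡ w · v′ → Word ⊤ m x → proj₁ (reduced u) ℕ.≤ m
  minimal {x} {v′} V′ x≡wv′ X with shorten {u = u} {v ⊙ v′} {x} pos (proj₂ (InW-⊙ {u = v} {v′} V V′)) (λ y → trans (x≡wv′ y) (w≡uv (v′ ⟨ y ⟩))) X
  ... | m′ , m′≤m , U = ℕₚ.≤-trans (Reduced-shortest (proj₂ (reduced u)) U) m′≤m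

-- A descent α_i of u with i ∈ J would give a strictly shorter word for u s_i, which lies in the
-- same coset of W_J.
factorization⇒positive : ∀ {n} {J : Subset n} {w u v : 𝔅 n} → ParabolicFactorization J w u v → PositiveOn J u
factorization⇒positive {J = J} {w} {u} {v} F i i∈J with ≢0⇒sign (L≢0 u (α-root i)) | ParabolicFactorization.minimal F
... | inj₂ p | _ = p
... | inj₁ p | k , U , minimal with exchange U i p
...   | k′ , refl , U′ = ⊥-elim (ℕₚ.<-irrefl refl (minimal {u ⊙ σ i} {v ⁻¹ ⊙ σ i}
          (InW-⊙ {u = v ⁻¹} {σ i} (InW-⁻¹ {w = v} (ParabolicFactorization.inW F)) (InW-σ i∈J))
          (λ x → sym (trans (ParabolicFactorization.product F _) (cong (u ⟨_⟩) (⁻¹-inverseʳ v (σ i ⟨ x ⟩))))) U′))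

-- Restriction to parabolic subsystems

-- This is all that restriction to Φ_J remembers of an element; parabolic factors and restrictions
-- are compared with w only through it.
SameSign : ∀ {n} → Subset n → 𝔅 n → 𝔅 n → Set
SameSign J w v = ∀ {β} → Φ⁺ J β → (L w β < 0ℤ → L v β < 0ℤ) × (L v β < 0ℤ → L w β < 0ℤ)

SameSign-sym : ∀ {n} {J : Subset n} w v → SameSign J w v → SameSign J v w
SameSign-sym w v same {β} b = let p , q = same {β} b in q , p

-- The factor v maps Φ_J into itself, and u does not change the sign of any root of Φ_J.
factorization⇒SameSign : ∀ {n} {J : Subset n} {w u v} → w ≡ u · v → InW J v → PositiveOn J u → SameSign J w v
factorization⇒SameSign {w = w} {u} {v} w≡uv V pos {β} (p , s) with root-cases (•-root v (positive⇒root p))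
... | inj₁ q = (λ r → ⊥-elim (ℤₚ.<-asym r w>0)) , λ r → ⊥-elim (ℤₚ.<-asym r (positive-•⇒L>0 v {β} q))
  where
  w>0 : 0ℤ < L w β
  w>0 = subst (0ℤ <_) (trans (L-• u v β) (sym (L-≋ {u = w} {u ⊙ v} β w≡uv))) (PositiveOn-Φ⁺ {u = u} pos (q , InW-Span {w = v} V s))
... | inj₂ q = (λ _ → negative-•⇒L<0 v {β} q) , λ _ → neg-pos (subst (0ℤ <_)
        (trans (L-⊖ u (v • β)) (cong -_ (trans (L-• u v β) (sym (L-≋ {u = w} {u ⊙ v} β w≡uv)))))
        (PositiveOn-Φ⁺ {u = u} pos (q , Span-⊖ (InW-Span {w = v} V s))))

restricts-intro : ∀ {n} {J C : Subset n} {w v} → C ⊆ J → InW J w → InW C v → SameSign C w v → Restricts J w C v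
restricts-intro {w = w} {v} C⊆J W V same = V , λ β → mk⇔
  (λ { i@((p , s) , _) → inversion-intro {w = w} W (p , Span-mono C⊆J s) (proj₂ (same {β} (p , s)) (inversion-elim {w = v} i)) , s })
  (λ { (i@((p , _) , _) , s) → inversion-intro {w = v} V (p , s) (proj₁ (same {β} (p , s)) (inversion-elim {w = w} i)) })

restricts-elim : ∀ {n} {J C : Subset n} {w v} → C ⊆ J → InW J w → Restricts J w C v → SameSign C w v
restricts-elim {w = w} {v} C⊆J W (V , f) {β} b@(p , s) =
  (λ q → inversion-elim {w = v} (Equivalence.from (f β) (inversion-intro {w = w} W (p , Span-mono C⊆J s) q , s))) ,
  (λ q → inversion-elim {w = w} (proj₁ (Equivalence.to (f β) (inversion-intro {w = v} V b q))))

-- The restriction to Φ_C is the right factor of w with respect to W_C.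
restriction : ∀ {n} {J : Subset n} (C : Subset n) {w} → C ⊆ J → InW J w → ∃[ v ] Restricts J w C v × InW C v × SameSign C w v
restriction C {w} C⊆J W with factorize C w
... | u , v , w≡uv , V , pos = v , restricts-intro {w = w} {v} C⊆J W V same , V , same
  where
  same : SameSign C w v
  same {β} = factorization⇒SameSign {w = w} {u} {v} w≡uv V pos {β}

-- For x = oneLine w: x_q < 0, x_p + x_q < 0 and x_p > x_q.
Negative : ∀ {n} → 𝔅 n → Fin n → Set
Negative w q = L w (e (Sign.+ , q)) < 0ℤ

NegativeSum Inverted : ∀ {n} → 𝔅 n → Fin n → Fin n → Set
NegativeSum w p q = L w (e (Sign.+ , p) ⊞ e (Sign.+ , q)) < 0ℤ
Inverted w p q = L w (e (Sign.- , p) ⊞ e (Sign.+ , q)) < 0ℤ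

-- The signed pattern conditions, restricted to the roots of Φ_J: no p < q with
-- x_p and x_q of opposite signs and |x_p| > |x_q|, and no 2413 or 3142.
record Good {n} (J : Subset n) (w : 𝔅 n) : Set where
  field
    sum-sign : ∀ {p q} → p Fin.< q → Below J q → (Negative w q → NegativeSum w p q) × (NegativeSum w p q → Negative w q)
    no-2413  : ∀ {a b c d} → a Fin.< b → b Fin.< c → c Fin.< d → Between J a d → Inverted w a c → ¬ Inverted w a d → ¬ Inverted w b d
    no-3142  : ∀ {a b c d} → a Fin.< b → b Fin.< c → c Fin.< d → Between J a d → Inverted w a d → ¬ Inverted w b d → ¬ ¬ Inverted w a c

short-Φ⁺ : ∀ {n} {J : Subset n} {q} → Below J q → Φ⁺ J (e (Sign.+ , q))
short-Φ⁺ {q = q} b = short q (λ _ → refl) , Below⇒Span-short b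

sum-Φ⁺ : ∀ {n} {J : Subset n} {p q} → p Fin.< q → Below J q → Φ⁺ J (e (Sign.+ , p) ⊞ e (Sign.+ , q))
sum-Φ⁺ p<q b = long Sign.+ p<q (λ _ → refl) , Below⇒Span-sum p<q b

difference-Φ⁺ : ∀ {n} {J : Subset n} {p q} → p Fin.< q → Between J p q → Φ⁺ J (e (Sign.- , p) ⊞ e (Sign.+ , q))
difference-Φ⁺ p<q b = long Sign.- p<q (λ _ → refl) , Between⇒Span-difference p<q b

Between-narrow : ∀ {n} {J : Subset n} {a b c d} → a Fin.≤ b → c Fin.≤ d → Between J a d → Between J b c
Between-narrow a≤b c≤d bt i b<i i≤c = bt i (ℕₚ.≤-<-trans a≤b b<i) (ℕₚ.≤-trans i≤c c≤d)

-- Each inequality in `Good` is the sign of one root whose support lies in J; in a pattern on a < b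
-- < c < d, all supports are contained in that of e_d - e_a.
Good-transfer : ∀ {n} {J : Subset n} w v → SameSign J w v → Good J w → Good J v
Good-transfer {n} {J} w v same g = record
  { sum-sign = λ {p} {q} p<q b →
      (λ r → proj₁ (same (sum-Φ⁺ p<q b)) (proj₁ (Good.sum-sign g p<q b) (proj₂ (same (short-Φ⁺ b)) r))) ,
      (λ r → proj₁ (same (short-Φ⁺ b)) (proj₂ (Good.sum-sign g p<q b) (proj₂ (same (sum-Φ⁺ p<q b)) r)))
  ; no-2413 = λ {a} {b} {c} {d} a<b b<c c<d bt ac ¬ad bd → Good.no-2413 g a<b b<c c<d bt
      (from (ℕₚ.<-trans a<b b<c) (Between-narrow {a = a} {a} {c} {d} ℕₚ.≤-refl (ℕₚ.<⇒≤ c<d) bt) ac)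
      (λ r → ¬ad (to (ℕₚ.<-trans a<b (ℕₚ.<-trans b<c c<d)) bt r))
      (from (ℕₚ.<-trans b<c c<d) (Between-narrow {a = a} {b} {d} {d} (ℕₚ.<⇒≤ a<b) ℕₚ.≤-refl bt) bd)
  ; no-3142 = λ {a} {b} {c} {d} a<b b<c c<d bt ad ¬bd ¬ac → Good.no-3142 g a<b b<c c<d bt
      (from (ℕₚ.<-trans a<b (ℕₚ.<-trans b<c c<d)) bt ad)
      (λ r → ¬bd (to (ℕₚ.<-trans b<c c<d) (Between-narrow {a = a} {b} {d} {d} (ℕₚ.<⇒≤ a<b) ℕₚ.≤-refl bt) r))
      (λ r → ¬ac (to (ℕₚ.<-trans a<b b<c) (Between-narrow {a = a} {a} {c} {d} ℕₚ.≤-refl (ℕₚ.<⇒≤ c<d) bt) r))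
  }
  where
  to : ∀ {p q} → p Fin.< q → Between J p q → Inverted w p q → Inverted v p q
  to p<q b = proj₁ (same (difference-Φ⁺ p<q b))
  from : ∀ {p q} → p Fin.< q → Between J p q → Inverted v p q → Inverted w p q
  from p<q b = proj₂ (same (difference-Φ⁺ p<q b))

-- Domination and pivots

coeff-α-≤ : ∀ {n} {β : V n} {i} → (∀ j → 0ℤ ≤ coeff β j) → 1ℤ ≤ coeff β i → ∀ j → 0ℤ ≤ coeff (β ⊟ α i) j
coeff-α-≤ {β = β} {i} nonneg p j = subst (0ℤ ≤_) (sym (tailSum-⊟ (toℕ j) β (α i))) go
  where
  go : 0ℤ ≤ coeff β j - coeff (α i) j
  go with i ≟ j
  ... | yes refl = ℤₚ.i≤j⇒0≤j-i (subst (_≤ coeff β i) (sym (coeff-α-self i)) p)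
  ... | no i≢j = ℤₚ.i≤j⇒0≤j-i (subst (_≤ coeff β j) (sym (coeff-α-other i≢j)) (nonneg j))

-- The coefficients of β are nonnegative, so only the one at α_i can obstruct β ≥ α_i; absolute
-- values then serve as the natural coefficients of β - α_i.
dominates-intro : ∀ {n} {J : Subset n} {β i} → Φ⁺ J β → i ∈ J → 1ℤ ≤ coeff β i → Dominates J β (α i)
dominates-intro {J = J} {β} {i} (p , s) i∈J 1≤c = (λ j → ∣ coeff (β ⊟ α i) j ∣) , zero-off ,
  λ k → trans (combination-coeff (β ⊟ α i) k) (sum-cong-≗ λ j → cong (_* α j k) (sym (ℤₚ.0≤i⇒+∣i∣≡i (coeff-α-≤ {β = β} {i} (coeff-nonneg p) 1≤c j))))
  where
  zero-off : ∀ j → j ∉ J → ∣ coeff (β ⊟ α i) j ∣ ≡ 0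
  zero-off j j∉J = cong ∣_∣ (trans (tailSum-⊟ (toℕ j) β (α i)) (cong₂ _-_ (Span⇒coeff s j j∉J) (Span⇒coeff (Span-α i∈J) j j∉J)))

dominates-elim : ∀ {n} {J : Subset n} {β i} → Dominates J β (α i) → 1ℤ ≤ coeff β i
dominates-elim {β = β} {i} (c , _ , p) = ℤₚ.0≤i-j⇒j≤i (subst (0ℤ ≤_)
  (trans (trans (sym (coeff-combination (λ j → + c j) i)) (tailSum-cong (toℕ i) (λ k → sym (p k))))
         (trans (tailSum-⊟ (toℕ i) β (α i)) (cong (λ t → coeff β i - t) (coeff-α-self i)))) (+≤+ z≤n))

sum-coeff : ∀ {n} {i p q : Fin n} → p Fin.< q → i Fin.≤ q → 1ℤ ≤ coeff (e (Sign.+ , p) ⊞ e (Sign.+ , q)) i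
sum-coeff {i = i} {p} p<q i≤q with ℕₚ.≤-<-connex (toℕ i) (toℕ p)
... | inj₁ i≤p = subst (1ℤ ≤_) (sym (coeff-long-low Sign.+ {i} p<q i≤p)) (+≤+ (s≤s z≤n))
... | inj₂ p<i = ℤₚ.≤-reflexive (sym (coeff-long-mid Sign.+ {i} p<q p<i i≤q))

module _ {n} {J : Subset n} {i : Fin n} (w : 𝔅 n) where
  All≥ None≥ : Set
  All≥  = ∀ β → Φ⁺ J β → 1ℤ ≤ coeff β i → L w β < 0ℤ
  None≥ = ∀ β → Φ⁺ J β → 1ℤ ≤ coeff β i → ¬ L w β < 0ℤ

  -- Roots without α_i are covered by the smaller system, and the others are all inverted or all
  -- not. If a < i ≤ d, then i lies in (a,c] or in (b,d], because b < c; so e_d - e_a shares its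
  -- status with e_c - e_a or with e_d - e_b, whereas 2413 and 3142 give it the status opposite to
  -- both.
  pivot⇒Good : Good (J ∖ i) w → All≥ ⊎ None≥ → Good J w
  pivot⇒Good g uniform = record { sum-sign = sums uniform ; no-2413 = λ {a} {b} {c} {d} → λ p q r s → 2413-free {a} {b} {c} {d} p q r s uniform ; no-3142 = λ {a} {b} {c} {d} → λ p q r s → 3142-free {a} {b} {c} {d} p q r s uniform }
    where
    sums : All≥ ⊎ None≥ → ∀ {p q} → p Fin.< q → Below J q → (Negative w q → NegativeSum w p q) × (NegativeSum w p q → Negative w q)
    sums u {p} {q} p<q b with ℕₚ.≤-<-connex (toℕ i) (toℕ q) | u
    ... | inj₂ q<i | _ = Good.sum-sign g p<q λ j j≤q → Subₚ.x∈p∧x≢y⇒x∈p-y (b j j≤q) λ { refl → ℕₚ.<⇒≱ q<i j≤q }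
    ... | inj₁ i≤q | inj₁ all = (λ _ → all _ (sum-Φ⁺ p<q b) (sum-coeff {i = i} p<q i≤q)) , λ _ → all _ (short-Φ⁺ b) (ℤₚ.≤-reflexive (sym (coeff-short-≤ {i = i} {q} i≤q)))
    ... | inj₁ i≤q | inj₂ none = (λ r → ⊥-elim (none _ (short-Φ⁺ b) (ℤₚ.≤-reflexive (sym (coeff-short-≤ {i = i} {q} i≤q))) r)) , λ r → ⊥-elim (none _ (sum-Φ⁺ p<q b) (sum-coeff {i = i} p<q i≤q) r)

    all⇒ : All≥ → ∀ {p q} → p Fin.< q → Between J p q → p Fin.< i → i Fin.≤ q → Inverted w p q
    all⇒ all p<q b p<i i≤q = all _ (difference-Φ⁺ p<q b) (ℤₚ.≤-reflexive (sym (coeff-long-mid Sign.- {i} p<q p<i i≤q)))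

    none⇒ : None≥ → ∀ {p q} → p Fin.< q → Between J p q → p Fin.< i → i Fin.≤ q → ¬ Inverted w p q
    none⇒ none p<q b p<i i≤q = none _ (difference-Φ⁺ p<q b) (ℤₚ.≤-reflexive (sym (coeff-long-mid Sign.- {i} p<q p<i i≤q)))

    position : ∀ a d → Between J a d → Between (J ∖ i) a d ⊎ (a Fin.< i × i Fin.≤ d)
    position a d bt with ℕₚ.≤-<-connex (toℕ i) (toℕ a) | ℕₚ.≤-<-connex (toℕ i) (toℕ d)
    ... | inj₁ i≤a | _ = inj₁ λ j a<j j≤d → Subₚ.x∈p∧x≢y⇒x∈p-y (bt j a<j j≤d) λ { refl → ℕₚ.<⇒≱ a<j i≤a }
    ... | inj₂ a<i | inj₁ i≤d = inj₂ (a<i , i≤d)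
    ... | inj₂ _ | inj₂ d<i = inj₁ λ j a<j j≤d → Subₚ.x∈p∧x≢y⇒x∈p-y (bt j a<j j≤d) λ { refl → ℕₚ.<⇒≱ d<i j≤d }

    module _ {a b c d : Fin n} (a<b : a Fin.< b) (b<c : b Fin.< c) (c<d : c Fin.< d) (bt : Between J a d) where
      a<d : a Fin.< d
      a<d = ℕₚ.<-trans a<b (ℕₚ.<-trans b<c c<d)
      bt-ac : Between J a c
      bt-ac = Between-narrow {a = a} {a} {c} {d} ℕₚ.≤-refl (ℕₚ.<⇒≤ c<d) bt
      bt-bd : Between J b d
      bt-bd = Between-narrow {a = a} {b} {d} {d} (ℕₚ.<⇒≤ a<b) ℕₚ.≤-refl bt

      2413-free : All≥ ⊎ None≥ → Inverted w a c → ¬ Inverted w a d → ¬ Inverted w b d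
      2413-free u ac ¬ad bd with position a d bt | u
      ... | inj₁ bt′ | _ = Good.no-2413 g a<b b<c c<d bt′ ac ¬ad bd
      ... | inj₂ (a<i , i≤d) | inj₁ all = ¬ad (all⇒ all a<d bt a<i i≤d)
      ... | inj₂ (a<i , i≤d) | inj₂ none with ℕₚ.≤-<-connex (toℕ i) (toℕ c)
      ...   | inj₁ i≤c = none⇒ none (ℕₚ.<-trans a<b b<c) bt-ac a<i i≤c ac
      ...   | inj₂ c<i = none⇒ none (ℕₚ.<-trans b<c c<d) bt-bd (ℕₚ.<-trans b<c c<i) i≤d bd

      3142-free : All≥ ⊎ None≥ → Inverted w a d → ¬ Inverted w b d → ¬ ¬ Inverted w a c
      3142-free u ad ¬bd ¬ac with position a d bt | u
      ... | inj₁ bt′ | _ = Good.no-3142 g a<b b<c c<d bt′ ad ¬bd ¬ac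
      ... | inj₂ (a<i , i≤d) | inj₂ none = none⇒ none a<d bt a<i i≤d ad
      ... | inj₂ (a<i , i≤d) | inj₁ all with ℕₚ.≤-<-connex (toℕ i) (toℕ c)
      ...   | inj₁ i≤c = ¬ac (all⇒ all (ℕₚ.<-trans a<b b<c) bt-ac a<i i≤c)
      ...   | inj₂ c<i = ¬bd (all⇒ all (ℕₚ.<-trans b<c c<d) bt-bd (ℕₚ.<-trans b<c c<i) i≤d)

-- Connected components

comprehension : ∀ {n} {P : Fin n → Set} → (∀ i → Dec (P i)) → Subset n
comprehension P? = Vec.tabulate λ i → does (P? i)

module _ {n} {P : Fin n → Set} (P? : ∀ i → Dec (P i)) where
  ∈-comprehension⁺ : ∀ {i} → P i → i ∈ comprehension P?
  ∈-comprehension⁺ {i} p = lookup⇒[]= i _ (trans (lookup∘tabulate (λ j → does (P? j)) i) (true! (P? i)))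
    where
    true! : (d : Dec (P i)) → does d ≡ true
    true! (yes _) = refl
    true! (no ¬p) = contradiction p ¬p

  ∈-comprehension⁻ : ∀ {i} → i ∈ comprehension P? → P i
  ∈-comprehension⁻ {i} i∈ = witness (P? i) (trans (sym (lookup∘tabulate (λ j → does (P? j)) i)) ([]=⇒lookup i∈))
    where
    witness : (d : Dec (P i)) → does d ≡ true → P i
    witness (yes p) _ = p

-- The Dynkin diagram is the path 0, 1, ..., n-1, so two vertices are joined inside J when J
-- contains the whole interval between them.
Connected : ∀ {n} → Subset n → Fin n → Fin n → Set
Connected J m i = ∀ k → (i Fin.≤ k × k Fin.≤ m) ⊎ (m Fin.≤ k × k Fin.≤ i) → k ∈ J

connected? : ∀ {n} (J : Subset n) m i → Dec (Connected J m i)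
connected? J m i = all? λ k → ((i Finₚ.≤? k ×-dec k Finₚ.≤? m) ⊎-dec (m Finₚ.≤? k ×-dec k Finₚ.≤? i)) →-dec (k ∈? J)

Convex : ∀ {n} → Subset n → Set
Convex C = ∀ {i k l} → i ∈ C → l ∈ C → i Fin.≤ k → k Fin.≤ l → k ∈ C

tailSum-beyond : ∀ {n} i (v : V n) → n ℕ.≤ i → tailSum i v ≡ 0ℤ
tailSum-beyond {zero}  i       v p = refl
tailSum-beyond {suc n} (suc i) v (s≤s p) = tailSum-beyond i (v ∘ suc) p

module _ {n} {C : Subset n} {v : V n} (s : Span C v) where
  entry-zero : ∀ k → k ∉ C → tailSum (suc (toℕ k)) v ≡ 0ℤ → v k ≡ 0ℤ
  entry-zero k k∉C p = trans (entry-tailSum v k) (cong₂ _-_ (Span⇒coeff s k k∉C) p)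

adjacent : ∀ {n} {J : Subset (suc n)} (j : Fin n) → inject₁ j ∈ J → suc j ∈ J → ∀ k → inject₁ j Fin.≤ k → k Fin.≤ suc j → k ∈ J
adjacent j p q k j≤k k≤1+j with ℕₚ.m≤n⇒m<n∨m≡n k≤1+j
... | inj₂ eq = subst (_∈ _) (Finₚ.toℕ-injective (sym eq)) q
... | inj₁ (s≤s lt) = subst (_∈ _) (Finₚ.≤-antisym j≤k (ℕₚ.≤-trans lt (ℕₚ.≤-reflexive (sym (Finₚ.toℕ-inject₁ j))))) p

module Parts {n} (J : Subset n) (m : Fin n) where
  C : Subset n
  C = comprehension (connected? J m)

  rest? : ∀ i → Dec (i ∈ J × i ∉ C)
  rest? i = (i ∈? J) ×-dec ¬? (i ∈? C)

  B : Subset n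
  B = comprehension rest?

  C⁻ : ∀ {i} → i ∈ C → Connected J m i
  C⁻ = ∈-comprehension⁻ (connected? J m)

  C⁺ : ∀ {i} → Connected J m i → i ∈ C
  C⁺ = ∈-comprehension⁺ (connected? J m)

  B⁻ : ∀ {i} → i ∈ B → i ∈ J × i ∉ C
  B⁻ = ∈-comprehension⁻ rest?

  C⊆J : C ⊆ J
  C⊆J {i} i∈C with ℕₚ.≤-total (toℕ i) (toℕ m)
  ... | inj₁ i≤m = C⁻ i∈C i (inj₁ (ℕₚ.≤-refl , i≤m))
  ... | inj₂ m≤i = C⁻ i∈C i (inj₂ (m≤i , ℕₚ.≤-refl))

  m∈C : m ∈ J → m ∈ C
  m∈C m∈J = C⁺ λ { k (inj₁ (p , q)) → subst (_∈ J) (Finₚ.≤-antisym p q) m∈J ; k (inj₂ (p , q)) → subst (_∈ J) (Finₚ.≤-antisym p q) m∈J }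

  C-convex : Convex C
  C-convex i∈C l∈C i≤k k≤l = C⁺ λ where
    j (inj₁ (k≤j , j≤m)) → C⁻ i∈C j (inj₁ (ℕₚ.≤-trans i≤k k≤j , j≤m))
    j (inj₂ (m≤j , j≤k)) → C⁻ l∈C j (inj₂ (m≤j , ℕₚ.≤-trans j≤k k≤l))

  path-down : ∀ {i q} → q ∈ C → i Fin.≤ q → (∀ k → i Fin.≤ k → k Fin.≤ q → k ∈ J) → i ∈ C
  path-down {i} {q} q∈C i≤q p = C⁺ λ where
    k (inj₂ (m≤k , k≤i)) → C⁻ q∈C k (inj₂ (m≤k , ℕₚ.≤-trans k≤i i≤q))
    k (inj₁ (i≤k , k≤m)) → [ p k i≤k , (λ q≤k → C⁻ q∈C k (inj₁ (q≤k , k≤m))) ]′ (ℕₚ.≤-total (toℕ k) (toℕ q))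

  path-up : ∀ {i q} → i ∈ C → i Fin.≤ q → (∀ k → i Fin.≤ k → k Fin.≤ q → k ∈ J) → q ∈ C
  path-up {i} {q} i∈C i≤q p = C⁺ λ where
    k (inj₁ (q≤k , k≤m)) → C⁻ i∈C k (inj₁ (ℕₚ.≤-trans i≤q q≤k , k≤m))
    k (inj₂ (m≤k , k≤q)) → [ (λ k≤i → C⁻ i∈C k (inj₂ (m≤k , k≤i))) , (λ i≤k → p k i≤k k≤q) ]′ (ℕₚ.≤-total (toℕ k) (toℕ i))

  -- `P` describes an interval of J with upper end q. It is connected, so whether q belongs to C
  -- decides the matter for all its elements.
  interval : ∀ {q} (P : Fin n → Set) → (∀ i k → P i → i Fin.≤ k → k Fin.≤ q → k ∈ J) → (∀ i → P i → i Fin.≤ q) →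
             (∀ i → P i → i ∈ C) ⊎ (∀ i → P i → i ∈ B)
  interval {q} P full top with q ∈? C
  ... | yes q∈C = inj₁ λ i p → path-down q∈C (top i p) (λ k → full i k p)
  ... | no q∉C  = inj₂ λ i p → ∈-comprehension⁺ rest?
          (full i i p ℕₚ.≤-refl (top i p) , λ i∈C → q∉C (path-up i∈C (top i p) (λ k → full i k p)))

  Below-split : ∀ {q} → Below J q → Below C q ⊎ Below B q
  Below-split {q} b = interval (Fin._≤ q) (λ i k _ _ k≤q → b k k≤q) (λ _ p → p)

  Between-split : ∀ {p q} → Between J p q → Between C p q ⊎ Between B p q
  Between-split {p} {q} b = [ (λ f → inj₁ λ i p<i i≤q → f i (p<i , i≤q)) , (λ f → inj₂ λ i p<i i≤q → f i (p<i , i≤q)) ]′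
    (interval (λ i → p Fin.< i × i Fin.≤ q) (λ i k x i≤k k≤q → b k (ℕₚ.<-≤-trans (proj₁ x) i≤k) k≤q) (λ _ → proj₂))

  -- The support of a positive root is an interval of the diagram, hence lies in one part.
  split⁺ : ∀ {β} → Φ⁺ J β → Span C β ⊎ Span B β
  split⁺ (short q p , s) = [ inj₁ ∘ back ∘ Below⇒Span-short {q = q} , inj₂ ∘ back ∘ Below⇒Span-short {q = q} ]′ (Below-split {q} (Span-short⇒Below {q = q} (Span-cong p s)))
    where
    back : ∀ {K} → Span K (e (Sign.+ , q)) → Span K _
    back = Span-cong λ k → sym (p k)
  split⁺ (long Sign.+ {i} {j} i<j p , s) = [ inj₁ ∘ back ∘ Below⇒Span-sum i<j , inj₂ ∘ back ∘ Below⇒Span-sum i<j ]′ (Below-split {j} (Span-sum⇒Below i<j (Span-cong p s)))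
    where
    back : ∀ {K} → Span K (e (Sign.+ , i) ⊞ e (Sign.+ , j)) → Span K _
    back = Span-cong λ k → sym (p k)
  split⁺ (long Sign.- {i} {j} i<j p , s) = [ inj₁ ∘ back ∘ Between⇒Span-difference i<j , inj₂ ∘ back ∘ Between⇒Span-difference i<j ]′ (Between-split {i} {j} (Span-difference⇒Between i<j (Span-cong p s)))
    where
    back : ∀ {K} → Span K (e (Sign.- , i) ⊞ e (Sign.+ , j)) → Span K _
    back = Span-cong λ k → sym (p k)

  split : ∀ β → Φ J β → Φ C β ⊎ Φ B β
  split β (r , s) with root-cases r
  ... | inj₁ p = [ (λ t → inj₁ (r , t)) , (λ t → inj₂ (r , t)) ]′ (split⁺ (p , s))
  ... | inj₂ p = [ (λ t → inj₁ (r , back t)) , (λ t → inj₂ (r , back t)) ]′ (split⁺ (p , Span-⊖ s))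
    where
    back : ∀ {K} → Span K (⊖ β) → Span K β
    back t = Span-cong (λ k → ℤₚ.neg-involutive (β k)) (Span-⊖ t)

  -- Orthogonality holds coordinate by coordinate. A nonzero coordinate k requires k or k + 1 in the
  -- support (only k if it is the last), and adjacent elements of J never lie in different parts.
  orthogonal : ∀ β γ → Φ C β → Φ B γ → ⟪ β , γ ⟫ ≡ 0ℤ
  orthogonal β γ (_ , s) (_ , t) = Σ-zero λ k → [ (λ p → cong (_* γ k) p) , (λ p → trans (cong (β k *_) p) (ℤₚ.*-zeroʳ (β k))) ]′ (disjoint k)
    where
    disjoint : ∀ k → β k ≡ 0ℤ ⊎ γ k ≡ 0ℤ
    disjoint k with k ∈? C | view k
    ... | no k∉C  | ‵fromℕ {n′} = inj₁ (entry-zero s (fromℕ n′) k∉C (tailSum-beyond _ β (ℕₚ.≤-reflexive (cong suc (sym (Finₚ.toℕ-fromℕ n′))))))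
    ... | yes k∈C | ‵fromℕ {n′} = inj₂ (entry-zero t (fromℕ n′) (λ k∈B → proj₂ (B⁻ k∈B) k∈C) (tailSum-beyond _ γ (ℕₚ.≤-reflexive (cong suc (sym (Finₚ.toℕ-fromℕ n′))))))
    ... | no k∉C  | ‵inject₁ j with suc j ∈? C
    ...   | no j∉C  = inj₁ (entry-zero s (inject₁ j) k∉C (trans (cong (λ i → tailSum (suc i) β) (Finₚ.toℕ-inject₁ j)) (Span⇒coeff s (suc j) j∉C)))
    ...   | yes j∈C = inj₂ (entry-zero t (inject₁ j)
              (λ k∈B → k∉C (path-down j∈C (ℕₚ.≤-trans (ℕₚ.≤-reflexive (Finₚ.toℕ-inject₁ j)) (ℕₚ.n≤1+n _)) (adjacent j (proj₁ (B⁻ k∈B)) (C⊆J j∈C))))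
              (trans (cong (λ i → tailSum (suc i) γ) (Finₚ.toℕ-inject₁ j)) (Span⇒coeff t (suc j) λ j∈B → proj₂ (B⁻ j∈B) j∈C)))
    disjoint k | yes k∈C | ‵inject₁ j = inj₂ (entry-zero t (inject₁ j) (λ k∈B → proj₂ (B⁻ k∈B) k∈C)
      (trans (cong (λ i → tailSum (suc i) γ) (Finₚ.toℕ-inject₁ j)) (Span⇒coeff t (suc j) λ j∈B → proj₂ (B⁻ j∈B)
        (path-up k∈C (ℕₚ.≤-trans (ℕₚ.≤-reflexive (Finₚ.toℕ-inject₁ j)) (ℕₚ.n≤1+n _)) (adjacent j (C⊆J k∈C) (proj₁ (B⁻ j∈B)))))))

  decomposition : m ∈ J → Nonempty B → J ≡ C ⊕ B
  decomposition m∈J B≢∅ = record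
    { A⊆J = C⊆J ; B⊆J = λ i∈B → proj₁ (B⁻ i∈B) ; nonemptyA = m , m∈C m∈J ; nonemptyB = B≢∅ ; cover = split ; orthogonal = orthogonal }

-- The root with support from a to b is e_b if a is 0, and e_b minus the basis vector at a - 1
-- otherwise.
joining-root : ∀ {n} {C : Subset n} {a b} → Convex C → a ∈ C → b ∈ C → a Fin.≤ b →
               ∃[ γ ] Φ C γ × coeff γ a ≡ 1ℤ × coeff γ b ≡ 1ℤ
joining-root {a = zero} {b} conv a∈C b∈C a≤b = e (Sign.+ , b) ,
  (short Sign.+ b (λ _ → refl) , Below⇒Span-short {q = b} λ i i≤b → conv a∈C b∈C z≤n i≤b) ,
  coeff-short-≤ {i = zero} {b} z≤n , coeff-short-≤ {i = b} {b} ℕₚ.≤-refl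
joining-root {a = suc a} {b} conv a∈C b∈C a<b = e (Sign.- , inject₁ a) ⊞ e (Sign.+ , b) ,
  (long Sign.- Sign.+ lt (λ _ → refl) , Between⇒Span-difference lt λ i a<i i≤b → conv a∈C b∈C (subst (ℕ._< toℕ i) (Finₚ.toℕ-inject₁ a) a<i) i≤b) ,
  coeff-long-mid Sign.- {suc a} lt (ℕₚ.≤-reflexive (cong suc (Finₚ.toℕ-inject₁ a))) a<b , coeff-long-mid Sign.- {b} lt lt ℕₚ.≤-refl
  where
  lt : inject₁ a Fin.< b
  lt = subst (ℕ._< toℕ b) (sym (Finₚ.toℕ-inject₁ a)) a<b

-- A common element i would make α_i orthogonal to itself.
⊕-disjoint : ∀ {n} {J A B : Subset n} → J ≡ A ⊕ B → ∀ {i} → i ∈ A → i ∉ B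
⊕-disjoint s {i} i∈A i∈B = i≮i (subst (0ℤ <_) (_≡_⊕_.orthogonal s (α i) (α i) (α-root i , Span-α i∈A) (α-root i , Span-α i∈B)) (norm-positive i))

-- The root joining an element of A to an element of B has both in its support, so it belongs to
-- neither summand.
convex⇒irreducible : ∀ {n} {C : Subset n} → Convex C → ¬ Reducible C
convex⇒irreducible {C = C} conv (A , B , s) with _≡_⊕_.nonemptyA s | _≡_⊕_.nonemptyB s
... | a , a∈A | b , b∈B = contradict joining
  where
  open _≡_⊕_ s
  joining : ∃[ γ ] Φ C γ × coeff γ a ≡ 1ℤ × coeff γ b ≡ 1ℤ
  joining with ℕₚ.≤-total (toℕ a) (toℕ b)
  ... | inj₁ a≤b = joining-root conv (A⊆J a∈A) (B⊆J b∈B) a≤b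
  ... | inj₂ b≤a with joining-root conv (B⊆J b∈B) (A⊆J a∈A) b≤a
  ...   | γ , r , p , q = γ , r , q , p
  contradict : ∃[ γ ] Φ C γ × coeff γ a ≡ 1ℤ × coeff γ b ≡ 1ℤ → ⊥
  contradict (γ , r , p , q) with cover γ r
  ... | inj₁ (_ , t) = ⊕-disjoint s (coeff≢0⇒∈ t b (≡1⇒≢0 q)) b∈B
  ... | inj₂ (_ , t) = ⊕-disjoint s a∈A (coeff≢0⇒∈ t a (≡1⇒≢0 p))

full-component⇒convex : ∀ {n} {J : Subset n} {m} → ¬ (∃[ i ] i ∈ J × i ∉ Parts.C J m) → Convex J
full-component⇒convex {J = J} {m} ¬rest i∈J l∈J i≤k k≤l = C⊆J (C-convex (J⊆C i∈J) (J⊆C l∈J) i≤k k≤l)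
  where
  open Parts J m
  J⊆C : ∀ {i} → i ∈ J → i ∈ C
  J⊆C {i} i∈J with i ∈? C
  ... | yes p = p
  ... | no p  = contradiction (i , i∈J , p) ¬rest

-- If C exhausted J, then J would be convex and hence irreducible.
component : ∀ {n} {J : Subset n} {m} → Reducible J → m ∈ J → Component J (Parts.C J m)
component {J = J} {m} red m∈J with Finₚ.any? (Parts.rest? J m)
... | yes (b , b∈) = ((m , m∈C m∈J) , convex⇒irreducible C-convex) , B , decomposition m∈J (b , ∈-comprehension⁺ rest? b∈)
  where open Parts J m
... | no ¬rest = contradiction red (convex⇒irreducible (full-component⇒convex ¬rest))

-- Separable elements satisfy the pattern condition

∖-⊆ : ∀ {n} (J : Subset n) i → J ∖ i ⊆ J
∖-⊆ J i = Subₚ.p─q⊆p J _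

-- Roots in type A₁ agree up to sign, so they vanish at the same coordinates; exhibiting two roots
-- that do not excludes the type.
A₁-roots : ∀ {n} {J : Subset n} → TypeA₁ J → ∀ {β β′} → Φ J β → Φ J β′ → ∀ {k} → β k ≡ 0ℤ → β′ k ≢ 1ℤ
A₁-roots (γ , _ , h) {β} {β′} r r′ {k} p q = ≡1⇒≢0 q (β′-zero (h β′ r′))
  where
  γ-zero : γ k ≡ 0ℤ
  γ-zero with h β r
  ... | inj₁ s = trans (sym (s k)) p
  ... | inj₂ s = ℤₚ.neg-injective (trans (sym (s k)) p)
  β′-zero : β′ ≗ γ ⊎ β′ ≗ ⊖ γ → β′ k ≡ 0ℤ
  β′-zero (inj₁ s) = trans (s k) γ-zero
  β′-zero (inj₂ s) = trans (s k) (cong -_ γ-zero)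

separable⇒Good : ∀ {n} {J : Subset n} {w} → InW J w → Separable J w → Good J w
-- Induction applies to the restricted element v of W_C; equal signs on Φ_C carry its conclusion
-- back to w.
restricted⇒Good : ∀ {n} {J C : Subset n} {w} → C ⊆ J → InW J w → (∃[ v ] Restricts J w C v × Separable C v) → Good C w

restricted⇒Good {w = w} C⊆J W (v , R , s) =
  Good-transfer v w (SameSign-sym w v (λ {β} → restricts-elim {w = w} {v} C⊆J W R {β})) (separable⇒Good (proj₁ R) s)

separable⇒Good {J = J} W (trivial empty) = record
  { sum-sign = λ {p} {q} p<q b → contradiction (q , b q ℕₚ.≤-refl) empty
  ; no-2413  = λ {a} {b} {c} {d} a<b b<c c<d bt → contradiction (d , bt d (ℕₚ.<-trans a<b (ℕₚ.<-trans b<c c<d)) ℕₚ.≤-refl) empty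
  ; no-3142  = λ {a} {b} {c} {d} a<b b<c c<d bt → contradiction (d , bt d (ℕₚ.<-trans a<b (ℕₚ.<-trans b<c c<d)) ℕₚ.≤-refl) empty
  }
separable⇒Good {J = J} W (typeA₁ A₁) = record
  { sum-sign = λ {p} {q} p<q b → ⊥-elim (sums p<q b)
  ; no-2413  = λ a<b b<c c<d bt _ _ _ → differences a<b b<c c<d bt
  ; no-3142  = λ a<b b<c c<d bt _ _ _ → differences a<b b<c c<d bt
  }
  where
  sums : ∀ {p q} → p Fin.< q → Below J q → ⊥
  sums {p} {q} p<q b = A₁-roots A₁ {e (Sign.+ , q)} {e (Sign.+ , p)}
    (short Sign.+ q (λ _ → refl) , Below⇒Span-short {q = q} b)
    (short Sign.+ p (λ _ → refl) , Below⇒Span-short {q = p} λ i i≤p → b i (ℕₚ.≤-trans i≤p (ℕₚ.<⇒≤ p<q)))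
    {p} (e-other Sign.+ (<⇒≢ p<q ∘ sym)) (e-self Sign.+ p)
  differences : ∀ {a b c d} → a Fin.< b → b Fin.< c → c Fin.< d → Between J a d → ⊥
  differences {a} {b} {c} {d} a<b b<c c<d bt = A₁-roots A₁ {e (Sign.- , a) ⊞ e (Sign.+ , d)} {e (Sign.- , a) ⊞ e (Sign.+ , c)}
    (long Sign.- Sign.+ a<d (λ _ → refl) , Between⇒Span-difference a<d bt)
    (long Sign.- Sign.+ a<c (λ _ → refl) , Between⇒Span-difference a<c (Between-narrow {a = a} {a} {c} {d} ℕₚ.≤-refl (ℕₚ.<⇒≤ c<d) bt))
    {c} (cong₂ _+_ (e-other Sign.- (<⇒≢ a<c)) (e-other Sign.+ (<⇒≢ c<d ∘ sym))) (cong₂ _+_ (e-other Sign.- (<⇒≢ a<c)) (e-self Sign.+ c))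
    where
    a<c : a Fin.< c
    a<c = ℕₚ.<-trans a<b b<c
    a<d : a Fin.< d
    a<d = ℕₚ.<-trans a<c c<d
separable⇒Good {J = J} {w} W (reducible red f) = record
  { sum-sign = λ {p} {q} p<q b → Good.sum-sign (good q (b q ℕₚ.≤-refl)) p<q (below q b)
  ; no-2413  = λ {a} {b} {c} {d} a<b b<c c<d bt → let d∈J = bt d (ℕₚ.<-trans a<b (ℕₚ.<-trans b<c c<d)) ℕₚ.≤-refl in
                 Good.no-2413 (good d d∈J) a<b b<c c<d (between a d d∈J bt)
  ; no-3142  = λ {a} {b} {c} {d} a<b b<c c<d bt → let d∈J = bt d (ℕₚ.<-trans a<b (ℕₚ.<-trans b<c c<d)) ℕₚ.≤-refl in
                 Good.no-3142 (good d d∈J) a<b b<c c<d (between a d d∈J bt)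
  }
  where
  open Parts J using (C; C⊆J; m∈C; path-down)
  good : ∀ m → m ∈ J → Good (C m) w
  good m m∈J = restricted⇒Good (C⊆J m) W (f (C m) (component red m∈J))
  -- The supports involved are intervals ending at q, or at d for the patterns, so they lie in the
  -- component of that end.
  below : ∀ q → Below J q → Below (C q) q
  below q b i i≤q = path-down q (m∈C q (b q ℕₚ.≤-refl)) i≤q λ k _ k≤q → b k k≤q
  between : ∀ a d → d ∈ J → Between J a d → Between (C d) a d
  between a d d∈J b i a<i i≤d = path-down d (m∈C d d∈J) i≤d λ k i≤k k≤d → b k (ℕₚ.<-≤-trans a<i i≤k) k≤d
separable⇒Good {J = J} {w} W (irreducible _ i i∈J r u) = pivot⇒Good w (restricted⇒Good (∖-⊆ J i) W r) (uniform u)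
  where
  uniform : (∀ β → Φ⁺ J β → Dominates J β (α i) → Inversion J w β) ⊎ (∀ β → Φ⁺ J β → Dominates J β (α i) → ¬ Inversion J w β) →
            All≥ {J = J} {i} w ⊎ None≥ {J = J} {i} w
  uniform (inj₁ all)  = inj₁ λ β b c → inversion-elim {w = w} (all β b (dominates-intro b i∈J c))
  uniform (inj₂ none) = inj₂ λ β b c p → none β b (dominates-intro b i∈J c) (inversion-intro {w = w} W b p)

-- Separable permutations decompose

Cut : (ℕ → ℕ → Set) → ℕ → ℕ → Set
Cut R i r = ∀ {p q} → p ℕ.< i → i ℕ.≤ q → q ℕ.≤ r → R p q

-- With R read as comparison of entries, this is a decomposition of positions 0, ..., r as a direct
-- or a skew sum; i is the first position of the second block.
Splits : (ℕ → ℕ → Set) → ℕ → Set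
Splits R r = ∃[ i ] 1 ℕ.≤ i × i ℕ.≤ r × (Cut R i r ⊎ Cut (λ p q → R q p) i r)

Splits-flip : ∀ {R r} → Splits (λ p q → R q p) r → Splits R r
Splits-flip (i , 1≤i , i≤r , inj₁ c) = i , 1≤i , i≤r , inj₂ c
Splits-flip (i , 1≤i , i≤r , inj₂ c) = i , 1≤i , i≤r , inj₁ c

private
  at-end : ∀ {r q} → q ℕ.≤ suc r → q ℕ.≤ r ⊎ q ≡ suc r
  at-end q≤ with ℕₚ.m≤n⇒m<n∨m≡n q≤
  ... | inj₁ (s≤s q≤r) = inj₁ q≤r
  ... | inj₂ eq        = inj₂ eq

-- Take the smallest cut of the prefix that ends at r.  If the new last element
-- lies strictly between two elements of the first block, then that block splits
-- the other way, and the two elements, r and r + 1 form the pattern 3142.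
extend : ∀ {R : ℕ → ℕ → Set} → (∀ p q → Dec (R p q)) → (∀ {p q s} → R p q → R q s → R p s) → (∀ {p q} → R p q → ¬ R q p) →
         ∀ r → (∀ {p} → p ℕ.≤ r → R p (suc r) ⊎ R (suc r) p) →
         (∀ {a b} → a ℕ.< b → b ℕ.< r → R b (suc r) → R (suc r) a → ¬ R a r) →
         (∀ k → 1 ℕ.≤ k → k ℕ.≤ r → Splits R k) →
         ∀ i → Acc ℕ._<_ i → 1 ℕ.≤ i → i ℕ.≤ r → Cut R i r → Splits R (suc r)
extend {R} R? R-trans R-asym r total no-3142 shorter i@(suc k) (acc rec) 1≤i i≤r cut
  with ℕₚ.anyUpTo? (λ p → R? (suc r) p) i | ℕₚ.anyUpTo? (λ p → R? p (suc r)) i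
... | no ¬larger | _ = i , 1≤i , ℕₚ.m≤n⇒m≤1+n i≤r , inj₁ cut′
  where
  cut′ : Cut R i (suc r)
  cut′ p<i i≤q q≤ with at-end q≤
  ... | inj₁ q≤r = cut p<i i≤q q≤r
  ... | inj₂ refl with total (ℕₚ.≤-trans (ℕₚ.<⇒≤ p<i) i≤r)
  ...   | inj₁ x = x
  ...   | inj₂ x = contradiction (_ , p<i , x) ¬larger
-- The new element is below the first block, and the first block is below the second, so the new
-- element splits off alone.
... | yes (u , u<i , r<u) | no ¬smaller = suc r , s≤s z≤n , ℕₚ.≤-refl , inj₂ cut′
  where
  first : ∀ {p} → p ℕ.< suc r → R (suc r) p
  first {p} (s≤s p≤r) with ℕₚ.<-≤-connex p i
  ... | inj₂ i≤p = R-trans r<u (cut u<i i≤p p≤r)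
  ... | inj₁ p<i with total p≤r
  ...   | inj₁ x = contradiction (_ , p<i , x) ¬smaller
  ...   | inj₂ x = x
  cut′ : Cut (λ p q → R q p) (suc r) (suc r)
  cut′ p<r r≤q q≤r rewrite ℕₚ.≤-antisym q≤r r≤q = first p<r
... | yes (u , s≤s u≤k , r<u) | yes (v , s≤s v≤k , v<r) with shorter k (1≤k k u≤k v≤k) (ℕₚ.<⇒≤ i≤r)
  where
  -- For k = 0 the positions u and v coincide, and one element would be both above and below the new
  -- one.
  1≤k : ∀ k → u ℕ.≤ k → v ℕ.≤ k → 1 ℕ.≤ k
  1≤k zero z≤n z≤n = contradiction v<r (R-asym r<u)
  1≤k (suc k) _ _  = s≤s z≤n
-- The first block splits in the same direction, so j is an earlier cut of the whole prefix; this
-- descent ends at the smallest cut.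
...   | j , 1≤j , j≤k , inj₁ cutⱼ = extend R? R-trans R-asym r total no-3142 shorter j (rec (s≤s j≤k)) 1≤j (ℕₚ.≤-trans j≤k (ℕₚ.<⇒≤ i≤r)) cut′
  where
  cut′ : Cut R j r
  cut′ {p} {q} p<j j≤q q≤r with ℕₚ.≤-<-connex q k
  ... | inj₁ q≤k = cutⱼ p<j j≤q q≤k
  ... | inj₂ k<q = cut (ℕₚ.<-trans p<j (s≤s j≤k)) k<q q≤r
...   | j , 1≤j , j≤k , inj₂ cutⱼ = contradict upper lower
  where
  -- Everything before j exceeds everything from j to k. An element above the new one can thus be
  -- moved before j, and in `lower` an element below it to j or later.
  upper : ∃[ a ] a ℕ.< j × R (suc r) a
  upper with ℕₚ.<-≤-connex u j
  ... | inj₁ u<j = u , u<j , r<u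
  ... | inj₂ j≤u = 0 , 1≤j , R-trans r<u (cutⱼ 1≤j j≤u u≤k)
  lower : ∃[ b ] j ℕ.≤ b × b ℕ.≤ k × R b (suc r)
  lower with ℕₚ.<-≤-connex v j
  ... | inj₁ v<j = j , ℕₚ.≤-refl , j≤k , R-trans (cutⱼ v<j ℕₚ.≤-refl j≤k) v<r
  ... | inj₂ j≤v = v , j≤v , v≤k , v<r
  contradict : (∃[ a ] a ℕ.< j × R (suc r) a) → (∃[ b ] j ℕ.≤ b × b ℕ.≤ k × R b (suc r)) → Splits R (suc r)
  contradict (a , a<j , r<a) (b , j≤b , b≤k , b<r) = contradiction (cut (ℕₚ.<-≤-trans a<j (ℕₚ.≤-trans j≤k (ℕₚ.n≤1+n k))) i≤r ℕₚ.≤-refl)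
    (no-3142 (ℕₚ.<-≤-trans a<j j≤b) (ℕₚ.≤-<-trans b≤k i≤r) b<r r<a)

-- Strong induction on the length of the prefix. A skew decomposition is a direct one for the
-- converse relation, which exchanges 3142 and 2413.
splits : ∀ {R : ℕ → ℕ → Set} → (∀ p q → Dec (R p q)) → (∀ {p q s} → R p q → R q s → R p s) → (∀ {p q} → R p q → ¬ R q p) →
         ∀ N → (∀ {p q} → p ℕ.< q → q ℕ.≤ N → R p q ⊎ R q p) →
         (∀ {a b c d} → a ℕ.< b → b ℕ.< c → c ℕ.< d → d ℕ.≤ N → R b d → R d a → ¬ R a c) →
         (∀ {a b c d} → a ℕ.< b → b ℕ.< c → c ℕ.< d → d ℕ.≤ N → R c a → R a d → ¬ R d b) →
         1 ℕ.≤ N → Splits R N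
splits {R} R? R-trans R-asym N total no-3142 no-2413 1≤N = go N 1≤N ℕₚ.≤-refl (<-wellFounded N)
  where
  swap : ∀ {A B : Set} → A ⊎ B → B ⊎ A
  swap = [ inj₂ , inj₁ ]′
  go : ∀ r → 1 ℕ.≤ r → r ℕ.≤ N → Acc ℕ._<_ r → Splits R r
  go 1 _ 1≤N _ = 1 , ℕₚ.≤-refl , ℕₚ.≤-refl , Sum.map pair pair (total (s≤s z≤n) 1≤N)
    where
    pair : ∀ {S : ℕ → ℕ → Set} → S 0 1 → Cut S 1 1
    pair x (s≤s z≤n) (s≤s z≤n) (s≤s z≤n) = x
  go (suc r@(suc _)) _ r<N (acc rec) with go r (s≤s z≤n) (ℕₚ.<⇒≤ r<N) (rec ℕₚ.≤-refl)
  ... | i , 1≤i , i≤r , inj₁ cut = extend R? R-trans R-asym r (λ p≤r → total (s≤s p≤r) r<N)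
          (λ a<b b<r → no-3142 a<b b<r ℕₚ.≤-refl r<N)
          (λ k 1≤k k≤r → go k 1≤k (ℕₚ.≤-trans k≤r (ℕₚ.<⇒≤ r<N)) (rec (s≤s k≤r))) i (<-wellFounded i) 1≤i i≤r cut
  ... | i , 1≤i , i≤r , inj₂ cut = Splits-flip (extend {λ p q → R q p} (λ p q → R? q p) (λ x y → R-trans y x) R-asym r (λ p≤r → swap (total (s≤s p≤r) r<N))
          (λ a<b b<r x y z → no-2413 a<b b<r ℕₚ.≤-refl r<N z y x)
          (λ k 1≤k k≤r → Splits-flip (go k 1≤k (ℕₚ.≤-trans k≤r (ℕₚ.<⇒≤ r<N)) (rec (s≤s k≤r)))) i (<-wellFounded i) 1≤i i≤r cut)

-- Good elements are separable

module _ {n} (w : 𝔅 n) where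
  private
    x : Fin n → ℤ
    x = oneLine w

  L-sum : ∀ p q → L w (e (Sign.+ , p) ⊞ e (Sign.+ , q)) ≡ x p + x q
  L-sum p q = L-pair w (Sign.+ , p) (Sign.+ , q)

  L-difference : ∀ p q → L w (e (Sign.- , p) ⊞ e (Sign.+ , q)) ≡ x q - x p
  L-difference p q = trans (L-pair w (Sign.- , p) (Sign.+ , q)) (trans (cong (_+ x q) (oneLine-neg w p)) (ℤₚ.+-comm (- x p) (x q)))

  negative⁺ : ∀ {q} → x q < 0ℤ → Negative w q
  negative⁺ {q} = subst (_< 0ℤ) (sym (L-e w (Sign.+ , q)))

  negative⁻ : ∀ {q} → Negative w q → x q < 0ℤ
  negative⁻ {q} = subst (_< 0ℤ) (L-e w (Sign.+ , q))

  negativeSum⁺ : ∀ {p q} → x p + x q < 0ℤ → NegativeSum w p q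
  negativeSum⁺ {p} {q} = subst (_< 0ℤ) (sym (L-sum p q))

  negativeSum⁻ : ∀ {p q} → NegativeSum w p q → x p + x q < 0ℤ
  negativeSum⁻ {p} {q} = subst (_< 0ℤ) (L-sum p q)

  inverted⁺ : ∀ {p q} → x q < x p → Inverted w p q
  inverted⁺ {p} {q} r = subst (_< 0ℤ) (sym (L-difference p q)) (neg-pos (subst (0ℤ <_) (flip (x p) (x q)) (gap r)))
    where
    flip : ∀ a b → a - b ≡ - (b - a)
    flip = solve-∀

  inverted⁻ : ∀ {p q} → Inverted w p q → x q < x p
  inverted⁻ {p} {q} r = ungap (subst (0ℤ <_) (flip (x p) (x q)) (-‿pos (subst (_< 0ℤ) (L-difference p q) r)))
    where
    flip : ∀ a b → - (b - a) ≡ a - b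
    flip = solve-∀

  oneLine-nonzero : ∀ q → x q ≢ 0ℤ
  oneLine-nonzero q = value≢0 (w ⟨ Sign.+ , q ⟩)

  oneLine-sum-nonzero : ∀ {p q} → p ≢ q → x p + x q ≢ 0ℤ
  oneLine-sum-nonzero {p} {q} p≢q r = p≢q (cong proj₂ (⟨⟩-injective w {Sign.+ , p} {Sign.- , q}
    (trans (opposite-value (w ⟨ Sign.+ , p ⟩) (w ⟨ Sign.+ , q ⟩) r) (sym (𝔅.odd w (Sign.+ , q))))))

  oneLine-injective : ∀ {p q} → x p ≡ x q → p ≡ q
  oneLine-injective {p} {q} r = cong proj₂ (⟨⟩-injective w {Sign.+ , p} {Sign.+ , q} (trans
    (opposite-value (w ⟨ Sign.+ , p ⟩) (neg (w ⟨ Sign.+ , q ⟩)) (trans (cong₂ _+_ r (value-neg (w ⟨ Sign.+ , q ⟩))) (ℤₚ.+-inverseʳ (x q))))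
    (neg-involutive (w ⟨ Sign.+ , q ⟩))))

  negative? : ∀ q → Dec (Negative w q)
  negative? q = _ ℤₚ.<? 0ℤ

  ¬negative : ∀ {q} → ¬ Negative w q → 0ℤ < x q
  ¬negative {q} ¬neg = [ (λ r → contradiction (negative⁺ {q} r) ¬neg) , id ]′ (≢0⇒sign (oneLine-nonzero q))

  ¬negativeSum : ∀ {p q} → p ≢ q → ¬ NegativeSum w p q → 0ℤ < x p + x q
  ¬negativeSum {p} {q} p≢q ¬neg = [ (λ r → contradiction (negativeSum⁺ {p} {q} r) ¬neg) , id ]′ (≢0⇒sign (oneLine-sum-nonzero p≢q))

least : ∀ {n} {P : Fin n → Set} → (∀ i → Dec (P i)) → ∀ {j} → P j → ∃[ i ] P i × (∀ k → k Fin.< i → ¬ P k)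
least {P = P} P? {j} p = go j p (Finᵢ.<-wellFounded j)
  where
  go : ∀ j → P j → Acc Fin._<_ j → ∃[ i ] P i × (∀ k → k Fin.< i → ¬ P k)
  go j p (acc rec) with any? (λ k → (k Finₚ.<? j) ×-dec P? k)
  ... | yes (k , k<j , q) = go k q (rec k<j)
  ... | no ¬smaller = j , p , λ k k<j q → ¬smaller (k , k<j , q)

greatest : ∀ {n} {P : Fin n → Set} → (∀ i → Dec (P i)) → ∀ {j} → P j → ∃[ i ] P i × (∀ k → P k → k Fin.≤ i)
greatest {P = P} P? {j} p = go j p (Finᵢ.>-wellFounded j)
  where
  go : ∀ j → P j → Acc Fin._>_ j → ∃[ i ] P i × (∀ k → P k → k Fin.≤ i)
  go j p (acc rec) with any? (λ k → (j Finₚ.<? k) ×-dec P? k)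
  ... | yes (k , j<k , q) = go k q (rec j<k)
  ... | no ¬larger = j , p , λ k q → ℕₚ.≮⇒≥ λ j<k → ¬larger (k , j<k , q)

-- Roots above a simple root, and pivots in type B

1≰0 : ¬ 1ℤ ≤ 0ℤ
1≰0 (+≤+ ())

data Dominating {n} (J : Subset n) (i : Fin n) (β : V n) : Set where
  single     : ∀ q → i Fin.≤ q → Below J q → β ≗ e (Sign.+ , q) → Dominating J i β
  sum        : ∀ {p q} → p Fin.< q → i Fin.≤ q → Below J q → β ≗ e (Sign.+ , p) ⊞ e (Sign.+ , q) → Dominating J i β
  difference : ∀ {p q} → p Fin.< q → p Fin.< i → i Fin.≤ q → Between J p q → β ≗ e (Sign.- , p) ⊞ e (Sign.+ , q) → Dominating J i β

dominating : ∀ {n} {J : Subset n} {i β} → Φ⁺ J β → 1ℤ ≤ coeff β i → Dominating J i β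
dominating {i = i} (short q β≗ , s) c with ℕₚ.≤-<-connex (toℕ i) (toℕ q)
... | inj₁ i≤q = single q i≤q (Span-short⇒Below {q = q} (Span-cong β≗ s)) β≗
... | inj₂ q<i = contradiction (subst (1ℤ ≤_) (trans (tailSum-cong (toℕ i) β≗) (coeff-short-> {i = i} {q} q<i)) c) 1≰0
dominating {i = i} (long s₀ {p} {q} p<q β≗ , s) c with ℕₚ.≤-<-connex (toℕ i) (toℕ q)
... | inj₂ q<i = contradiction (subst (1ℤ ≤_) (trans (tailSum-cong (toℕ i) β≗) (coeff-long-high s₀ {i} p<q q<i)) c) 1≰0
... | inj₁ i≤q with s₀
...   | Sign.+ = sum p<q i≤q (Span-sum⇒Below p<q (Span-cong β≗ s)) β≗
...   | Sign.- with ℕₚ.≤-<-connex (toℕ i) (toℕ p)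
...     | inj₁ i≤p = contradiction (subst (1ℤ ≤_) (trans (tailSum-cong (toℕ i) β≗) (coeff-long-low Sign.- {i} p<q i≤p)) c) 1≰0
...     | inj₂ p<i = difference p<q p<i i≤q (Span-difference⇒Between p<q (Span-cong β≗ s)) β≗

Pivot : ∀ {n} → Subset n → 𝔅 n → Set
Pivot J w = ∃[ i ] i ∈ J × (All≥ {J = J} {i} w ⊎ None≥ {J = J} {i} w)

-- `P` is the common truth value of all inversions above α_i; deciding it selects the alternative of
-- the pivot.
uniform⇒pivot : ∀ {n} {J : Subset n} (w : 𝔅 n) {i} → i ∈ J → (P : Set) → Dec P →
  (∀ {q} → i Fin.≤ q → Below J q → (P → Negative w q) × (Negative w q → P)) →
  (∀ {p q} → p Fin.< q → i Fin.≤ q → Below J q → (P → NegativeSum w p q) × (NegativeSum w p q → P)) →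
  (∀ {p q} → p Fin.< q → p Fin.< i → i Fin.≤ q → Between J p q → (P → Inverted w p q) × (Inverted w p q → P)) → Pivot J w
uniform⇒pivot {J = J} w {i} i∈J P P? f g h = i , i∈J , decide P?
  where
  same : ∀ β → Dominating J i β → (P → L w β < 0ℤ) × (L w β < 0ℤ → P)
  same β (single q i≤q b β≗)            rewrite L-cong w β≗ = f i≤q b
  same β (sum p<q i≤q b β≗)             rewrite L-cong w β≗ = g p<q i≤q b
  same β (difference p<q p<i i≤q b β≗)  rewrite L-cong w β≗ = h p<q p<i i≤q b
  decide : Dec P → All≥ {J = J} {i} w ⊎ None≥ {J = J} {i} w
  decide (yes p) = inj₁ λ β b c → proj₁ (same β (dominating b c)) p
  decide (no ¬p) = inj₂ λ β b c r → ¬p (proj₂ (same β (dominating b c)) r)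

-- From i on, all entries up to q₀ have the sign of x_{q₀}, which settles e_q and, by the sign
-- condition, e_p + e_q. For e_q - e_p with p < i there is a t with p ≤ t < i whose entry has the
-- other sign. If t = p, the signs of x_p and x_q compare them; otherwise x_p + x_t has the sign of
-- x_t and x_t + x_q that of x_q, and eliminating x_t does so.
pivot-B : ∀ {n} {J : Subset n} (w : 𝔅 n) → Good J w → ∀ {q₀} → Below J q₀ → (∀ k → k ∈ J → k Fin.≤ q₀) → Pivot J w
pivot-B {n} {J} w g {q₀} b₀ top with least block? {q₀} (ℕₚ.≤-refl , λ k q≤k k≤q → subst (λ k → Same k) (Finₚ.≤-antisym q≤k k≤q) (id , id))
  where
  Same : Fin n → Set
  Same k = (Negative w q₀ → Negative w k) × (Negative w k → Negative w q₀)
  same? : ∀ k → Dec (Same k)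
  same? k = (negative? w q₀ →-dec negative? w k) ×-dec (negative? w k →-dec negative? w q₀)
  block? : ∀ i → Dec (i Fin.≤ q₀ × (∀ k → i Fin.≤ k → k Fin.≤ q₀ → Same k))
  block? i = (i Finₚ.≤? q₀) ×-dec all? λ k → (i Finₚ.≤? k) →-dec ((k Finₚ.≤? q₀) →-dec same? k)
... | i , (i≤q₀ , block) , smallest = uniform⇒pivot w (b₀ i i≤q₀) (Negative w q₀) (negative? w q₀) singles sums differences
  where
  singles : ∀ {q} → i Fin.≤ q → Below J q → (Negative w q₀ → Negative w q) × (Negative w q → Negative w q₀)
  singles {q} i≤q b = block q i≤q (top q (b q ℕₚ.≤-refl))
  sums : ∀ {p q} → p Fin.< q → i Fin.≤ q → Below J q → (Negative w q₀ → NegativeSum w p q) × (NegativeSum w p q → Negative w q₀)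
  sums p<q i≤q b = proj₁ (Good.sum-sign g p<q b) ∘ proj₁ (singles i≤q b) , proj₂ (singles i≤q b) ∘ proj₂ (Good.sum-sign g p<q b)
  -- By minimality of i, the entries from p to q₀ do not all have the same sign; an entry that
  -- deviates must come before i.
  between : ∀ {p} → p Fin.< i → ∃[ t ] p Fin.≤ t × t Fin.< i × ((Negative w q₀ × ¬ Negative w t) ⊎ (¬ Negative w q₀ × Negative w t))
  between {p} p<i with any? (λ t → (p Finₚ.≤? t) ×-dec ((t Finₚ.≤? q₀) ×-dec ((negative? w q₀ ×-dec ¬? (negative? w t)) ⊎-dec (¬? (negative? w q₀) ×-dec negative? w t))))
  ... | yes (t , p≤t , t≤q₀ , d) = t , p≤t , ℕₚ.≰⇒> (λ i≤t → differ d (block t i≤t t≤q₀)) , d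
    where
    differ : ∀ {A B : Set} → (A × ¬ B) ⊎ (¬ A × B) → (A → B) × (B → A) → ⊥
    differ (inj₁ (a , ¬b)) (f , _) = ¬b (f a)
    differ (inj₂ (¬a , b)) (_ , f) = ¬a (f b)
  ... | no ¬t = contradiction (ℕₚ.≤-trans (ℕₚ.<⇒≤ p<i) i≤q₀ , λ k p≤k k≤q₀ → agree k p≤k k≤q₀) (smallest p p<i)
    where
    agree : ∀ k → p Fin.≤ k → k Fin.≤ q₀ → (Negative w q₀ → Negative w k) × (Negative w k → Negative w q₀)
    agree k p≤k k≤q₀ with negative? w q₀ | negative? w k
    ... | yes a | yes b = (λ _ → b) , λ _ → a
    ... | yes a | no ¬b = contradiction (k , p≤k , k≤q₀ , inj₁ (a , ¬b)) ¬t
    ... | no ¬a | yes b = contradiction (k , p≤k , k≤q₀ , inj₂ (¬a , b)) ¬t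
    ... | no ¬a | no ¬b = (λ a → contradiction a ¬a) , λ b → contradiction b ¬b
  x : Fin n → ℤ
  x = oneLine w
  eliminate : ∀ a t b → 0ℤ < a + t → t + b < 0ℤ → b < a
  eliminate a t b r s = ungap (subst (0ℤ <_) (ring a t b) (ℤₚ.+-mono-< r (-‿pos s)))
    where
    ring : ∀ a t b → a + t + - (t + b) ≡ a - b
    ring = solve-∀
  differences : ∀ {p q} → p Fin.< q → p Fin.< i → i Fin.≤ q → Between J p q → (Negative w q₀ → Inverted w p q) × (Inverted w p q → Negative w q₀)
  differences {p} {q} p<q p<i i≤q b with between {p} p<i
  ... | t , p≤t , t<i , inj₁ (neg , ¬neg) = (λ _ → inverted⁺ w {p} {q} (smaller (ℕₚ.m≤n⇒m<n∨m≡n p≤t))) , λ _ → neg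
    where
    q∈J : q ∈ J
    q∈J = b q p<q ℕₚ.≤-refl
    below : ∀ {k} → k Fin.≤ q → Below J k
    below k≤q j j≤k = b₀ j (ℕₚ.≤-trans (ℕₚ.≤-trans j≤k k≤q) (top q q∈J))
    t<q : t Fin.< q
    t<q = ℕₚ.<-≤-trans t<i i≤q
    negq : Negative w q
    negq = proj₁ (block q i≤q (top q q∈J)) neg
    smaller : p Fin.< t ⊎ toℕ p ≡ toℕ t → x q < x p
    smaller (inj₂ p≡t) = subst (λ p → x q < x p) (sym (Finₚ.toℕ-injective p≡t)) (ℤₚ.<-trans (negative⁻ w {q} negq) (¬negative w {t} ¬neg))
    smaller (inj₁ p<t) = eliminate (x p) (x t) (x q)
      (¬negativeSum w (<⇒≢ p<t) (¬neg ∘ proj₂ (Good.sum-sign g p<t (below {t} (ℕₚ.<⇒≤ t<q)))))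
      (negativeSum⁻ w {t} {q} (proj₁ (Good.sum-sign g t<q (below {q} ℕₚ.≤-refl)) negq))
  ... | t , p≤t , t<i , inj₂ (¬neg , negt) = (λ r → contradiction r ¬neg) , λ r → ⊥-elim (ℤₚ.<-asym (inverted⁻ w {p} {q} r) (smaller (ℕₚ.m≤n⇒m<n∨m≡n p≤t)))
    where
    q∈J : q ∈ J
    q∈J = b q p<q ℕₚ.≤-refl
    below : ∀ {k} → k Fin.≤ q → Below J k
    below k≤q j j≤k = b₀ j (ℕₚ.≤-trans (ℕₚ.≤-trans j≤k k≤q) (top q q∈J))
    t<q : t Fin.< q
    t<q = ℕₚ.<-≤-trans t<i i≤q
    ¬negq : ¬ Negative w q
    ¬negq = ¬neg ∘ proj₂ (block q i≤q (top q q∈J))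
    smaller : p Fin.< t ⊎ toℕ p ≡ toℕ t → x p < x q
    smaller (inj₂ p≡t) = subst (λ p → x p < x q) (sym (Finₚ.toℕ-injective p≡t)) (ℤₚ.<-trans (negative⁻ w {t} negt) (¬negative w {q} ¬negq))
    smaller (inj₁ p<t) = eliminate (x q) (x t) (x p)
      (subst (0ℤ <_) (ℤₚ.+-comm (x t) (x q)) (¬negativeSum w (<⇒≢ t<q) (¬negq ∘ proj₂ (Good.sum-sign g t<q (below {q} ℕₚ.≤-refl)))))
      (subst (_< 0ℤ) (ℤₚ.+-comm (x p) (x t)) (negativeSum⁻ w {p} {t} (proj₁ (Good.sum-sign g p<t (below {t} (ℕₚ.<⇒≤ t<q))) negt)))

-- Pivots in type A

extension : ∀ {n} → Vector ℤ n → ℕ → ℤ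
extension {zero}  f _       = 0ℤ
extension {suc n} f zero    = f zero
extension {suc n} f (suc k) = extension (f ∘ suc) k

extension-toℕ : ∀ {n} (f : Vector ℤ n) i {k} → k ≡ toℕ i → extension f k ≡ f i
extension-toℕ f zero    refl = refl
extension-toℕ f (suc i) refl = extension-toℕ (f ∘ suc) i refl

module _ {n} {J : Subset (suc n)} (w : 𝔅 (suc n)) (g : Good J w) (convex : Convex J) {l : Fin n} {hi : Fin (suc n)}
         (lo∈J : suc l ∈ J) (bottom : ∀ k → k Fin.< suc l → k ∉ J) (hi∈J : hi ∈ J) (top : ∀ k → k ∈ J → k Fin.≤ hi) where
  private
    x : Fin (suc n) → ℤ
    x = oneLine w
    -- The simple roots with indices l + 1, ..., hi compare positions l, ..., hi, one position more
    -- than there are roots; hence the base is l, and the shifted positions run from 0 to N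
    -- inclusive.
    b N : ℕ
    b = toℕ l
    N = toℕ hi ℕ.∸ b
    l<hi : b ℕ.< toℕ hi
    l<hi = top (suc l) lo∈J
    -- The default value 0 of `extension` lies outside the range k ≤ N in which totality and
    -- patterns are tested.
    y : ℕ → ℤ
    y k = extension x (b ℕ.+ k)
    R : ℕ → ℕ → Set
    R p q = y p < y q
    b+k≤hi : ∀ {k} → k ℕ.≤ N → b ℕ.+ k ℕ.≤ toℕ hi
    b+k≤hi k≤N = ℕₚ.≤-trans (ℕₚ.+-monoʳ-≤ b k≤N) (ℕₚ.≤-reflexive (ℕₚ.m+[n∸m]≡n (ℕₚ.<⇒≤ l<hi)))
    index : ∀ k → k ℕ.≤ N → ∃[ i ] toℕ i ≡ b ℕ.+ k
    index k k≤N = fromℕ< k<n , Finₚ.toℕ-fromℕ< k<n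
      where
      k<n : b ℕ.+ k ℕ.< suc n
      k<n = ℕₚ.≤-<-trans (b+k≤hi k≤N) (Finₚ.toℕ<n hi)
    entry : ∀ {k i} → toℕ i ≡ b ℕ.+ k → y k ≡ x i
    entry {i = i} p = extension-toℕ x i (sym p)
    total : ∀ {p q} → p ℕ.< q → q ℕ.≤ N → R p q ⊎ R q p
    total {p} {q} p<q q≤N with ℤₚ.<-cmp (y p) (y q)
    ... | tri< r _ _ = inj₁ r
    ... | tri> _ _ r = inj₂ r
    ... | tri≈ _ r _ with index p (ℕₚ.≤-trans (ℕₚ.<⇒≤ p<q) q≤N) | index q q≤N
    ...   | i , ip | j , jq = contradiction (ℕₚ.+-cancelˡ-≡ b _ _ (trans (sym ip) (trans (cong toℕ (oneLine-injective w (trans (sym (entry {i = i} ip)) (trans r (entry {i = j} jq))))) jq))) (ℕₚ.<⇒≢ p<q)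
    inside : ∀ (i j : Fin (suc n)) {p q} → toℕ i ≡ b ℕ.+ p → toℕ j ≡ b ℕ.+ q → q ℕ.≤ N → Between J i j
    inside i j ip jq q≤N k i<k k≤j = convex lo∈J hi∈J
      (ℕₚ.≤-trans (s≤s (ℕₚ.m≤m+n b _)) (subst (ℕ._< toℕ k) ip i<k)) (ℕₚ.≤-trans k≤j (subst (ℕ._≤ toℕ hi) (sym jq) (b+k≤hi q≤N)))
    strict : ∀ (i j : Fin (suc n)) {p q} → toℕ i ≡ b ℕ.+ p → toℕ j ≡ b ℕ.+ q → p ℕ.< q → i Fin.< j
    strict i j {p} {q} ip jq p<q = subst₂ ℕ._<_ (sym ip) (sym jq) (ℕₚ.+-monoʳ-< b p<q)
    to : ∀ (i j : Fin (suc n)) {p q} → toℕ i ≡ b ℕ.+ p → toℕ j ≡ b ℕ.+ q → R p q → Inverted w j i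
    to i j ip jq r = inverted⁺ w {j} {i} (subst₂ _<_ (entry {i = i} ip) (entry {i = j} jq) r)
    to¬ : ∀ (i j : Fin (suc n)) {p q} → toℕ i ≡ b ℕ.+ p → toℕ j ≡ b ℕ.+ q → R p q → ¬ Inverted w i j
    to¬ i j ip jq r s = ℤₚ.<-asym (inverted⁻ w {i} {j} s) (subst₂ _<_ (entry {i = i} ip) (entry {i = j} jq) r)
    module _ {a c₁ c₂ d} (a<c₁ : a ℕ.< c₁) (c₁<c₂ : c₁ ℕ.< c₂) (c₂<d : c₂ ℕ.< d) (d≤N : d ℕ.≤ N) where
      c₂≤N : c₂ ℕ.≤ N
      c₂≤N = ℕₚ.≤-trans (ℕₚ.<⇒≤ c₂<d) d≤N
      c₁≤N : c₁ ℕ.≤ N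
      c₁≤N = ℕₚ.≤-trans (ℕₚ.<⇒≤ c₁<c₂) c₂≤N
      a≤N : a ℕ.≤ N
      a≤N = ℕₚ.≤-trans (ℕₚ.<⇒≤ a<c₁) c₁≤N
      no-3142 : R c₁ d → R d a → ¬ R a c₂
      no-3142 r s t with index a a≤N | index c₁ c₁≤N | index c₂ c₂≤N | index d d≤N
      ... | i , p | j , q | k , u | m , v = Good.no-3142 g {i} {j} {k} {m} (strict i j p q a<c₁) (strict j k q u c₁<c₂) (strict k m u v c₂<d)
              (inside i m p v d≤N) (to m i v p s) (to¬ j m q v r) (to¬ i k p u t)
      no-2413 : R c₂ a → R a d → ¬ R d c₁
      no-2413 r s t with index a a≤N | index c₁ c₁≤N | index c₂ c₂≤N | index d d≤N
      ... | i , p | j , q | k , u | m , v = Good.no-2413 g {i} {j} {k} {m} (strict i j p q a<c₁) (strict j k q u c₁<c₂) (strict k m u v c₂<d)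
              (inside i m p v d≤N) (to k i u p r) (to¬ i m p v s) (to m j v q t)

    module _ {i₀} (1≤i₀ : 1 ℕ.≤ i₀) (i₀≤N : i₀ ℕ.≤ N) {i : Fin (suc n)} (ii : toℕ i ≡ b ℕ.+ i₀) where
      i∈J : i ∈ J
      i∈J = convex lo∈J hi∈J (subst (suc b ℕ.≤_) (sym ii) (ℕₚ.≤-trans (ℕₚ.≤-reflexive (ℕₚ.+-comm 1 b)) (ℕₚ.+-monoʳ-≤ b 1≤i₀))) (subst (ℕ._≤ toℕ hi) (sym ii) (b+k≤hi i₀≤N))
      no-below : ∀ {q} → ¬ Below J q
      no-below below = bottom zero (s≤s z≤n) (below zero z≤n)
      -- A root reaching below position l would have index l in its support, but J starts at l + 1.
      base≤ : ∀ {p q} → p Fin.< i → i Fin.≤ q → Between J p q → b ℕ.≤ toℕ p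
      base≤ {p} {q} p<i i≤q between = ℕₚ.≮⇒≥ λ p<b → bottom (inject₁ l) (s≤s (ℕₚ.≤-reflexive (Finₚ.toℕ-inject₁ l)))
        (between (inject₁ l) (subst (toℕ p ℕ.<_) (sym (Finₚ.toℕ-inject₁ l)) p<b)
          (subst (ℕ._≤ toℕ q) (sym (Finₚ.toℕ-inject₁ l)) (ℕₚ.≤-trans (ℕₚ.m≤m+n b i₀) (ℕₚ.≤-trans (ℕₚ.≤-reflexive (sym ii)) i≤q))))
      across : (S : ℕ → ℕ → Set) → Cut S i₀ N → ∀ {p q} → p Fin.< i → i Fin.≤ q → Between J p q →
               ∃[ p′ ] ∃[ q′ ] toℕ p ≡ b ℕ.+ p′ × toℕ q ≡ b ℕ.+ q′ × S p′ q′
      across S c {p} {q} p<i i≤q between = toℕ p ℕ.∸ b , toℕ q ℕ.∸ b , pp , qq ,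
        c (ℕₚ.+-cancelˡ-< b _ _ (subst₂ ℕ._<_ pp ii p<i)) (ℕₚ.+-cancelˡ-≤ b _ _ (subst₂ ℕ._≤_ ii qq i≤q))
          (ℕₚ.∸-monoˡ-≤ b (top q (between q (ℕₚ.<-≤-trans p<i i≤q) ℕₚ.≤-refl)))
        where
        pp : toℕ p ≡ b ℕ.+ (toℕ p ℕ.∸ b)
        pp = sym (ℕₚ.m+[n∸m]≡n (base≤ p<i i≤q between))
        qq : toℕ q ≡ b ℕ.+ (toℕ q ℕ.∸ b)
        qq = sym (ℕₚ.m+[n∸m]≡n (ℕₚ.≤-trans (base≤ p<i i≤q between) (ℕₚ.<⇒≤ (ℕₚ.<-≤-trans p<i i≤q))))
      -- The roots above α_i compare positions on the two sides of the cut: a direct cut inverts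
      -- none of them, a skew cut all.
      finish : Cut R i₀ N ⊎ Cut (λ p q → R q p) i₀ N → Pivot J w
      finish (inj₁ c) = i , i∈J , inj₂ λ β φ 1≤c r → none β (dominating φ 1≤c) r
        where
        none : ∀ β → Dominating J i β → ¬ L w β < 0ℤ
        none β (single q _ below _) _ = no-below below
        none β (sum _ _ below _) _    = no-below below
        none β (difference {p} {q} _ p<i i≤q between β≗) r with across R c p<i i≤q between
        ... | p′ , q′ , pp , qq , s = to¬ p q pp qq s (subst (_< 0ℤ) (L-cong w β≗) r)
      finish (inj₂ c) = i , i∈J , inj₁ λ β φ 1≤c → all β (dominating φ 1≤c)
        where
        all : ∀ β → Dominating J i β → L w β < 0ℤ
        all β (single q _ below _) = contradiction below no-below
        all β (sum _ _ below _)    = contradiction below no-below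
        all β (difference {p} {q} _ p<i i≤q between β≗) with across (λ p q → R q p) c p<i i≤q between
        ... | p′ , q′ , pp , qq , s = subst (_< 0ℤ) (sym (L-cong w β≗)) (to q p qq pp s)

    decide : Splits R N → Pivot J w
    decide (i₀ , 1≤i₀ , i₀≤N , cut) = let i , ii = index i₀ i₀≤N in finish 1≤i₀ i₀≤N ii cut

  pivot-A : Pivot J w
  pivot-A = decide (splits {R} (λ p q → y p ℤₚ.<? y q) (λ {p} {q} {r} → ℤₚ.<-trans {y p} {y q} {y r}) (λ {p} {q} → ℤₚ.<-asym {y p} {y q})
    N total no-3142 no-2413 (ℕₚ.m<n⇒0<n∸m l<hi))

-- A convex J is of type B if it contains 0 and of type A otherwise, so its least element decides
-- which argument applies.
pivot : ∀ {n} {J : Subset n} (w : 𝔅 n) → Good J w → Convex J → Nonempty J → Pivot J w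
pivot {J = J} w g convex (m , m∈J) with least (_∈? J) m∈J | greatest (_∈? J) m∈J
... | zero  , 0∈J  , _      | hi , hi∈J , top = pivot-B w g (λ i i≤hi → convex 0∈J hi∈J z≤n i≤hi) top
... | suc l , lo∈J , bottom | hi , hi∈J , top = pivot-A w g convex lo∈J bottom hi∈J top

-- Induction on the number of simple roots

Good-⊆ : ∀ {n} {J C : Subset n} {w} → C ⊆ J → Good J w → Good C w
Good-⊆ C⊆J g = record
  { sum-sign = λ p<q b → Good.sum-sign g p<q λ i i≤q → C⊆J (b i i≤q)
  ; no-2413  = λ a<b b<c c<d bt → Good.no-2413 g a<b b<c c<d λ i a<i i≤d → C⊆J (bt i a<i i≤d)
  ; no-3142  = λ a<b b<c c<d bt → Good.no-3142 g a<b b<c c<d λ i a<i i≤d → C⊆J (bt i a<i i≤d)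
  }

Good⇒separable : ∀ {n} {J : Subset n} {w} → InW J w → Good J w → Separable J w
Good⇒separable W g = go W g (<-wellFounded _)
  where
  go : ∀ {n} {J : Subset n} {w} → InW J w → Good J w → Acc ℕ._<_ (card J) → Separable J w
  restrict : ∀ {n} {J C : Subset n} {w} → InW J w → Good J w → C ⊆ J → Acc ℕ._<_ (card C) → ∃[ v ] Restricts J w C v × Separable C v
  restrict {C = C} {w} W g C⊆J a with restriction C {w} C⊆J W
  ... | v , R , V , same = v , R , go V (Good-transfer w v (λ {β} → same {β}) (Good-⊆ C⊆J g)) a

  go {J = J} {w} W g (acc rec) with Subₚ.nonempty? J
  ... | no empty = trivial empty
  ... | yes (m , m∈J) with any? (Parts.rest? J m)
  ...   | yes (b , b∈) = reducible (C , B , decomposition m∈J (b , ∈-comprehension⁺ rest? b∈)) λ { K (_ , B′ , s) → restrict W g (_≡_⊕_.A⊆J s) (rec (smaller s)) }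
    where
    open Parts J m
    -- The complementary summand is nonempty and disjoint from K, so K is a proper subset.
    smaller : ∀ {K B′} → J ≡ K ⊕ B′ → card K ℕ.< card J
    smaller s with _≡_⊕_.nonemptyB s
    ... | b′ , b′∈ = Subₚ.p⊂q⇒∣p∣<∣q∣ (_≡_⊕_.A⊆J s , b′ , _≡_⊕_.B⊆J s b′∈ , λ b′∈K → ⊕-disjoint s b′∈K b′∈)
  ...   | no ¬rest with full-component⇒convex ¬rest
  ...     | convex with pivot w g convex (m , m∈J)
  ...       | i , i∈J , u = irreducible ((m , m∈J) , convex⇒irreducible convex) i i∈J
              (restrict W g (∖-⊆ J i) (rec (Subₚ.x∈p⇒∣p-x∣<∣p∣ i∈J))) (uniform u)
    where
    uniform : All≥ {J = J} {i} w ⊎ None≥ {J = J} {i} w →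
              (∀ β → Φ⁺ J β → Dominates J β (α i) → Inversion J w β) ⊎ (∀ β → Φ⁺ J β → Dominates J β (α i) → ¬ Inversion J w β)
    uniform (inj₁ all)  = inj₁ λ β b d → inversion-intro {w = w} W b (all β b (dominates-elim d))
    uniform (inj₂ none) = inj₂ λ β b d i → none β b (dominates-elim d) (inversion-elim {w = w} i)

-- Patterns

HasSign : Sign → ℤ → Set
HasSign Sign.+ z = 0ℤ < z
HasSign Sign.- z = z < 0ℤ

opposite-* : ∀ s t → opposite s Sign.* t ≡ opposite (s Sign.* t)
opposite-* Sign.+ Sign.+ = refl
opposite-* Sign.+ Sign.- = refl
opposite-* Sign.- Sign.+ = refl
opposite-* Sign.- Sign.- = refl

-- The vector τ gives the rank of each absolute value and o is its inverse: o lists the positions by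
-- increasing absolute value, so that the order is stated as one chain of inequalities.
module SignedPermutation {m} (ss : Vec Sign m) (τ o : Vec (Fin m) m)
  (oτ : ∀ i → lookup o (lookup τ i) ≡ i) (τo : ∀ i → lookup τ (lookup o i) ≡ i) where

  element : 𝔅 m
  element = record
    { bijection = mk↔ₛ′ (λ (s , i) → s Sign.* lookup ss i , lookup τ i) (λ (s , j) → s Sign.* lookup ss (lookup o j) , lookup o j)
        (λ (s , j) → cong₂ _,_ (cancel s (lookup ss (lookup o j))) (τo j))
        (λ (s , i) → cong₂ _,_ (trans (cong (λ k → s Sign.* lookup ss i Sign.* lookup ss k) (oτ i)) (cancel s (lookup ss i))) (oτ i))
    ; odd = λ (s , i) → cong (_, lookup τ i) (opposite-* s (lookup ss i))
    }
    where
    cancel : ∀ s t → s Sign.* t Sign.* t ≡ s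
    cancel s t = trans (Signₚ.*-assoc s t t) (trans (cong (s Sign.*_) (Signₚ.s*s≡+ t)) (Signₚ.*-identityʳ s))

  word : Vec ℤ m
  word = Vec.tabulate (oneLine element)

  ∣element∣ : ∀ i → ∣ oneLine element i ∣ ≡ suc (toℕ (lookup τ i))
  ∣element∣ i = ℤₚ.abs-◃ (lookup ss i) (suc (toℕ (lookup τ i)))

  element-sign : ∀ i → HasSign (lookup ss i) (oneLine element i)
  element-sign i with lookup ss i
  ... | Sign.+ = +<+ (s≤s z≤n)
  ... | Sign.- = -<+

  module _ {a : Vector ℤ m} (signs : ∀ i → HasSign (lookup ss i) (a i))
           (chain : ∀ {k l} → k Fin.< l → ∣ a (lookup o k) ∣ ℕ.< ∣ a (lookup o l) ∣) where
    private
      sign⇔ : ∀ s {y z} → HasSign s y → HasSign s z → y < 0ℤ ⇔ z < 0ℤ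
      sign⇔ Sign.+ p q = mk⇔ (λ r → ⊥-elim (ℤₚ.<-asym p r)) (λ r → ⊥-elim (ℤₚ.<-asym q r))
      sign⇔ Sign.- p q = mk⇔ (λ _ → q) (λ _ → p)

      chain′ : ∀ {i j} → lookup τ i Fin.< lookup τ j → ∣ a i ∣ ℕ.< ∣ a j ∣
      chain′ {i} {j} p = subst₂ (λ i j → ∣ a i ∣ ℕ.< ∣ a j ∣) (oτ i) (oτ j) (chain p)

    sts-intro : sts a ≐ word
    sts-intro = element , ((λ i → sign⇔ (lookup ss i) (element-sign i) (signs i)) , λ i j i<j → mk⇔ (to i j) (from i j (<⇒≢ i<j))) ,
      λ i → sym (lookup∘tabulate (oneLine element) i)
      where
      to : ∀ i j → ∣ oneLine element i ∣ ℕ.< ∣ oneLine element j ∣ → ∣ a i ∣ ℕ.≤ ∣ a j ∣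
      to i j p = ℕₚ.<⇒≤ (chain′ (ℕₚ.≤-pred (subst₂ ℕ._<_ (∣element∣ i) (∣element∣ j) p)))
      from : ∀ i j → i ≢ j → ∣ a i ∣ ℕ.≤ ∣ a j ∣ → ∣ oneLine element i ∣ ℕ.< ∣ oneLine element j ∣
      from i j i≢j p with Finₚ.<-cmp (lookup τ i) (lookup τ j)
      ... | tri< q _ _ = subst₂ ℕ._<_ (sym (∣element∣ i)) (sym (∣element∣ j)) (s≤s q)
      ... | tri≈ _ q _ = contradiction (trans (sym (oτ i)) (trans (cong (lookup o) q) (oτ j))) i≢j
      ... | tri> _ _ q = contradiction (chain′ q) (ℕₚ.≤⇒≯ p)

  module _ {a : Vector ℤ m} (nonzero : ∀ i → a i ≢ 0ℤ) (distinct : ∀ {i j} → i ≢ j → ∣ a i ∣ ≢ ∣ a j ∣)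
           (a≐ : sts a ≐ word) where
    private
      v : 𝔅 m
      v = proj₁ a≐

      v≡ : ∀ i → oneLine v i ≡ oneLine element i
      v≡ i = trans (proj₂ (proj₂ a≐) i) (lookup∘tabulate (oneLine element) i)

    sts-sign : ∀ i → HasSign (lookup ss i) (a i)
    sts-sign i = go (lookup ss i) (subst (HasSign (lookup ss i)) (sym (v≡ i)) (element-sign i))
      where
      go : ∀ s → HasSign s (oneLine v i) → HasSign s (a i)
      go Sign.- p = Equivalence.to (proj₁ (proj₁ (proj₂ a≐)) i) p
      go Sign.+ p = [ (λ q → ⊥-elim (ℤₚ.<-asym p (Equivalence.from (proj₁ (proj₁ (proj₂ a≐)) i) q))) , id ]′ (≢0⇒sign (nonzero i))

    sts-chain : ∀ {k l} → k Fin.< l → ∣ a (lookup o k) ∣ ℕ.< ∣ a (lookup o l) ∣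
    sts-chain {k} {l} k<l = go (lookup o k) (lookup o l) refl refl
      where
      element< : ∀ i j → i ≡ lookup o k → j ≡ lookup o l → ∣ oneLine v i ∣ ℕ.< ∣ oneLine v j ∣
      element< i j refl refl = subst₂ ℕ._<_ (sym (trans (cong ∣_∣ (v≡ i)) (trans (∣element∣ i) (cong (suc ∘ toℕ) (τo k)))))
        (sym (trans (cong ∣_∣ (v≡ j)) (trans (∣element∣ j) (cong (suc ∘ toℕ) (τo l))))) (s≤s k<l)
      go : ∀ i j → i ≡ lookup o k → j ≡ lookup o l → ∣ a i ∣ ℕ.< ∣ a j ∣
      go i j ik jl with Finₚ.<-cmp i j
      ... | tri< i<j i≢j _ = ℕₚ.≤∧≢⇒< (Equivalence.to (proj₂ (proj₁ (proj₂ a≐)) i j i<j) (element< i j ik jl)) (distinct i≢j)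
      ... | tri≈ _ refl _ = ⊥-elim (ℕₚ.<-irrefl refl (element< i j ik jl))
      -- Standardization compares only in the order of positions; for j before i its equivalence is
      -- read backwards and contraposed.
      ... | tri> _ _ j<i = ℕₚ.≰⇒> λ p → ℕₚ.<-asym (element< i j ik jl) (Equivalence.from (proj₂ (proj₁ (proj₂ a≐)) j i j<i) p)

-- Comparison of absolute values

∣∣-intro : ∀ {a b} → 0ℤ < a → a < b → ∣ a ∣ ℕ.< ∣ b ∣
∣∣-intro p q = ∣∣-mono-< (ℤₚ.<⇒≤ p) q

∣∣-elim : ∀ {a b} → 0ℤ < a → 0ℤ < b → ∣ a ∣ ℕ.< ∣ b ∣ → a < b
∣∣-elim (+<+ _) (+<+ _) p = +<+ p

∣∣-negˡ : ∀ {a k} → ∣ - a ∣ ℕ.< k → ∣ a ∣ ℕ.< k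
∣∣-negˡ {a} {k} = subst (ℕ._< k) (ℤₚ.∣-i∣≡∣i∣ a)

∣∣-negʳ : ∀ {b k} → k ℕ.< ∣ - b ∣ → k ℕ.< ∣ b ∣
∣∣-negʳ {b} {k} = subst (k ℕ.<_) (ℤₚ.∣-i∣≡∣i∣ b)

∣∣-unnegˡ : ∀ {a k} → ∣ a ∣ ℕ.< k → ∣ - a ∣ ℕ.< k
∣∣-unnegˡ {a} {k} = subst (ℕ._< k) (sym (ℤₚ.∣-i∣≡∣i∣ a))

∣∣-unnegʳ : ∀ {b k} → k ℕ.< ∣ b ∣ → k ℕ.< ∣ - b ∣
∣∣-unnegʳ {b} {k} = subst (k ℕ.<_) (sym (ℤₚ.∣-i∣≡∣i∣ b))

sum<0⇒ : ∀ {a b} → a + b < 0ℤ → a < - b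
sum<0⇒ {a} {b} p = ungap (subst (0ℤ <_) (ring a b) (-‿pos p))
  where
  ring : ∀ a b → - (a + b) ≡ - b - a
  ring = solve-∀

sum>0⇒ : ∀ {a b} → 0ℤ < a + b → - a < b
sum>0⇒ {a} {b} p = ungap (subst (0ℤ <_) (ring a b) p)
  where
  ring : ∀ a b → a + b ≡ b - - a
  ring = solve-∀

sum<0⇐ : ∀ {a b} → a < - b → a + b < 0ℤ
sum<0⇐ {a} {b} p = neg-pos (subst (0ℤ <_) (ring a b) (gap p))
  where
  ring : ∀ a b → - b - a ≡ - (a + b)
  ring = solve-∀

sum>0⇐ : ∀ {a b} → - a < b → 0ℤ < a + b
sum>0⇐ {a} {b} p = subst (0ℤ <_) (ring a b) (gap p)
  where
  ring : ∀ a b → b - - a ≡ a + b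
  ring = solve-∀

∣neg∣<∣neg∣ : ∀ {a b} → a < 0ℤ → b < a → ∣ a ∣ ℕ.< ∣ b ∣
∣neg∣<∣neg∣ {a} {b} p q = ∣∣-negˡ {a} (∣∣-negʳ {b} (∣∣-intro (-‿pos p) (ℤₚ.neg-mono-< q)))

∣neg∣<∣neg∣⁻ : ∀ {a b} → a < 0ℤ → b < 0ℤ → ∣ a ∣ ℕ.< ∣ b ∣ → b < a
∣neg∣<∣neg∣⁻ {a} {b} p q r = ℤₚ.neg-cancel-< (∣∣-elim (-‿pos p) (-‿pos q) (∣∣-unnegˡ {a} (∣∣-unnegʳ {b} r)))

∣pos∣<∣neg∣ : ∀ {a b} → 0ℤ < a → a + b < 0ℤ → ∣ a ∣ ℕ.< ∣ b ∣
∣pos∣<∣neg∣ {a} {b} p q = ∣∣-negʳ {b} (∣∣-intro p (sum<0⇒ {a} {b} q))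

∣pos∣<∣neg∣⁻ : ∀ {a b} → 0ℤ < a → b < 0ℤ → ∣ a ∣ ℕ.< ∣ b ∣ → a + b < 0ℤ
∣pos∣<∣neg∣⁻ {a} {b} p q r = sum<0⇐ {a} {b} (∣∣-elim p (-‿pos q) (∣∣-unnegʳ {b} r))

∣neg∣<∣pos∣ : ∀ {a b} → a < 0ℤ → 0ℤ < a + b → ∣ a ∣ ℕ.< ∣ b ∣
∣neg∣<∣pos∣ {a} {b} p q = ∣∣-negˡ {a} (∣∣-intro (-‿pos p) (sum>0⇒ {a} {b} q))

∣neg∣<∣pos∣⁻ : ∀ {a b} → a < 0ℤ → 0ℤ < b → ∣ a ∣ ℕ.< ∣ b ∣ → 0ℤ < a + b
∣neg∣<∣pos∣⁻ {a} {b} p q r = sum>0⇐ {a} {b} (∣∣-elim (-‿pos p) q (∣∣-unnegˡ {a} r))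

-- The signed versions of 2413 that respect the sign condition on the pairs
-- (a,b) and (b,c): 2413, its all-negative version, and 1 3 −4 2, −2 3 −4 1,
-- −1 3 −4 2, −2 3 −4 −1.  Those of 3142 arise by changing all signs.
data Kind : Set where
  all₊ all₋ m₁ m₂ m₃ m₄ : Kind

pattern 0F = zero
pattern 1F = suc zero
pattern 2F = suc (suc zero)
pattern 3F = suc (suc (suc zero))

v4 : ∀ {A : Set} → A → A → A → A → Vec A 4
v4 a b c d = a Vec.∷ b Vec.∷ c Vec.∷ d Vec.∷ Vec.[]

signs : Kind → Vec Sign 4
signs all₊ = v4 Sign.+ Sign.+ Sign.+ Sign.+
signs all₋ = v4 Sign.- Sign.- Sign.- Sign.-
signs m₁  = v4 Sign.+ Sign.+ Sign.- Sign.+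
signs m₂  = v4 Sign.- Sign.+ Sign.- Sign.+
signs m₃  = v4 Sign.- Sign.+ Sign.- Sign.+
signs m₄  = v4 Sign.- Sign.+ Sign.- Sign.-

-- Negative entries reverse absolute values, so the all-negative form of 2413 has absolute values
-- 3142.
ranks order : Kind → Vec (Fin 4) 4
ranks all₊ = v4 1F 3F 0F 2F
ranks all₋ = v4 2F 0F 3F 1F
ranks m₁  = v4 0F 2F 3F 1F
ranks m₂  = v4 1F 2F 3F 0F
ranks m₃  = v4 0F 2F 3F 1F
ranks m₄  = v4 1F 2F 3F 0F

order all₊ = v4 2F 0F 3F 1F
order all₋ = v4 1F 3F 0F 2F
order m₁  = v4 0F 3F 1F 2F
order m₂  = v4 3F 0F 1F 2F
order m₃  = v4 0F 3F 1F 2F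
order m₄  = v4 3F 0F 1F 2F

order-ranks : ∀ k i → lookup (order k) (lookup (ranks k) i) ≡ i
order-ranks all₊ = from-yes (all? λ i → lookup (order all₊) (lookup (ranks all₊) i) ≟ i)
order-ranks all₋ = from-yes (all? λ i → lookup (order all₋) (lookup (ranks all₋) i) ≟ i)
order-ranks m₁  = from-yes (all? λ i → lookup (order m₁) (lookup (ranks m₁) i) ≟ i)
order-ranks m₂  = from-yes (all? λ i → lookup (order m₂) (lookup (ranks m₂) i) ≟ i)
order-ranks m₃  = from-yes (all? λ i → lookup (order m₃) (lookup (ranks m₃) i) ≟ i)
order-ranks m₄  = from-yes (all? λ i → lookup (order m₄) (lookup (ranks m₄) i) ≟ i)

ranks-order : ∀ k i → lookup (ranks k) (lookup (order k) i) ≡ i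
ranks-order all₊ = from-yes (all? λ i → lookup (ranks all₊) (lookup (order all₊) i) ≟ i)
ranks-order all₋ = from-yes (all? λ i → lookup (ranks all₋) (lookup (order all₋) i) ≟ i)
ranks-order m₁  = from-yes (all? λ i → lookup (ranks m₁) (lookup (order m₁) i) ≟ i)
ranks-order m₂  = from-yes (all? λ i → lookup (ranks m₂) (lookup (order m₂) i) ≟ i)
ranks-order m₃  = from-yes (all? λ i → lookup (ranks m₃) (lookup (order m₃) i) ≟ i)
ranks-order m₄  = from-yes (all? λ i → lookup (ranks m₄) (lookup (order m₄) i) ≟ i)

-- The sign f multiplies the whole word: + gives the signed forms of 2413, - those of 3142.
module Word4 (f : Sign) (k : Kind) =
  SignedPermutation (Vec.map (f Sign.*_) (signs k)) (ranks k) (order k) (order-ranks k) (ranks-order k)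

record Fits (f : Sign) (k : Kind) (a : Vector ℤ 4) : Set where
  constructor fits
  field
    sign  : ∀ i → HasSign (f Sign.* lookup (signs k) i) (a i)
    chain : ∀ {i j} → i Fin.< j → ∣ a (lookup (order k) i) ∣ ℕ.< ∣ a (lookup (order k) j) ∣

Fits-cong : ∀ {f k} {a b : Vector ℤ 4} → a ≗ b → Fits f k a → Fits f k b
Fits-cong {f} {k} p (fits s c) = fits (λ i → subst (HasSign (f Sign.* lookup (signs k) i)) (p i) (s i))
  λ i<j → subst₂ (λ y z → ∣ y ∣ ℕ.< ∣ z ∣) (p _) (p _) (c i<j)

Fits⇒sts : ∀ {f k} {a : Vector ℤ 4} → Fits f k a → sts a ≐ Word4.word f k
Fits⇒sts {f} {k} {a} (fits s c) = Word4.sts-intro f k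
  (λ i → subst (λ t → HasSign t (a i)) (sym (lookup-map i (f Sign.*_) (signs k))) (s i)) c

sts⇒Fits : ∀ {f k} {a : Vector ℤ 4} → (∀ i → a i ≢ 0ℤ) → (∀ {i j} → i ≢ j → ∣ a i ∣ ≢ ∣ a j ∣) → sts a ≐ Word4.word f k → Fits f k a
sts⇒Fits {f} {k} {a} nonzero distinct p = fits
  (λ i → subst (λ t → HasSign t (a i)) (lookup-map i (f Sign.*_) (signs k)) (Word4.sts-sign f k nonzero distinct p i))
  (Word4.sts-chain f k nonzero distinct p)

HasSign-neg : ∀ s {z} → HasSign s (- z) → HasSign (opposite s) z
HasSign-neg Sign.+ p = neg-pos p
HasSign-neg Sign.- {z} p = subst (0ℤ <_) (ℤₚ.neg-involutive z) (-‿pos p)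

HasSign-neg⁻ : ∀ s {z} → HasSign (opposite s) z → HasSign s (- z)
HasSign-neg⁻ Sign.+ p = -‿pos p
HasSign-neg⁻ Sign.- p = -‿neg p

Fits-neg : ∀ {k} {a : Vector ℤ 4} → Fits Sign.+ k (λ i → - a i) → Fits Sign.- k a
Fits-neg {k} {a} (fits s c) = fits (λ i → HasSign-neg (lookup (signs k) i) (s i))
  λ i<j → subst₂ ℕ._<_ (ℤₚ.∣-i∣≡∣i∣ (a _)) (ℤₚ.∣-i∣≡∣i∣ (a _)) (c i<j)

Fits-neg⁻ : ∀ {k} {a : Vector ℤ 4} → Fits Sign.- k a → Fits Sign.+ k (λ i → - a i)
Fits-neg⁻ {k} {a} (fits s c) = fits (λ i → HasSign-neg⁻ (lookup (signs k) i) (s i))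
  λ i<j → subst₂ ℕ._<_ (sym (ℤₚ.∣-i∣≡∣i∣ (a _))) (sym (ℤₚ.∣-i∣≡∣i∣ (a _))) (c i<j)

increasing : (f : Fin 4 → ℕ) → f 0F ℕ.< f 1F → f 1F ℕ.< f 2F → f 2F ℕ.< f 3F → ∀ {i j} → i Fin.< j → f i ℕ.< f j
increasing f p q r {0F} {1F} _ = p
increasing f p q r {0F} {2F} _ = ℕₚ.<-trans p q
increasing f p q r {0F} {3F} _ = ℕₚ.<-trans p (ℕₚ.<-trans q r)
increasing f p q r {1F} {2F} _ = q
increasing f p q r {1F} {3F} _ = ℕₚ.<-trans q r
increasing f p q r {2F} {3F} _ = r
increasing f p q r {1F} {1F} (s≤s ())
increasing f p q r {2F} {1F} (s≤s ())
increasing f p q r {2F} {2F} (s≤s (s≤s ()))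
increasing f p q r {3F} {1F} (s≤s ())
increasing f p q r {3F} {2F} (s≤s (s≤s ()))
increasing f p q r {3F} {3F} (s≤s (s≤s (s≤s ())))

quadruple : ℤ → ℤ → ℤ → ℤ → Vector ℤ 4
quadruple a b c d = lookup (v4 a b c d)

mkFits : ∀ k {a} → (let s = lookup (signs k); o = lookup (order k)) →
         HasSign (s 0F) (a 0F) → HasSign (s 1F) (a 1F) → HasSign (s 2F) (a 2F) → HasSign (s 3F) (a 3F) →
         ∣ a (o 0F) ∣ ℕ.< ∣ a (o 1F) ∣ → ∣ a (o 1F) ∣ ℕ.< ∣ a (o 2F) ∣ → ∣ a (o 2F) ∣ ℕ.< ∣ a (o 3F) ∣ → Fits Sign.+ k a
mkFits k {a} s₀ s₁ s₂ s₃ p q r = fits (λ { 0F → s₀ ; 1F → s₁ ; 2F → s₂ ; 3F → s₃ }) (increasing (λ i → ∣ a (lookup (order k) i) ∣) p q r)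

-- For nonzero entries of distinct absolute values, this fails exactly at the patterns -2 1 and 2
-- -1.
Balanced : ℤ → ℤ → Set
Balanced a b = (b < 0ℤ → a + b < 0ℤ) × (0ℤ < b → 0ℤ < a + b)

Balanced-neg : ∀ {a b} → Balanced a b → Balanced (- a) (- b)
Balanced-neg {a} {b} (f , g) =
  (λ p → subst (_< 0ℤ) (ℤₚ.neg-distrib-+ a b) (-‿neg (g (subst (0ℤ <_) (ℤₚ.neg-involutive b) (-‿pos p))))) ,
  (λ p → subst (0ℤ <_) (ℤₚ.neg-distrib-+ a b) (-‿pos (f (neg-pos p))))

-- The least entry is c and the greatest is b. If c > 0 or b < 0, all signs agree. Otherwise balance
-- gives |b| < |c|, and |a| < |b| when a < 0; the signs of a and d then fix the order of absolute
-- values, except that for a < 0 < d the sign of a + d must decide between |a| and |d|.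
2413⇒Fits : ∀ {a b c d} → a ≢ 0ℤ → b ≢ 0ℤ → c ≢ 0ℤ → d ≢ 0ℤ → a + d ≢ 0ℤ → Balanced a b → Balanced b c →
            c < a → a < d → d < b → ∃[ k ] Fits Sign.+ k (quadruple a b c d)
2413⇒Fits {a} {b} {c} {d} a≢0 b≢0 c≢0 d≢0 a+d≢0 ab bc c<a a<d d<b with ≢0⇒sign c≢0 | ≢0⇒sign b≢0 | ≢0⇒sign a≢0
... | inj₂ c>0 | _ | _ = all₊ , mkFits all₊ a>0 (ℤₚ.<-trans d>0 d<b) c>0 d>0 (∣∣-intro c>0 c<a) (∣∣-intro a>0 a<d) (∣∣-intro d>0 d<b)
  where
  a>0 : 0ℤ < a
  a>0 = ℤₚ.<-trans c>0 c<a
  d>0 : 0ℤ < d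
  d>0 = ℤₚ.<-trans a>0 a<d
... | inj₁ c<0 | inj₁ b<0 | _ = all₋ , mkFits all₋ a<0 b<0 c<0 d<0 (∣neg∣<∣neg∣ b<0 d<b) (∣neg∣<∣neg∣ d<0 a<d) (∣neg∣<∣neg∣ a<0 c<a)
  where
  d<0 : d < 0ℤ
  d<0 = ℤₚ.<-trans d<b b<0
  a<0 : a < 0ℤ
  a<0 = ℤₚ.<-trans a<d d<0
... | inj₁ c<0 | inj₂ b>0 | inj₂ a>0 = m₁ , mkFits m₁ a>0 b>0 c<0 d>0 (∣∣-intro a>0 a<d) (∣∣-intro d>0 d<b) (∣pos∣<∣neg∣ b>0 (proj₁ bc c<0))
  where
  d>0 : 0ℤ < d
  d>0 = ℤₚ.<-trans a>0 a<d
... | inj₁ c<0 | inj₂ b>0 | inj₁ a<0 with ≢0⇒sign d≢0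
...   | inj₁ d<0 = m₄ , mkFits m₄ a<0 b>0 c<0 d<0 (∣neg∣<∣neg∣ d<0 a<d) (∣neg∣<∣pos∣ {a} {b} a<0 (proj₂ ab b>0)) (∣pos∣<∣neg∣ b>0 (proj₁ bc c<0))
...   | inj₂ d>0 with ≢0⇒sign a+d≢0
...     | inj₁ a+d<0 = m₂ , mkFits m₂ a<0 b>0 c<0 d>0 (∣pos∣<∣neg∣ d>0 (subst (_< 0ℤ) (ℤₚ.+-comm a d) a+d<0)) (∣neg∣<∣pos∣ {a} {b} a<0 (proj₂ ab b>0)) (∣pos∣<∣neg∣ b>0 (proj₁ bc c<0))
...     | inj₂ a+d>0 = m₃ , mkFits m₃ a<0 b>0 c<0 d>0 (∣neg∣<∣pos∣ {a} {d} a<0 a+d>0) (∣∣-intro d>0 d<b) (∣pos∣<∣neg∣ b>0 (proj₁ bc c<0))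

Fits⇒2413 : ∀ k {a} → Fits Sign.+ k a → a 2F < a 0F × a 0F < a 3F × a 3F < a 1F
Fits⇒2413 k {a} (fits s c) = go k (s 0F) (s 1F) (s 2F) (s 3F)
  (c {0F} {1F} (s≤s z≤n)) (c {1F} {2F} (s≤s (s≤s z≤n))) (c {2F} {3F} (s≤s (s≤s (s≤s z≤n))))
  where
  go : ∀ k → (let s = lookup (signs k); o = lookup (order k)) →
       HasSign (s 0F) (a 0F) → HasSign (s 1F) (a 1F) → HasSign (s 2F) (a 2F) → HasSign (s 3F) (a 3F) →
       ∣ a (o 0F) ∣ ℕ.< ∣ a (o 1F) ∣ → ∣ a (o 1F) ∣ ℕ.< ∣ a (o 2F) ∣ → ∣ a (o 2F) ∣ ℕ.< ∣ a (o 3F) ∣ →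
       a 2F < a 0F × a 0F < a 3F × a 3F < a 1F
  go all₊ s₀ s₁ s₂ s₃ p q r = ∣∣-elim s₂ s₀ p , ∣∣-elim s₀ s₃ q , ∣∣-elim s₃ s₁ r
  go all₋ s₀ s₁ s₂ s₃ p q r = ∣neg∣<∣neg∣⁻ s₀ s₂ r , ∣neg∣<∣neg∣⁻ s₃ s₀ q , ∣neg∣<∣neg∣⁻ s₁ s₃ p
  go m₁ s₀ s₁ s₂ s₃ p q r = ℤₚ.<-trans s₂ s₀ , ∣∣-elim s₀ s₃ p , ∣∣-elim s₃ s₁ q
  go m₂ s₀ s₁ s₂ s₃ p q r = ∣neg∣<∣neg∣⁻ s₀ s₂ (ℕₚ.<-trans q r) , ℤₚ.<-trans s₀ s₃ , ∣∣-elim s₃ s₁ (ℕₚ.<-trans p q)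
  go m₃ s₀ s₁ s₂ s₃ p q r = ∣neg∣<∣neg∣⁻ s₀ s₂ (ℕₚ.<-trans p (ℕₚ.<-trans q r)) , ℤₚ.<-trans s₀ s₃ , ∣∣-elim s₃ s₁ q
  go m₄ s₀ s₁ s₂ s₃ p q r = ∣neg∣<∣neg∣⁻ s₀ s₂ (ℕₚ.<-trans q r) , ∣neg∣<∣neg∣⁻ s₃ s₀ p , ℤₚ.<-trans s₃ s₁

data Uniform : Kind → Set where
  all₊ : Uniform all₊
  all₋ : Uniform all₋

-- Every mixed kind has an unbalanced pair at its end: (c,d) if d > 0, and (b,d) if d < 0. Hence
-- mixed kinds can occur only with d as the last position of w.
balanced⇒uniform : ∀ {k a} → Fits Sign.+ k a → Balanced (a 1F) (a 3F) → Balanced (a 2F) (a 3F) → Uniform k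
balanced⇒uniform {k} {a} (fits s c) bd cd = go k (s 0F) (s 1F) (s 2F) (s 3F)
  (c {0F} {1F} (s≤s z≤n)) (c {1F} {2F} (s≤s (s≤s z≤n))) (c {2F} {3F} (s≤s (s≤s (s≤s z≤n))))
  where
  positive : 0ℤ < a 3F → a 2F < 0ℤ → ∣ a 3F ∣ ℕ.< ∣ a 2F ∣ → ⊥
  positive p q r = ℤₚ.<-asym (proj₂ cd p) (subst (_< 0ℤ) (ℤₚ.+-comm (a 3F) (a 2F)) (∣pos∣<∣neg∣⁻ p q r))
  go : ∀ k → (let s = lookup (signs k); o = lookup (order k)) →
       HasSign (s 0F) (a 0F) → HasSign (s 1F) (a 1F) → HasSign (s 2F) (a 2F) → HasSign (s 3F) (a 3F) →
       ∣ a (o 0F) ∣ ℕ.< ∣ a (o 1F) ∣ → ∣ a (o 1F) ∣ ℕ.< ∣ a (o 2F) ∣ → ∣ a (o 2F) ∣ ℕ.< ∣ a (o 3F) ∣ → Uniform k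
  go all₊ _ _ _ _ _ _ _ = all₊
  go all₋ _ _ _ _ _ _ _ = all₋
  go m₁ s₀ s₁ s₂ s₃ p q r = ⊥-elim (positive s₃ s₂ (ℕₚ.<-trans q r))
  go m₂ s₀ s₁ s₂ s₃ p q r = ⊥-elim (positive s₃ s₂ (ℕₚ.<-trans p (ℕₚ.<-trans q r)))
  go m₃ s₀ s₁ s₂ s₃ p q r = ⊥-elim (positive s₃ s₂ (ℕₚ.<-trans q r))
  go m₄ s₀ s₁ s₂ s₃ p q r = ⊥-elim (ℤₚ.<-asym (proj₁ bd s₃) (subst (0ℤ <_) (ℤₚ.+-comm (a 3F) (a 1F)) (∣neg∣<∣pos∣⁻ s₃ s₁ (ℕₚ.<-trans p q))))

-- The patterns of an unbalanced pair

module Word2 (f : Sign) =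
  SignedPermutation (Sign.- Sign.* f Vec.∷ f Vec.∷ Vec.[]) (1F Vec.∷ 0F Vec.∷ Vec.[]) (1F Vec.∷ 0F Vec.∷ Vec.[])
    (from-yes (all? {2} λ i → lookup (1F Vec.∷ 0F Vec.∷ Vec.[]) (lookup (1F Vec.∷ 0F Vec.∷ Vec.[]) i) ≟ i))
    (from-yes (all? {2} λ i → lookup (1F Vec.∷ 0F Vec.∷ Vec.[]) (lookup (1F Vec.∷ 0F Vec.∷ Vec.[]) i) ≟ i))

module _ {a : Vector ℤ 2} where
  private
    chain : ∣ a 1F ∣ ℕ.< ∣ a 0F ∣ → ∀ {k l : Fin 2} → k Fin.< l →
            ∣ a (lookup (1F Vec.∷ 0F Vec.∷ Vec.[]) k) ∣ ℕ.< ∣ a (lookup (1F Vec.∷ 0F Vec.∷ Vec.[]) l) ∣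
    chain p {0F} {1F} _ = p
    chain p {1F} {1F} (s≤s ())

  pair⁺-intro : 0ℤ < a 1F → a 0F + a 1F < 0ℤ → sts a ≐ p2 (- + 2) (+ 1)
  pair⁺-intro p q = Word2.sts-intro Sign.+ (λ { 0F → a₀<0 ; 1F → p })
    (chain (∣pos∣<∣neg∣ p (subst (_< 0ℤ) (ℤₚ.+-comm (a 0F) (a 1F)) q)))
    where
    a₀<0 : a 0F < 0ℤ
    a₀<0 = ℤₚ.<-trans (sum<0⇒ {a 0F} {a 1F} q) (-‿neg p)

  pair⁻-intro : a 1F < 0ℤ → 0ℤ < a 0F + a 1F → sts a ≐ p2 (+ 2) (- + 1)
  pair⁻-intro p q = Word2.sts-intro Sign.- (λ { 0F → a₀>0 ; 1F → p })
    (chain (∣neg∣<∣pos∣ {a 1F} {a 0F} p (subst (0ℤ <_) (ℤₚ.+-comm (a 0F) (a 1F)) q)))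
    where
    a₀>0 : 0ℤ < a 0F
    a₀>0 = ℤₚ.<-trans (-‿pos p) (sum>0⇒ {a 1F} {a 0F} (subst (0ℤ <_) (ℤₚ.+-comm (a 0F) (a 1F)) q))

  module _ (nonzero : ∀ i → a i ≢ 0ℤ) (distinct : ∀ {i j} → i ≢ j → ∣ a i ∣ ≢ ∣ a j ∣) where
    pair⁺-elim : sts a ≐ p2 (- + 2) (+ 1) → ¬ Balanced (a 0F) (a 1F)
    pair⁺-elim s (_ , f) = ℤₚ.<-asym (f p) (subst (_< 0ℤ) (ℤₚ.+-comm (a 1F) (a 0F))
      (∣pos∣<∣neg∣⁻ p (Word2.sts-sign Sign.+ nonzero distinct s 0F) (Word2.sts-chain Sign.+ nonzero distinct s {0F} {1F} (s≤s z≤n))))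
      where
      p : 0ℤ < a 1F
      p = Word2.sts-sign Sign.+ nonzero distinct s 1F

    pair⁻-elim : sts a ≐ p2 (+ 2) (- + 1) → ¬ Balanced (a 0F) (a 1F)
    pair⁻-elim s (f , _) = ℤₚ.<-asym (f p) (subst (0ℤ <_) (ℤₚ.+-comm (a 1F) (a 0F))
      (∣neg∣<∣pos∣⁻ p (Word2.sts-sign Sign.- nonzero distinct s 0F) (Word2.sts-chain Sign.- nonzero distinct s {0F} {1F} (s≤s z≤n))))
      where
      p : a 1F < 0ℤ
      p = Word2.sts-sign Sign.- nonzero distinct s 1F

balanced? : ∀ a b → Dec (Balanced a b)
balanced? a b = ((b ℤₚ.<? 0ℤ) →-dec ((a + b) ℤₚ.<? 0ℤ)) ×-dec ((0ℤ ℤₚ.<? b) →-dec (0ℤ ℤₚ.<? (a + b)))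

-- Minimal non-separability in terms of entries

module _ {m} (w : 𝔅 (suc m)) where
  private
    x : Fin (suc m) → ℤ
    x = oneLine w

    top : Fin (suc m)
    top = fromℕ m

  ∣oneLine∣-injective : ∀ {p q} → p ≢ q → ∣ x p ∣ ≢ ∣ x q ∣
  ∣oneLine∣-injective {p} {q} p≢q r = p≢q (index-injective w (Sign.+ , p) (Sign.+ , q)
    (Finₚ.toℕ-injective (ℕₚ.suc-injective (trans (sym (abs p)) (trans r (abs q))))))
    where
    abs : ∀ i → ∣ x i ∣ ≡ suc (toℕ (proj₂ (w ⟨ Sign.+ , i ⟩)))
    abs i = ℤₚ.abs-◃ (proj₁ (w ⟨ Sign.+ , i ⟩)) _

  BalancedInit Free : Set
  BalancedInit = ∀ {p q : Fin m} → p Fin.< q → Balanced (x (inject₁ p)) (x (inject₁ q))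
  Free = ∀ {a b c d} → a Fin.< b → b Fin.< c → c Fin.< d →
         ¬ (x c < x a × x a < x d × x d < x b) × ¬ (x b < x d × x d < x a × x a < x c)

  inject₁-mono-< : ∀ {p q : Fin m} → p Fin.< q → inject₁ p Fin.< inject₁ q
  inject₁-mono-< {p} {q} = subst₂ ℕ._<_ (sym (Finₚ.toℕ-inject₁ p)) (sym (Finₚ.toℕ-inject₁ q))

  inject₁-cancel-< : ∀ {p q : Fin m} → inject₁ p Fin.< inject₁ q → p Fin.< q
  inject₁-cancel-< {p} {q} = subst₂ ℕ._<_ (Finₚ.toℕ-inject₁ p) (Finₚ.toℕ-inject₁ q)

  inject₁<top : ∀ (p : Fin m) → inject₁ p Fin.< top
  inject₁<top p = subst₂ ℕ._<_ (sym (Finₚ.toℕ-inject₁ p)) (sym (Finₚ.toℕ-fromℕ m)) (Finₚ.toℕ<n p)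

  lower : ∀ {p q : Fin (suc m)} → p Fin.< q → ∃[ p′ ] p ≡ inject₁ p′
  lower {p} {q} p<q with view p
  ... | ‵inject₁ p′ = p′ , refl
  ... | ‵fromℕ = contradiction (Finₚ.≤fromℕ q) (ℕₚ.<⇒≱ p<q)

  ¬inverted : ∀ {p q} → p ≢ q → ¬ Inverted w p q → x p < x q
  ¬inverted {p} {q} p≢q ¬inv with ℤₚ.<-cmp (x p) (x q)
  ... | tri< r _ _ = r
  ... | tri≈ _ r _ = contradiction (oneLine-injective w r) p≢q
  ... | tri> _ _ r = contradiction (inverted⁺ w {p} {q} r) ¬inv

  Good-intro : ∀ {J} → (∀ {p q} → p Fin.< q → Below J q → Balanced (x p) (x q)) → Free → Good J w
  Good-intro balanced free = record
    { sum-sign = λ {p} {q} p<q b →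
        (λ r → negativeSum⁺ w {p} {q} (proj₁ (balanced p<q b) (negative⁻ w {q} r))) ,
        (λ r → [ negative⁺ w {q} , (λ s → ⊥-elim (ℤₚ.<-asym (proj₂ (balanced p<q b) s) (negativeSum⁻ w {p} {q} r))) ]′ (≢0⇒sign (oneLine-nonzero w q)))
    ; no-2413 = λ {a} {b} {c} {d} a<b b<c c<d _ ac ¬ad bd → proj₁ (free a<b b<c c<d)
        (inverted⁻ w {a} {c} ac , ¬inverted (<⇒≢ (ℕₚ.<-trans a<b (ℕₚ.<-trans b<c c<d))) ¬ad , inverted⁻ w {b} {d} bd)
    ; no-3142 = λ {a} {b} {c} {d} a<b b<c c<d _ ad ¬bd ¬ac → proj₂ (free a<b b<c c<d)
        (¬inverted (<⇒≢ (ℕₚ.<-trans b<c c<d)) ¬bd , inverted⁻ w {a} {d} ad , ¬inverted (<⇒≢ (ℕₚ.<-trans a<b b<c)) ¬ac)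
    }

  Good⇒Balanced : ∀ {J p q} → Good J w → p Fin.< q → Below J q → Balanced (x p) (x q)
  Good⇒Balanced {J} {p} {q} g p<q b =
    (λ r → negativeSum⁻ w {p} {q} (proj₁ (Good.sum-sign g p<q b) (negative⁺ w {q} r))) ,
    (λ r → ¬negativeSum w (<⇒≢ p<q) λ s → ℤₚ.<-asym r (negative⁻ w {q} (proj₂ (Good.sum-sign g p<q b) s)))

  -- Removing only α₀ leaves every difference e_q - e_p, so a single proper J controls all
  -- quadruples.
  Good⇒Free : (∀ {J} → J ⊂ ⊤ → Good J w) → Free
  Good⇒Free good {a} {b} {c} {d} a<b b<c c<d =
    (λ (c<a , a<d , d<b) → Good.no-2413 g a<b b<c c<d between (inverted⁺ w {a} {c} c<a) (not {a} {d} a<d) (inverted⁺ w {b} {d} d<b)) ,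
    (λ (b<d , d<a , a<c) → Good.no-3142 g a<b b<c c<d between (inverted⁺ w {a} {d} d<a) (not {b} {d} b<d) (not {a} {c} a<c))
    where
    g : Good (⊤ ∖ zero) w
    g = good (Subₚ.x∈p⇒p-x⊂p {x = zero} {⊤} Subₚ.∈⊤)
    between : Between (⊤ ∖ zero) a d
    between i a<i _ = Subₚ.x∈p∧x≢y⇒x∈p-y {x = i} {⊤} {zero} Subₚ.∈⊤ λ { refl → contradiction a<i λ () }
    not : ∀ {p q} → x p < x q → ¬ Inverted w p q
    not {p} {q} r s = ℤₚ.<-asym r (inverted⁻ w {p} {q} s)

  Good⇒BalancedInit : (∀ {J} → J ⊂ ⊤ → Good J w) → BalancedInit
  Good⇒BalancedInit good {p} {q} p<q = Good⇒Balanced (good (Subₚ.x∈p⇒p-x⊂p {x = top} {⊤} Subₚ.∈⊤)) (inject₁-mono-< p<q)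
    λ i i≤q → Subₚ.x∈p∧x≢y⇒x∈p-y {x = i} {⊤} {top} Subₚ.∈⊤ λ { refl → ℕₚ.<⇒≱ (inject₁<top q) i≤q }

  below-top : ∀ {J} → Below J top → ∀ i → i ∈ J
  below-top b i = b i (Finₚ.≤fromℕ i)

  -- The root e_q with q the last position has full support, so a proper J imposes no sign condition
  -- on pairs ending there.
  BalancedInit⇒Good : BalancedInit → Free → ∀ {J} → J ⊂ ⊤ → Good J w
  BalancedInit⇒Good balanced free {J} (_ , i , _ , i∉J) = Good-intro go free
    where
    go : ∀ {p q} → p Fin.< q → Below J q → Balanced (x p) (x q)
    go {p} {q} p<q b with lower p<q | view q
    ... | p′ , refl | ‵inject₁ q′ = balanced (inject₁-cancel-< p<q)
    ... | _ | ‵fromℕ = contradiction (below-top b i) i∉J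

  -- Passing from all proper J to the full set adds exactly the balance of the pairs ending at the
  -- last position; since this is decidable and finite, its failure yields a witness i.
  minimal⇔ : MinimalNonSeparable w ⇔ (BalancedInit × Free × ∃[ i ] ¬ Balanced (x (inject₁ i)) (x top))
  minimal⇔ = mk⇔ to from
    where
    to : MinimalNonSeparable w → BalancedInit × Free × ∃[ i ] ¬ Balanced (x (inject₁ i)) (x top)
    to (¬sep , parabolic) = balanced , free , unbalanced (any? λ i → ¬? (balanced? (x (inject₁ i)) (x top)))
      where
      good : ∀ {J} → J ⊂ ⊤ → Good J w
      good {J} J⊂⊤ with parabolic J J⊂⊤
      ... | u , v , F , s = Good-transfer v w (SameSign-sym w v λ {β} → factorization⇒SameSign {w = w} {u} {v} product inW (factorization⇒positive F) {β})
              (separable⇒Good inW s)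
        where open ParabolicFactorization F
      balanced : BalancedInit
      balanced = Good⇒BalancedInit good
      free : Free
      free = Good⇒Free good
      unbalanced : Dec (∃[ i ] ¬ Balanced (x (inject₁ i)) (x top)) → ∃[ i ] ¬ Balanced (x (inject₁ i)) (x top)
      unbalanced (yes p) = p
      unbalanced (no ¬p) = contradiction (Good⇒separable (InW-⊤ w) (Good-intro go free)) ¬sep
        where
        go : ∀ {p q} → p Fin.< q → Below ⊤ q → Balanced (x p) (x q)
        go {p} {q} p<q b with lower p<q | view q
        ... | p′ , refl | ‵inject₁ q′ = balanced (inject₁-cancel-< p<q)
        ... | p′ , refl | ‵fromℕ with balanced? (x (inject₁ p′)) (x top)
        ...   | yes r = r
        ...   | no ¬r = contradiction (p′ , ¬r) ¬p
    from : BalancedInit × Free × (∃[ i ] ¬ Balanced (x (inject₁ i)) (x top)) → MinimalNonSeparable w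
    from (balanced , free , i , ¬b) = (λ s → ¬b (Good⇒Balanced (separable⇒Good (InW-⊤ w) s) (inject₁<top i) λ _ _ → Subₚ.∈⊤)) , parabolic
      where
      parabolic : ∀ J → J ⊂ ⊤ → ∃[ u ] ∃[ v ] ParabolicFactorization J w u v × Separable J v
      parabolic J J⊂⊤ with factorize J w
      ... | u , v , w≡uv , V , pos′ = u , v , factorization J w≡uv V pos′ ,
              Good⇒separable V (Good-transfer w v (λ {β} → factorization⇒SameSign {w = w} {u} {v} w≡uv V pos′ {β}) (BalancedInit⇒Good balanced free J⊂⊤))

-- Translation into conditions (a) and (b)

module _ {m} (w : 𝔅 (suc m)) where
  private
    x : Fin (suc m) → ℤ
    x = oneLine w

    top : Fin (suc m)
    top = fromℕ m

    increasing⇒distinct : ∀ {r s} {f : Fin r → Fin s} → (∀ i j → i Fin.< j → f i Fin.< f j) → ∀ {i j} → i ≢ j → f i ≢ f j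
    increasing⇒distinct mono {i} {j} i≢j with Finₚ.<-cmp i j
    ... | tri< i<j _ _ = <⇒≢ (mono i j i<j)
    ... | tri≈ _ i≡j _ = contradiction i≡j i≢j
    ... | tri> _ _ j<i = <⇒≢ (mono j i j<i) ∘ sym

    nonzero : ∀ {r} (f : Fin r → Fin (suc m)) i → x (f i) ≢ 0ℤ
    nonzero f i = oneLine-nonzero w (f i)

    distinct : ∀ {r} {f : Fin r → Fin (suc m)} → (∀ i j → i Fin.< j → f i Fin.< f j) → ∀ {i j} → i ≢ j → ∣ x (f i) ∣ ≢ ∣ x (f j) ∣
    distinct mono i≢j = ∣oneLine∣-injective w (increasing⇒distinct mono i≢j)

    sum-nonzero : ∀ {p q} → p Fin.< q → x p + x q ≢ 0ℤ
    sum-nonzero p<q = oneLine-sum-nonzero w (<⇒≢ p<q)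

    two : ∀ {s} {p q : Fin s} → p Fin.< q → ∀ i j → i Fin.< j → lookup (p Vec.∷ q Vec.∷ Vec.[]) i Fin.< lookup (p Vec.∷ q Vec.∷ Vec.[]) j
    two p<q 0F 1F _ = p<q
    two p<q 1F 1F (s≤s ())

    four : ∀ {s} {a b c d : Fin s} → a Fin.< b → b Fin.< c → c Fin.< d → ∀ i j → i Fin.< j → lookup (v4 a b c d) i Fin.< lookup (v4 a b c d) j
    four {a = a} {b} {c} {d} p q r i j = increasing (λ i → toℕ (lookup (v4 a b c d) i)) p q r

  Avoids⇒BalancedInit : Avoids (init x) (p2 (- + 2) (+ 1)) → Avoids (init x) (p2 (+ 2) (- + 1)) → BalancedInit w
  Avoids⇒BalancedInit avoids⁺ avoids⁻ {p} {q} p<q = (λ r → [ id , (λ s → contradiction (pq , two p<q , pair⁻-intro r s) avoids⁻) ]′ sign) ,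
    (λ r → [ (λ s → contradiction (pq , two p<q , pair⁺-intro r s) avoids⁺) , id ]′ sign)
    where
    pq : Fin 2 → Fin m
    pq = lookup (p Vec.∷ q Vec.∷ Vec.[])
    sign : x (inject₁ p) + x (inject₁ q) < 0ℤ ⊎ 0ℤ < x (inject₁ p) + x (inject₁ q)
    sign = ≢0⇒sign (sum-nonzero (inject₁-mono-< w p<q))

  BalancedInit⇒Avoids : BalancedInit w → Avoids (init x) (p2 (- + 2) (+ 1)) × Avoids (init x) (p2 (+ 2) (- + 1))
  BalancedInit⇒Avoids balanced =
    (λ (f , mono , s) → pair⁺-elim (nonzero (inject₁ ∘ f)) (distinct (λ i j → inject₁-mono-< w ∘ mono i j)) s (balanced (mono 0F 1F (s≤s z≤n)))) ,
    (λ (f , mono , s) → pair⁻-elim (nonzero (inject₁ ∘ f)) (distinct (λ i j → inject₁-mono-< w ∘ mono i j)) s (balanced (mono 0F 1F (s≤s z≤n))))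

  Free⇒¬sts : Free w → ∀ f k (g : Fin 4 → Fin (suc m)) → (∀ i j → i Fin.< j → g i Fin.< g j) → ¬ sts (x ∘ g) ≐ Word4.word f k
  Free⇒¬sts free f k g mono s = go f (sts⇒Fits {f} {k} (nonzero g) (distinct mono) s)
    where
    free′ : ¬ (x (g 2F) < x (g 0F) × x (g 0F) < x (g 3F) × x (g 3F) < x (g 1F)) × ¬ (x (g 1F) < x (g 3F) × x (g 3F) < x (g 0F) × x (g 0F) < x (g 2F))
    free′ = free (mono 0F 1F (s≤s z≤n)) (mono 1F 2F (s≤s (s≤s z≤n))) (mono 2F 3F (s≤s (s≤s (s≤s z≤n))))
    go : ∀ f → Fits f k (x ∘ g) → ⊥
    go Sign.+ F = proj₁ free′ (Fits⇒2413 k F)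
    go Sign.- F with Fits⇒2413 k (Fits-neg⁻ F)
    ... | p , q , r = proj₂ free′ (ℤₚ.neg-cancel-< r , ℤₚ.neg-cancel-< q , ℤₚ.neg-cancel-< p)

  quad : Fin m → Fin m → Fin m → Vector ℤ 4
  quad j k l = init x j ∷ init x k ∷ init x l ∷ last x ∷ []

  -- The quadruples of condition (b) are rewritten as subwords of x, so that statements about
  -- arbitrary positions apply to them.
  quad-index : Fin m → Fin m → Fin m → Fin 4 → Fin (suc m)
  quad-index j k l = lookup (v4 (inject₁ j) (inject₁ k) (inject₁ l) top)

  quad≗ : ∀ j k l → x ∘ quad-index j k l ≗ quad j k l
  quad≗ j k l 0F = refl
  quad≗ j k l 1F = refl
  quad≗ j k l 2F = refl
  quad≗ j k l 3F = refl

  sts-cong : ∀ {r} {a b : Vector ℤ r} {p} → a ≗ b → sts a ≐ p → sts b ≐ p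
  sts-cong a≗b (v , (s , o) , v≗) = v ,
    ((λ i → subst (λ z → oneLine v i < 0ℤ ⇔ z < 0ℤ) (a≗b i) (s i)) ,
     λ i j i<j → subst₂ (λ y z → ∣ oneLine v i ∣ ℕ.< ∣ oneLine v j ∣ ⇔ ∣ y ∣ ℕ.≤ ∣ z ∣) (a≗b i) (a≗b j) (o i j i<j)) , v≗

  Free⇒¬quad : Free w → ∀ f k {i j l} → i Fin.< j → j Fin.< l → ¬ sts quad i j l ≐ Word4.word f k
  Free⇒¬quad free f k {i} {j} {l} i<j j<l s = Free⇒¬sts free f k (quad-index i j l)
    (four (inject₁-mono-< w i<j) (inject₁-mono-< w j<l) (inject₁<top w l)) (sts-cong {p = Word4.word f k} (λ i′ → sym (quad≗ i j l i′)) s)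

  unbalanced : ∀ {a b} → b ≢ 0ℤ → a + b ≢ 0ℤ → ¬ Balanced a b → (0ℤ < b × a + b < 0ℤ) ⊎ (b < 0ℤ × 0ℤ < a + b)
  unbalanced b≢0 a+b≢0 ¬b with ≢0⇒sign b≢0 | ≢0⇒sign a+b≢0
  ... | inj₁ p | inj₂ q = inj₂ (p , q)
  ... | inj₂ p | inj₁ q = inj₁ (p , q)
  ... | inj₁ p | inj₁ q = contradiction ((λ _ → q) , λ r → ⊥-elim (ℤₚ.<-asym p r)) ¬b
  ... | inj₂ p | inj₂ q = contradiction ((λ r → ⊥-elim (ℤₚ.<-asym p r)) , λ _ → q) ¬b

  conditions-intro : BalancedInit w → Free w → (∃[ i ] ¬ Balanced (x (inject₁ i)) (x top)) → ConditionA w × ConditionB w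
  conditions-intro balanced free (i , ¬b) =
    (proj₁ (BalancedInit⇒Avoids balanced) , proj₂ (BalancedInit⇒Avoids balanced) ,
      -- The word 3142 is the negative of the all-negative form of 2413, hence the sign - with
      -- `all₋`.
      avoids Sign.- all₋ , avoids Sign.+ all₊ , avoids Sign.+ all₋ , avoids Sign.- all₊) ,
    (i , pair (unbalanced {x (inject₁ i)} {x top} (oneLine-nonzero w top) (sum-nonzero (inject₁<top w i)) ¬b)) ,
    λ j k l j<k k<l →
      let ¬q = λ f κ → Free⇒¬quad free f κ j<k k<l in
      -- The forbidden lists are sorted by the sign of the last entry. Since `m₄` alone among the
      -- mixed kinds ends negatively, its negative joins `m₁`, `m₂`, `m₃` here, and in the second
      -- list the signs are exchanged.
      (λ _ → λ { (here s) → ¬q Sign.+ m₁ s ; (there (here s)) → ¬q Sign.- m₄ s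
               ; (there (there (here s))) → ¬q Sign.+ m₃ s ; (there (there (there (here s)))) → ¬q Sign.+ m₂ s }) ,
      (λ _ → λ { (here s) → ¬q Sign.- m₁ s ; (there (here s)) → ¬q Sign.+ m₄ s
               ; (there (there (here s))) → ¬q Sign.- m₃ s ; (there (there (there (here s)))) → ¬q Sign.- m₂ s })
    where
    avoids : ∀ f k → Avoids x (Word4.word f k)
    avoids f k (g , mono , s) = Free⇒¬sts free f k g mono s
    pair : (0ℤ < x top × x (inject₁ i) + x top < 0ℤ) ⊎ (x top < 0ℤ × 0ℤ < x (inject₁ i) + x top) →
           (0ℤ < x top → sts (init x i ∷ x top ∷ []) ≐ p2 (- + 2) (+ 1)) × (x top < 0ℤ → sts (init x i ∷ x top ∷ []) ≐ p2 (+ 2) (- + 1))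
    pair (inj₁ (p , q)) = (λ _ → pair⁺-intro p q) , λ r → ⊥-elim (ℤₚ.<-asym p r)
    pair (inj₂ (p , q)) = (λ r → ⊥-elim (ℤₚ.<-asym p r)) , λ _ → pair⁻-intro p q

  conditions-elim : ConditionA w × ConditionB w → BalancedInit w × Free w × ∃[ i ] ¬ Balanced (x (inject₁ i)) (x top)
  conditions-elim ((avoids⁺ , avoids⁻ , avoids-3142 , avoids-2413 , avoids-3142⁻ , avoids-2413⁻) , (i , pair⁺ , pair⁻) , quads) =
    balanced , (λ a<b b<c c<d → 2413-free a<b b<c c<d , 3142-free a<b b<c c<d) , i , ¬balanced
    where
    balanced : BalancedInit w
    balanced = Avoids⇒BalancedInit avoids⁺ avoids⁻

    pair-index : Fin 2 → Fin (suc m)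
    pair-index = lookup (inject₁ i Vec.∷ top Vec.∷ Vec.[])

    pair≗ : init x i ∷ x top ∷ [] ≗ x ∘ pair-index
    pair≗ 0F = refl
    pair≗ 1F = refl

    ¬balanced : ¬ Balanced (x (inject₁ i)) (x top)
    ¬balanced with ≢0⇒sign (oneLine-nonzero w top)
    ... | inj₂ p = pair⁺-elim (nonzero pair-index) (distinct (two (inject₁<top w i))) (sts-cong {p = p2 (- + 2) (+ 1)} pair≗ (pair⁺ p))
    ... | inj₁ p = pair⁻-elim (nonzero pair-index) (distinct (two (inject₁<top w i))) (sts-cong {p = p2 (+ 2) (- + 1)} pair≗ (pair⁻ p))

    ¬uniform : ∀ f {k} → Uniform k → ∀ g → (∀ i j → i Fin.< j → g i Fin.< g j) → ¬ Fits f k (x ∘ g)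
    ¬uniform Sign.+ all₊ g mono F = avoids-2413 (g , mono , Fits⇒sts {Sign.+} {all₊} F)
    ¬uniform Sign.- all₊ g mono F = avoids-2413⁻ (g , mono , Fits⇒sts {Sign.-} {all₊} F)
    ¬uniform Sign.+ all₋ g mono F = avoids-3142⁻ (g , mono , Fits⇒sts {Sign.+} {all₋} F)
    ¬uniform Sign.- all₋ g mono F = avoids-3142 (g , mono , Fits⇒sts {Sign.-} {all₋} F)

    ¬quad : ∀ f k {j l r} → j Fin.< l → l Fin.< r → ¬ Fits f k (x ∘ quad-index j l r)
    ¬quad f all₊ {j} {l} {r} j<l l<r F = ¬uniform f all₊ (quad-index j l r) (four (inject₁-mono-< w j<l) (inject₁-mono-< w l<r) (inject₁<top w r)) F
    ¬quad f all₋ {j} {l} {r} j<l l<r F = ¬uniform f all₋ (quad-index j l r) (four (inject₁-mono-< w j<l) (inject₁-mono-< w l<r) (inject₁<top w r)) F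
    ¬quad Sign.+ m₁ {j} {l} {r} j<l l<r F = proj₁ (quads j l r j<l l<r) (Fits.sign F 3F) (here (Fits⇒sts {Sign.+} {m₁} (Fits-cong (quad≗ j l r) F)))
    ¬quad Sign.- m₄ {j} {l} {r} j<l l<r F = proj₁ (quads j l r j<l l<r) (Fits.sign F 3F) (there (here (Fits⇒sts {Sign.-} {m₄} (Fits-cong (quad≗ j l r) F))))
    ¬quad Sign.+ m₃ {j} {l} {r} j<l l<r F = proj₁ (quads j l r j<l l<r) (Fits.sign F 3F) (there (there (here (Fits⇒sts {Sign.+} {m₃} (Fits-cong (quad≗ j l r) F)))))
    ¬quad Sign.+ m₂ {j} {l} {r} j<l l<r F = proj₁ (quads j l r j<l l<r) (Fits.sign F 3F) (there (there (there (here (Fits⇒sts {Sign.+} {m₂} (Fits-cong (quad≗ j l r) F))))))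
    ¬quad Sign.- m₁ {j} {l} {r} j<l l<r F = proj₂ (quads j l r j<l l<r) (Fits.sign F 3F) (here (Fits⇒sts {Sign.-} {m₁} (Fits-cong (quad≗ j l r) F)))
    ¬quad Sign.+ m₄ {j} {l} {r} j<l l<r F = proj₂ (quads j l r j<l l<r) (Fits.sign F 3F) (there (here (Fits⇒sts {Sign.+} {m₄} (Fits-cong (quad≗ j l r) F))))
    ¬quad Sign.- m₃ {j} {l} {r} j<l l<r F = proj₂ (quads j l r j<l l<r) (Fits.sign F 3F) (there (there (here (Fits⇒sts {Sign.-} {m₃} (Fits-cong (quad≗ j l r) F)))))
    ¬quad Sign.- m₂ {j} {l} {r} j<l l<r F = proj₂ (quads j l r j<l l<r) (Fits.sign F 3F) (there (there (there (here (Fits⇒sts {Sign.-} {m₂} (Fits-cong (quad≗ j l r) F))))))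

    inner⇒uniform : ∀ f {k} {a : Vector ℤ 4} → Fits f k a → Balanced (a 1F) (a 3F) → Balanced (a 2F) (a 3F) → Uniform k
    inner⇒uniform Sign.+ F bd cd = balanced⇒uniform F bd cd
    inner⇒uniform Sign.- {a = a} F bd cd = balanced⇒uniform (Fits-neg⁻ F) (Balanced-neg {a 1F} bd) (Balanced-neg {a 2F} cd)

    -- If d is the last position, the lists of (b) exclude the mixed kinds. If not, all the pairs
    -- involved are balanced, so the kind is uniform. Uniform kinds are excluded by (a) everywhere.
    ¬fits : ∀ f k {a b c d} → a Fin.< b → b Fin.< c → c Fin.< d → ¬ Fits f k (x ∘ lookup (v4 a b c d))
    ¬fits f k {a} {b} {c} {d} a<b b<c c<d F with lower w a<b | lower w b<c | lower w c<d | view d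
    ... | a′ , refl | b′ , refl | c′ , refl | ‵fromℕ = ¬quad f k (inject₁-cancel-< w a<b) (inject₁-cancel-< w b<c) F
    ... | _ | b′ , refl | c′ , refl | ‵inject₁ d′ = ¬uniform f (inner⇒uniform f F
            (balanced (inject₁-cancel-< w (ℕₚ.<-trans b<c c<d))) (balanced (inject₁-cancel-< w c<d))) _ (four a<b b<c c<d) F

    module _ {a b c d : Fin (suc m)} (a<b : a Fin.< b) (b<c : b Fin.< c) (c<d : c Fin.< d) where
      balanced′ : ∀ {p q r} → p Fin.< q → q Fin.< r → Balanced (x p) (x q)
      balanced′ p<q q<r with lower w p<q | lower w q<r
      ... | p′ , refl | q′ , refl = balanced (inject₁-cancel-< w p<q)

      a+d≢0 : x a + x d ≢ 0ℤ
      a+d≢0 = sum-nonzero (ℕₚ.<-trans a<b (ℕₚ.<-trans b<c c<d))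

      2413-free : ¬ (x c < x a × x a < x d × x d < x b)
      2413-free (p , q , r) with 2413⇒Fits (oneLine-nonzero w a) (oneLine-nonzero w b) (oneLine-nonzero w c) (oneLine-nonzero w d) a+d≢0
        (balanced′ a<b b<c) (balanced′ b<c c<d) p q r
      ... | k , F = ¬fits Sign.+ k a<b b<c c<d (Fits-cong (λ { 0F → refl ; 1F → refl ; 2F → refl ; 3F → refl }) F)

      -‿nonzero : ∀ {z} → z ≢ 0ℤ → - z ≢ 0ℤ
      -‿nonzero z≢0 p = z≢0 (ℤₚ.neg-injective p)

      3142-free : ¬ (x b < x d × x d < x a × x a < x c)
      3142-free (p , q , r) with 2413⇒Fits (-‿nonzero (oneLine-nonzero w a)) (-‿nonzero (oneLine-nonzero w b)) (-‿nonzero (oneLine-nonzero w c)) (-‿nonzero (oneLine-nonzero w d))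
        (λ s → -‿nonzero a+d≢0 (trans (ℤₚ.neg-distrib-+ (x a) (x d)) s))
        (Balanced-neg {x a} (balanced′ a<b b<c)) (Balanced-neg {x b} (balanced′ b<c c<d)) (ℤₚ.neg-mono-< r) (ℤₚ.neg-mono-< q) (ℤₚ.neg-mono-< p)
      ... | k , F = ¬fits Sign.- k a<b b<c c<d (Fits-neg (Fits-cong (λ { 0F → refl ; 1F → refl ; 2F → refl ; 3F → refl }) F))

lemma3p7 : ∀ (m : ℕ) → 2 ℕ.≤ suc m → (w : 𝔅 (suc m)) →
    MinimalNonSeparable w ⇔ (ConditionA w × ConditionB w)
lemma3p7 m _ w = mk⇔
  (λ s → let balanced , free , b = Equivalence.to (minimal⇔ w) s in conditions-intro w balanced free b)
  (λ c → Equivalence.from (minimal⇔ w) (conditions-elim w c))
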